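{- Let $\lambda \geq 2$ be an integer. Then there exists a constant $C(\lambda)$, depending only on $\lambda$, such that for every sesqui-regular graph $G$ with parameters $(v,k,c)$, if $\lambda_{\min}(G) \geq -\lambda$ and $k \geq C(\lambda)$, then at least one of the following holds: (i) $c \leq \lambda^2(\lambda-1)$; (ii) $v-k-1 \leq \frac{(\lambda-1)^2}{4}+1$.
   Context: All graphs are finite, simple and undirected. A sesqui-regular graph with parameters $(v,k,c)$ is a $k$-regular graph on $v$ vertices such that any two vertices at distance $2$ have exactly $c$ common neighbours. $\lambda_{\min}(G)$ denotes the smallest eigenvalue of the adjacency matrix of $G$.
   Formalization: The graph G is additionally assumed connected; without this the claim fails, e.g. for two disjoint copies of a large cocktail party graph (k = c = 2n-2, smallest eigenvalue -2, v-k-1 = 2n+1). -}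

module Defs where

open import Data.Bool.Base using (Bool; true; false; if_then_else_)
open import Data.Fin.Base using (Fin)
open import Data.Fin.Subset using (Subset; _∩_; ∣_∣)
open import Data.Integer.Base as ℤ using (ℤ)
open import Data.Nat.Base as ℕ using (ℕ; zero; suc)
import Data.Nat.Properties as ℕ
open import Data.Product.Base using (Σ; ∃; _×_; _,_)
open import Data.Rational.Base as ℚ using (ℚ; 0ℚ; 1ℚ; ½; Positive; NonNegative)
import Data.Rational.Properties as ℚ
open import Data.Rational.Solver using (module +-*-Solver)
open import Data.Vec.Base using (tabulate)
open import Data.Vec.Functional using (Vector; foldr)
open import Relation.Binary.PropositionalEquality using (_≡_; refl; sym; trans; cong; subst)
open import Relation.Nullary.Negation.Core using (¬_)

-- Real numbers: Cauchy sequences of rationals, compared up to ≃.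

IsCauchy : (ℕ → ℚ) → Set
IsCauchy s = ∀ ε → Positive ε →
  Σ ℕ λ N → ∀ m n → N ℕ.≤ m → N ℕ.≤ n → ℚ.∣ s m ℚ.- s n ∣ ℚ.≤ ε

record ℝ : Set where
  constructor mkℝ
  field
    seq      : ℕ → ℚ
    isCauchy : IsCauchy seq
open ℝ public

infix 4 _≃_ _≤ᴿ_

_≃_ : ℝ → ℝ → Set
x ≃ y = ∀ ε → Positive ε →
  Σ ℕ λ N → ∀ n → N ℕ.≤ n → ℚ.∣ seq x n ℚ.- seq y n ∣ ℚ.≤ ε

_≤ᴿ_ : ℝ → ℝ → Set
x ≤ᴿ y = ∀ ε → Positive ε →
  Σ ℕ λ N → ∀ n → N ℕ.≤ n → seq x n ℚ.≤ seq y n ℚ.+ ε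

fromℚ : ℚ → ℝ
fromℚ q = mkℝ (λ _ → q) λ ε ε>0 → 0 , λ _ _ _ _ →
  subst (λ z → ℚ.∣ z ∣ ℚ.≤ ε) (sym (ℚ.+-inverseʳ q))
    (ℚ.nonNegative⁻¹ ε {{ℚ.pos⇒nonNeg ε {{ε>0}}}})

fromℤ : ℤ → ℝ
fromℤ i = fromℚ (i ℚ./ 1)

0ℝ 1ℝ : ℝ
0ℝ = fromℚ 0ℚ
1ℝ = fromℚ 1ℚ

private
  EventuallyBounded : ℝ → Set
  EventuallyBounded x = Σ ℚ λ B → Positive B ×
    Σ ℕ λ N → ∀ n → N ℕ.≤ n → ℚ.∣ seq x n ∣ ℚ.≤ B

  eventually-bounded : ∀ x → EventuallyBounded x
  eventually-bounded x with isCauchy x 1ℚ _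
  ... | N , p = B , B>0 , N , λ n N≤n → begin
      ℚ.∣ seq x n ∣                    ≡⟨ cong ℚ.∣_∣ (split (seq x n) a) ⟩
      ℚ.∣ (seq x n ℚ.- a) ℚ.+ a ∣      ≤⟨ ℚ.∣p+q∣≤∣p∣+∣q∣ (seq x n ℚ.- a) a ⟩
      ℚ.∣ seq x n ℚ.- a ∣ ℚ.+ ℚ.∣ a ∣  ≤⟨ ℚ.+-monoˡ-≤ ℚ.∣ a ∣ (p n N N≤n ℕ.≤-refl) ⟩
      1ℚ ℚ.+ ℚ.∣ a ∣                   ∎
    where
    open ℚ.≤-Reasoning
    a = seq x N
    B = 1ℚ ℚ.+ ℚ.∣ a ∣
    B>0 : Positive B
    B>0 = ℚ.pos+nonNeg⇒pos 1ℚ ℚ.∣ a ∣ {{ℚ.∣-∣-nonNeg a}}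
    split : ∀ u w → u ≡ (u ℚ.- w) ℚ.+ w
    split = solve 2 (λ u w → u := (u :- w) :+ w) refl
      where open +-*-Solver

  Share : ℚ → ℚ → ℚ → Set
  Share A B ε = Σ ℚ λ δ → Positive δ × A ℚ.* δ ℚ.+ B ℚ.* δ ≡ ε

  share : ∀ A B ε → Positive A → Positive B → Positive ε →
    Share A B ε
  share A B ε A>0 B>0 ε>0 = divide (A ℚ.+ B) (ℚ.pos+pos⇒pos A {{A>0}} B {{B>0}}) refl
    where
    divide : ∀ T → Positive T → A ℚ.+ B ≡ T →
      Share A B ε
    divide T T>0 eq =
      T⁻¹ ℚ.* ε ,
      ℚ.pos*pos⇒pos T⁻¹ {{ℚ.1/pos⇒pos T {{T>0}}}} ε {{ε>0}} ,
      trans (sym (ℚ.*-distribʳ-+ (T⁻¹ ℚ.* ε) A B))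
        (trans (cong (ℚ._* (T⁻¹ ℚ.* ε)) eq)
          (trans (sym (ℚ.*-assoc T T⁻¹ ε))
            (trans (cong (ℚ._* ε) (ℚ.*-inverseʳ T {{T≢0}})) (ℚ.*-identityˡ ε))))
      where
      T≢0 : ℚ.NonZero T
      T≢0 = ℚ.pos⇒nonZero T {{T>0}}
      T⁻¹ = ℚ.1/_ T {{T≢0}}

  *-bound : ∀ a b A B → NonNegative A → ℚ.∣ a ∣ ℚ.≤ A → ℚ.∣ b ∣ ℚ.≤ B →
            ℚ.∣ a ℚ.* b ∣ ℚ.≤ A ℚ.* B
  *-bound a b A B A≥0 a≤A b≤B = begin
    ℚ.∣ a ℚ.* b ∣        ≡⟨ ℚ.∣p*q∣≡∣p∣*∣q∣ a b ⟩
    ℚ.∣ a ∣ ℚ.* ℚ.∣ b ∣  ≤⟨ ℚ.*-monoʳ-≤-nonNeg ℚ.∣ b ∣ {{ℚ.∣-∣-nonNeg b}} a≤A ⟩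
    A ℚ.* ℚ.∣ b ∣        ≤⟨ ℚ.*-monoˡ-≤-nonNeg A {{A≥0}} b≤B ⟩
    A ℚ.* B              ∎
    where open ℚ.≤-Reasoning

  *-close : ∀ a b c d A B δ ε → Positive A → Positive B →
    A ℚ.* δ ℚ.+ B ℚ.* δ ≡ ε → ℚ.∣ a ∣ ℚ.≤ A → ℚ.∣ d ∣ ℚ.≤ B →
    ℚ.∣ a ℚ.- c ∣ ℚ.≤ δ → ℚ.∣ b ℚ.- d ∣ ℚ.≤ δ →
    ℚ.∣ a ℚ.* b ℚ.- c ℚ.* d ∣ ℚ.≤ ε
  *-close a b c d A B δ ε A>0 B>0 collect a≤A d≤B a-c≤δ b-d≤δ = begin
    ℚ.∣ a ℚ.* b ℚ.- c ℚ.* d ∣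
      ≡⟨ cong ℚ.∣_∣ (regroup a b c d) ⟩
    ℚ.∣ a ℚ.* (b ℚ.- d) ℚ.+ d ℚ.* (a ℚ.- c) ∣
      ≤⟨ ℚ.∣p+q∣≤∣p∣+∣q∣ (a ℚ.* (b ℚ.- d)) (d ℚ.* (a ℚ.- c)) ⟩
    ℚ.∣ a ℚ.* (b ℚ.- d) ∣ ℚ.+ ℚ.∣ d ℚ.* (a ℚ.- c) ∣
      ≤⟨ ℚ.+-mono-≤ (*-bound a (b ℚ.- d) A δ (ℚ.pos⇒nonNeg A {{A>0}}) a≤A b-d≤δ)
                    (*-bound d (a ℚ.- c) B δ (ℚ.pos⇒nonNeg B {{B>0}}) d≤B a-c≤δ) ⟩
    A ℚ.* δ ℚ.+ B ℚ.* δ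
      ≡⟨ collect ⟩
    ε ∎
    where
    open ℚ.≤-Reasoning
    regroup : ∀ a b c d → a ℚ.* b ℚ.- c ℚ.* d ≡ a ℚ.* (b ℚ.- d) ℚ.+ d ℚ.* (a ℚ.- c)
    regroup = solve 4 (λ a b c d → a :* b :- c :* d := a :* (b :- d) :+ d :* (a :- c)) refl
      where open +-*-Solver

  *-cauchy : ∀ x y → EventuallyBounded x → EventuallyBounded y →
    IsCauchy (λ n → seq x n ℚ.* seq y n)
  *-cauchy x y (A , A>0 , K , bx) (B , B>0 , L , by) ε ε>0 =
    fromShare (share A B ε A>0 B>0 ε>0)
    where
    fromShare : Share A B ε → Σ ℕ λ N → ∀ m n → N ℕ.≤ m → N ℕ.≤ n →
      ℚ.∣ seq x m ℚ.* seq y m ℚ.- seq x n ℚ.* seq y n ∣ ℚ.≤ ε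
    fromShare (δ , δ>0 , collect) with isCauchy x δ δ>0 | isCauchy y δ δ>0
    ... | N , p | M , q = (K ℕ.⊔ L) ℕ.⊔ (N ℕ.⊔ M) , λ m n m≥ n≥ →
        *-close (seq x m) (seq y m) (seq x n) (seq y n) A B δ ε A>0 B>0 collect
          (bx m (ℕ.m⊔n≤o⇒m≤o K L (left m≥))) (by n (ℕ.m⊔n≤o⇒n≤o K L (left n≥)))
          (p m n (ℕ.m⊔n≤o⇒m≤o N M (right m≥)) (ℕ.m⊔n≤o⇒m≤o N M (right n≥)))
          (q m n (ℕ.m⊔n≤o⇒n≤o N M (right m≥)) (ℕ.m⊔n≤o⇒n≤o N M (right n≥)))
      where
      left : ∀ {i} → (K ℕ.⊔ L) ℕ.⊔ (N ℕ.⊔ M) ℕ.≤ i → K ℕ.⊔ L ℕ.≤ i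
      left = ℕ.m⊔n≤o⇒m≤o (K ℕ.⊔ L) (N ℕ.⊔ M)
      right : ∀ {i} → (K ℕ.⊔ L) ℕ.⊔ (N ℕ.⊔ M) ℕ.≤ i → N ℕ.⊔ M ℕ.≤ i
      right = ℕ.m⊔n≤o⇒n≤o (K ℕ.⊔ L) (N ℕ.⊔ M)

infixl 6 _+ᴿ_
infixl 7 _*ᴿ_

_+ᴿ_ : ℝ → ℝ → ℝ
x +ᴿ y = mkℝ s cauchy
  where
  open ℚ.≤-Reasoning
  s : ℕ → ℚ
  s n = seq x n ℚ.+ seq y n
  regroup : ∀ a b c d → (a ℚ.+ b) ℚ.- (c ℚ.+ d) ≡ (a ℚ.- c) ℚ.+ (b ℚ.- d)
  regroup = solve 4 (λ a b c d → (a :+ b) :- (c :+ d) := (a :- c) :+ (b :- d)) refl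
    where open +-*-Solver
  halves : ∀ ε → ½ ℚ.* ε ℚ.+ ½ ℚ.* ε ≡ ε
  halves ε = trans (sym (ℚ.*-distribʳ-+ ε ½ ½)) (ℚ.*-identityˡ ε)
  cauchy : IsCauchy s
  cauchy ε ε>0
    with isCauchy x (½ ℚ.* ε) (ℚ.pos*pos⇒pos ½ ε {{ε>0}})
       | isCauchy y (½ ℚ.* ε) (ℚ.pos*pos⇒pos ½ ε {{ε>0}})
  ... | N , p | M , q = N ℕ.⊔ M , λ m n m≥ n≥ → begin
      ℚ.∣ s m ℚ.- s n ∣
        ≡⟨ cong ℚ.∣_∣ (regroup (seq x m) (seq y m) (seq x n) (seq y n)) ⟩
      ℚ.∣ (seq x m ℚ.- seq x n) ℚ.+ (seq y m ℚ.- seq y n) ∣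
        ≤⟨ ℚ.∣p+q∣≤∣p∣+∣q∣ (seq x m ℚ.- seq x n) (seq y m ℚ.- seq y n) ⟩
      ℚ.∣ seq x m ℚ.- seq x n ∣ ℚ.+ ℚ.∣ seq y m ℚ.- seq y n ∣
        ≤⟨ ℚ.+-mono-≤ (p m n (ℕ.m⊔n≤o⇒m≤o N M m≥) (ℕ.m⊔n≤o⇒m≤o N M n≥))
                      (q m n (ℕ.m⊔n≤o⇒n≤o N M m≥) (ℕ.m⊔n≤o⇒n≤o N M n≥)) ⟩
      ½ ℚ.* ε ℚ.+ ½ ℚ.* ε
        ≡⟨ halves ε ⟩
      ε ∎

_*ᴿ_ : ℝ → ℝ → ℝ
x *ᴿ y = mkℝ (λ n → seq x n ℚ.* seq y n) (*-cauchy x y (eventually-bounded x) (eventually-bounded y))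

Matrix : ℕ → Set
Matrix n = Fin n → Fin n → ℝ

_·_ : ∀ {n} → Matrix n → Vector ℝ n → Vector ℝ n
(M · x) i = foldr _+ᴿ_ 0ℝ (λ j → M i j *ᴿ x j)

-- Only real eigenvalues are considered; a real symmetric matrix has no others.

IsEigenvalue : ∀ {n} → Matrix n → ℝ → Set
IsEigenvalue {n} M θ = Σ (Vector ℝ n) λ x →
  ¬ (∀ i → x i ≃ 0ℝ) × (∀ i → (M · x) i ≃ θ *ᴿ x i)

IsSmallestEigenvalue : ∀ {n} → Matrix n → ℝ → Set
IsSmallestEigenvalue M θ = IsEigenvalue M θ × (∀ μ → IsEigenvalue M μ → θ ≤ᴿ μ)

record Graph (v : ℕ) : Set where
  field
    adj    : Fin v → Fin v → Bool
    symm   : ∀ x y → adj x y ≡ adj y x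
    irrefl : ∀ x → adj x x ≡ false

module _ {v : ℕ} (G : Graph v) where
  open Graph G

  neighbours : Fin v → Subset v
  neighbours x = tabulate (adj x)

  data Walk : ℕ → Fin v → Fin v → Set where
    nil  : ∀ {x} → Walk zero x x
    cons : ∀ {n x y z} → adj x y ≡ true → Walk n y z → Walk (suc n) x z

  Distance : Fin v → Fin v → ℕ → Set
  Distance x y d = Walk d x y × (∀ n → Walk n x y → d ℕ.≤ n)

  Connected : Set
  Connected = ∀ x y → ∃ λ n → Walk n x y

  adjacencyMatrix : Matrix v
  adjacencyMatrix x y = if adj x y then 1ℝ else 0ℝ

  record SesquiRegular (k c : ℕ) : Set where
    field
      regular : ∀ x → ∣ neighbours x ∣ ≡ k
      common  : ∀ x y → Distance x y 2 → ∣ neighbours x ∩ neighbours y ∣ ≡ c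

{-# OPTIONS --safe #-}

-- Positive semidefiniteness of A + l I.  Were A + l I indefinite, bisection on t
-- between matrices A - t I that are positive semidefinite and matrices that are
-- not (decidable over ℚ) would converge to a μ < -l for which A - μ I is singular,
-- that is, to an eigenvalue below -l.
--
-- Hence zᵀ (A + l I) z ≥ 0 for all integer vectors z, and everything else comes
-- from four kinds of test vectors:
--   * a neighbourhood has no independent set of size l² + 1, so by Ramsey's
--     theorem large sets of neighbours contain large cliques;
--   * a vertex has at most l(l-1) neighbours or a bounded number of
--     non-neighbours in a clique;
--   * a vertex y lying in l large, nearly independent cliques has no neighbour
--     outside them ("fan");
--   * Alon–Boppana for the complement.
--
-- If c is large, the cliques in the common neighbourhoods of x and vertices at
-- distance 2 form a fan at x, which bounds the number of vertices at distance 2;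
-- distance 3 is then impossible, so v - k - 1 is bounded, and as v is huge the
-- Alon–Boppana bound for the complement gives (l-1)² ≥ 4 (v - k - 2).
--
-- If c is bounded, large maximal cliques ("lines") are such that a vertex has at
-- most l(l-1) neighbours on a line not through it.  The neighbourhood of y is
-- covered by l lines, or by l-1 lines and boundedly many further vertices; in the
-- second case, a generic vertex u on a line through an uncovered neighbour of y
-- sees the uncovered neighbours of y only on that line.  Either way
-- c ≤ l · l(l-1).
module Submission where

-- Real numbers enter only to turn the eigenvalue hypothesis into one about rational vectors.
-- Whether a pivot tends to zero is undecidable for Cauchy sequences, so the eigenvalue found by
-- bisection exists only up to double negation; this suffices, since it serves to refute a strict
-- inequality between rationals. Afterwards test vectors are differences of multisets, so that both
-- sides of every inequality stay in ℕ. Each test vector is tuned so that its terms of highest order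
-- nearly cancel: one excess neighbour makes the leading coefficient negative, and a large enough
-- clique is then contradictory. This is why the exact value l(l-1) appears, while the other
-- constants are generous. The boundary `M` between large and bounded c must depend on l alone, and
-- bounded c needs lines longer than c; hence the constants are fixed in the order `q`, `M`, `m₀`,
-- `m₁`, `C`. In the Alon-Boppana step the vector has to be made orthogonal to the constants. This
-- costs a term of order 1/v, which only a huge v makes negligible.

open import Defs

-- Quadratic forms over ℚ and the decidability of semidefiniteness.

module RationalForms where

  open import Data.Fin.Base using (Fin; zero; suc)
  open import Data.Fin.Properties using (all?)
  open import Data.Nat.Base as ℕ using (ℕ; zero; suc)
  open import Data.Rational.Base
  open import Data.Rational.Properties
  open import Data.Rational.Solver using (module +-*-Solver)
  open import Data.Sum.Base using (inj₁; inj₂)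
  open import Data.Vec.Functional using (Vector; foldr; _∷_)
  open import Relation.Binary.Definitions using (tri<; tri≈; tri>)
  open import Relation.Binary.PropositionalEquality using (_≡_; refl; sym; trans; cong; cong₂; subst; module ≡-Reasoning)
  open import Relation.Nullary using (Dec; yes; no; contradiction)
  open import Relation.Nullary.Decidable using (map′)
  open +-*-Solver using (solve; _:=_; _:+_; _:*_; _:-_; :-_; con)

  0≤p*q : ∀ {p q} → 0ℚ ≤ p → 0ℚ ≤ q → 0ℚ ≤ p * q
  0≤p*q {p} {q} 0≤p 0≤q =
    nonNegative⁻¹ (p * q) {{nonNeg*nonNeg⇒nonNeg p {{nonNegative 0≤p}} q {{nonNegative 0≤q}}}}

  0≤p+q : ∀ {p q} → 0ℚ ≤ p → 0ℚ ≤ q → 0ℚ ≤ p + q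
  0≤p+q = +-mono-≤

  0≤p*p : ∀ p → 0ℚ ≤ p * p
  0≤p*p p with ≤-total 0ℚ p
  ... | inj₁ 0≤p = 0≤p*q 0≤p 0≤p
  ... | inj₂ p≤0 = subst (0ℚ ≤_) (solve 1 (λ p → (:- p) :* (:- p) := p :* p) refl p)
                     (0≤p*q (neg-antimono-≤ p≤0) (neg-antimono-≤ p≤0))

  p≤∣p∣ : ∀ p → p ≤ ∣ p ∣
  p≤∣p∣ p with ≤-total 0ℚ p
  ... | inj₁ 0≤p = ≤-reflexive (sym (0≤p⇒∣p∣≡p 0≤p))
  ... | inj₂ p≤0 = ≤-trans p≤0 (0≤∣p∣ p)

  ∣p∣≤q : ∀ {p q} → p ≤ q → - p ≤ q → ∣ p ∣ ≤ q
  ∣p∣≤q {p} p≤q -p≤q with ∣p∣≡p∨∣p∣≡-p p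
  ... | inj₁ eq = subst (_≤ _) (sym eq) p≤q
  ... | inj₂ eq = subst (_≤ _) (sym eq) -p≤q

  0≤q-p⇒p≤q : ∀ {p q} → 0ℚ ≤ q - p → p ≤ q
  0≤q-p⇒p≤q {p} {q} h = begin
    p             ≡⟨ sym (+-identityˡ p) ⟩
    0ℚ + p        ≤⟨ +-monoˡ-≤ p h ⟩
    (q - p) + p   ≡⟨ solve 2 (λ p q → (q :- p) :+ p := q) refl p q ⟩
    q             ∎
    where open ≤-Reasoning

  p≤q⇒0≤q-p : ∀ {p q} → p ≤ q → 0ℚ ≤ q - p
  p≤q⇒0≤q-p {p} {q} h = begin
    0ℚ     ≡⟨ sym (+-inverseʳ p) ⟩
    p - p  ≤⟨ +-monoˡ-≤ (- p) h ⟩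
    q - p  ∎
    where open ≤-Reasoning

  ∑ : ∀ {n} → Vector ℚ n → ℚ
  ∑ = foldr _+_ 0ℚ

  ∑-cong : ∀ {n} {f g : Vector ℚ n} → (∀ i → f i ≡ g i) → ∑ f ≡ ∑ g
  ∑-cong {zero}  h = refl
  ∑-cong {suc n} h = cong₂ _+_ (h zero) (∑-cong (λ i → h (suc i)))

  ∑-linear : ∀ {n} a b (f g : Vector ℚ n) → ∑ (λ i → a * f i + b * g i) ≡ a * ∑ f + b * ∑ g
  ∑-linear {zero} a b f g = solve 2 (λ a b → con 0ℚ := a :* con 0ℚ :+ b :* con 0ℚ) refl a b
  ∑-linear {suc n} a b f g = trans (cong (a * f zero + b * g zero +_) (∑-linear a b (λ i → f (suc i)) (λ i → g (suc i))))
    (solve 6 (λ a b p q P Q → (a :* p :+ b :* q) :+ (a :* P :+ b :* Q) := a :* (p :+ P) :+ b :* (q :+ Q))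
      refl a b (f zero) (g zero) (∑ (λ i → f (suc i))) (∑ (λ i → g (suc i))))

  ∑-scale : ∀ {n} a (f : Vector ℚ n) → ∑ (λ i → a * f i) ≡ a * ∑ f
  ∑-scale {zero}  a f = sym (*-zeroʳ a)
  ∑-scale {suc n} a f = trans (cong (a * f zero +_) (∑-scale a (λ i → f (suc i)))) (sym (*-distribˡ-+ a _ _))

  ∑-zero : ∀ {n} (f : Vector ℚ n) → (∀ i → f i ≡ 0ℚ) → ∑ f ≡ 0ℚ
  ∑-zero {zero}  f h = refl
  ∑-zero {suc n} f h = cong₂ _+_ (h zero) (∑-zero _ (λ i → h (suc i)))

  ∑-nonneg : ∀ {n} (f : Vector ℚ n) → (∀ i → 0ℚ ≤ f i) → 0ℚ ≤ ∑ f
  ∑-nonneg {zero}  f h = ≤-refl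
  ∑-nonneg {suc n} f h = 0≤p+q (h zero) (∑-nonneg _ (λ i → h (suc i)))

  δ : ∀ {n} → Fin n → Vector ℚ n
  δ zero    zero    = 1ℚ
  δ zero    (suc _) = 0ℚ
  δ (suc _) zero    = 0ℚ
  δ (suc i) (suc j) = δ i j

  ∑-δ : ∀ {n} (f : Vector ℚ n) j → ∑ (λ i → f i * δ j i) ≡ f j
  ∑-δ f zero = trans (cong₂ _+_ (*-identityʳ (f zero)) (∑-zero _ (λ i → *-zeroʳ (f (suc i))))) (+-identityʳ (f zero))
  ∑-δ f (suc j) = trans (cong₂ _+_ (*-zeroʳ (f zero)) (∑-δ (λ i → f (suc i)) j)) (+-identityˡ (f (suc j)))

  Mat : ℕ → Set
  Mat n = Fin n → Fin n → ℚ

  infixl 7 _∙_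
  _∙_ : ∀ {n} → Vector ℚ n → Vector ℚ n → ℚ
  x ∙ y = ∑ (λ i → x i * y i)

  mul : ∀ {n} → Mat n → Vector ℚ n → Vector ℚ n
  mul M x i = M i ∙ x

  form : ∀ {n} → Mat n → Vector ℚ n → ℚ
  form M x = x ∙ mul M x

  PSD : ∀ {n} → Mat n → Set
  PSD M = ∀ x → 0ℚ ≤ form M x

  Symmetric : ∀ {n} → Mat n → Set
  Symmetric M = ∀ i j → M i j ≡ M j i

  minor : ∀ {n} → Mat (suc n) → Mat n
  minor M i j = M (suc i) (suc j)

  row : ∀ {n} → Mat (suc n) → Vector ℚ n
  row M j = M zero (suc j)

  -- The Schur complement of the corner entry, scaled by that entry to avoid division.
  schur : ∀ {n} → Mat (suc n) → Mat n
  schur M i j = M zero zero * minor M i j + (- 1ℚ) * (row M i * row M j)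

  schur-symmetric : ∀ {n} (M : Mat (suc n)) → Symmetric M → Symmetric (schur M)
  schur-symmetric M s i j = cong₂ (λ p q → M zero zero * p + (- 1ℚ) * q) (s (suc i) (suc j)) (*-comm (row M i) (row M j))

  mul-schur : ∀ {n} (M : Mat (suc n)) y i →
    mul (schur M) y i ≡ M zero zero * mul (minor M) y i - row M i * (row M ∙ y)
  mul-schur M y i = begin
    ∑ (λ j → (a * N j + (- 1ℚ) * (b i * b j)) * y j)
      ≡⟨ ∑-cong (λ j → solve 5 (λ a n p q y → (a :* n :+ con (- 1ℚ) :* (p :* q)) :* y := a :* (n :* y) :+ (:- p) :* (q :* y))
           refl a (N j) (b i) (b j) (y j)) ⟩
    ∑ (λ j → a * (N j * y j) + (- b i) * (b j * y j))
      ≡⟨ ∑-linear a (- b i) (λ j → N j * y j) (λ j → b j * y j) ⟩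
    a * (N ∙ y) + (- b i) * (b ∙ y)
      ≡⟨ solve 4 (λ a p q r → a :* p :+ (:- q) :* r := a :* p :- q :* r) refl a (N ∙ y) (b i) (b ∙ y) ⟩
    a * (N ∙ y) - b i * (b ∙ y) ∎
    where
    open ≡-Reasoning
    a = M zero zero
    b = row M
    N = minor M i

  form-schur : ∀ {n} (M : Mat (suc n)) y →
    form (schur M) y ≡ M zero zero * form (minor M) y - (row M ∙ y) * (row M ∙ y)
  form-schur M y = begin
    ∑ (λ i → y i * mul (schur M) y i)
      ≡⟨ ∑-cong (λ i → trans (cong (y i *_) (mul-schur M y i))
           (solve 5 (λ y a p q r → y :* (a :* p :- q :* r) := a :* (y :* p) :+ (:- r) :* (q :* y))
             refl (y i) a (mul (minor M) y i) (row M i) β)) ⟩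
    ∑ (λ i → a * (y i * mul (minor M) y i) + (- β) * (row M i * y i))
      ≡⟨ ∑-linear a (- β) (λ i → y i * mul (minor M) y i) (λ i → row M i * y i) ⟩
    a * form (minor M) y + (- β) * β
      ≡⟨ solve 3 (λ a p r → a :* p :+ (:- r) :* r := a :* p :- r :* r) refl a (form (minor M) y) β ⟩
    a * form (minor M) y - β * β ∎
    where
    open ≡-Reasoning
    a = M zero zero
    β = row M ∙ y

  form-suc : ∀ {n} (M : Mat (suc n)) → Symmetric M → ∀ s y →
    form M (s ∷ y) ≡ s * (M zero zero * s + row M ∙ y) + (s * (row M ∙ y) + form (minor M) y)
  form-suc M sm s y = cong (s * (M zero zero * s + row M ∙ y) +_) (begin
    ∑ (λ i → y i * (M (suc i) zero * s + mul (minor M) y i))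
      ≡⟨ ∑-cong (λ i → trans (cong (λ z → y i * (z * s + mul (minor M) y i)) (sm (suc i) zero))
          (solve 4 (λ y b s r → y :* (b :* s :+ r) := s :* (b :* y) :+ con 1ℚ :* (y :* r)) refl
             (y i) (row M i) s (mul (minor M) y i))) ⟩
    ∑ (λ i → s * (row M i * y i) + 1ℚ * (y i * mul (minor M) y i))
      ≡⟨ ∑-linear s 1ℚ (λ i → row M i * y i) (λ i → y i * mul (minor M) y i) ⟩
    s * (row M ∙ y) + 1ℚ * form (minor M) y
      ≡⟨ cong (s * (row M ∙ y) +_) (*-identityˡ _) ⟩
    s * (row M ∙ y) + form (minor M) y ∎)
    where open ≡-Reasoning

  form-cong : ∀ {n} (M : Mat n) {x y} → (∀ i → x i ≡ y i) → form M x ≡ form M y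
  form-cong M h = ∑-cong (λ i → cong₂ _*_ (h i) (∑-cong (λ j → cong (M i j *_) (h j))))

  form-congᴹ : ∀ {n} {M N : Mat n} → (∀ i j → M i j ≡ N i j) → ∀ x → form M x ≡ form N x
  form-congᴹ h x = ∑-cong (λ i → cong (x i *_) (∑-cong (λ j → cong (_* x j) (h i j))))

  ∷-head-tail : ∀ {n} (x : Vector ℚ (suc n)) i → (x zero ∷ (λ j → x (suc j))) i ≡ x i
  ∷-head-tail x zero    = refl
  ∷-head-tail x (suc i) = refl

  form-δ : ∀ {n} (M : Mat n) j → form M (δ j) ≡ M j j
  form-δ M j = trans (∑-cong (λ i → trans (cong (δ j i *_) (∑-δ (M i) j)) (*-comm (δ j i) (M i j))))
    (∑-δ (λ i → M i j) j)

  psd⇒diagonal≥0 : ∀ {n} {M : Mat n} → PSD M → ∀ j → 0ℚ ≤ M j j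
  psd⇒diagonal≥0 {M = M} psd j = subst (0ℚ ≤_) (form-δ M j) (psd (δ j))

  -- Up to the factor `M zero zero`, this extension of `y` solves the first equation of the system,
  -- so `M` sends it to zero followed by `schur M y`. Semidefiniteness and, later, kernels are
  -- transported along it.
  lift : ∀ {n} → Mat (suc n) → Vector ℚ n → Vector ℚ (suc n)
  lift M y = ((- 1ℚ) * (row M ∙ y)) ∷ (λ i → M zero zero * y i)

  mul-lift-zero : ∀ {n} (M : Mat (suc n)) y → mul M (lift M y) zero ≡ 0ℚ
  mul-lift-zero M y = begin
    a * ((- 1ℚ) * β) + ∑ (λ j → row M j * (a * y j))
      ≡⟨ cong (a * ((- 1ℚ) * β) +_) (trans (∑-cong (λ j → solve 3 (λ p a y → p :* (a :* y) := a :* (p :* y)) refl (row M j) a (y j)))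
           (∑-scale a (λ j → row M j * y j))) ⟩
    a * ((- 1ℚ) * β) + a * β
      ≡⟨ solve 2 (λ a b → a :* (con (- 1ℚ) :* b) :+ a :* b := con 0ℚ) refl a β ⟩
    0ℚ ∎
    where
    open ≡-Reasoning
    a = M zero zero
    β = row M ∙ y

  mul-lift-suc : ∀ {n} (M : Mat (suc n)) → Symmetric M → ∀ y i → mul M (lift M y) (suc i) ≡ mul (schur M) y i
  mul-lift-suc M sm y i = begin
    M (suc i) zero * ((- 1ℚ) * β) + ∑ (λ j → minor M i j * (a * y j))
      ≡⟨ cong₂ (λ p q → p * ((- 1ℚ) * β) + q) (sm (suc i) zero)
           (trans (∑-cong (λ j → solve 3 (λ p a y → p :* (a :* y) := a :* (p :* y)) refl (minor M i j) a (y j)))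
           (∑-scale a (λ j → minor M i j * y j))) ⟩
    row M i * ((- 1ℚ) * β) + a * mul (minor M) y i
      ≡⟨ solve 4 (λ r b a m → r :* (con (- 1ℚ) :* b) :+ a :* m := a :* m :- r :* b) refl (row M i) β a (mul (minor M) y i) ⟩
    a * mul (minor M) y i - row M i * β
      ≡⟨ sym (mul-schur M y i) ⟩
    mul (schur M) y i ∎
    where
    open ≡-Reasoning
    a = M zero zero
    β = row M ∙ y

  form-lift : ∀ {n} (M : Mat (suc n)) → Symmetric M → ∀ y → form M (lift M y) ≡ M zero zero * form (schur M) y
  form-lift M sm y = begin
    h * mul M (lift M y) zero + ∑ (λ i → (a * y i) * mul M (lift M y) (suc i))
      ≡⟨ cong₂ (λ p q → h * p + q) (mul-lift-zero M y)
           (trans (∑-cong (λ i → trans (cong ((a * y i) *_) (mul-lift-suc M sm y i)) (*-assoc a (y i) _))) (∑-scale a (λ i → y i * mul (schur M) y i))) ⟩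
    h * 0ℚ + a * form (schur M) y
      ≡⟨ trans (cong (_+ a * form (schur M) y) (*-zeroʳ h)) (+-identityˡ _) ⟩
    a * form (schur M) y ∎
    where
    open ≡-Reasoning
    a = M zero zero
    h = (- 1ℚ) * (row M ∙ y)

  complete-square : ∀ {n} (M : Mat (suc n)) → Symmetric M → ∀ s y → let r = M zero zero * s + row M ∙ y in
    M zero zero * form M (s ∷ y) ≡ r * r + form (schur M) y
  complete-square M sm s y = trans (cong (M zero zero *_) (form-suc M sm s y))
    (trans (solve 4 (λ a s b f → a :* (s :* (a :* s :+ b) :+ (s :* b :+ f)) := (a :* s :+ b) :* (a :* s :+ b) :+ (a :* f :- b :* b))
        refl (M zero zero) s (row M ∙ y) (form (minor M) y))
      (cong ((M zero zero * s + row M ∙ y) * (M zero zero * s + row M ∙ y) +_) (sym (form-schur M y))))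

  0≤a*p⇒0≤p : ∀ {a p} → 0ℚ < a → 0ℚ ≤ a * p → 0ℚ ≤ p
  0≤a*p⇒0≤p {a} {p} a>0 h = *-cancelˡ-≤-pos a {{positive a>0}} (subst (_≤ a * p) (sym (*-zeroʳ a)) h)

  psd-schur : ∀ {n} {M : Mat (suc n)} → Symmetric M → 0ℚ < M zero zero → PSD M → PSD (schur M)
  psd-schur {M = M} sm a>0 psd y = 0≤a*p⇒0≤p a>0 (subst (0ℚ ≤_) (form-lift M sm y) (psd (lift M y)))

  psd-schur⁻¹ : ∀ {n} {M : Mat (suc n)} → Symmetric M → 0ℚ < M zero zero → PSD (schur M) → PSD M
  psd-schur⁻¹ {M = M} sm a>0 psd x = subst (0ℚ ≤_) (form-cong M {y = x} (∷-head-tail x))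
    (0≤a*p⇒0≤p a>0 (subst (0ℚ ≤_) (sym (complete-square M sm (x zero) (λ j → x (suc j)))) (0≤p+q (0≤p*p (M zero zero * x zero + row M ∙ (λ j → x (suc j)))) (psd (λ j → x (suc j))))))

  psd-plane : ∀ {n} {M : Mat (suc n)} → Symmetric M → PSD M → ∀ s j →
    0ℚ ≤ s * (M zero zero * s + row M j) + (s * row M j + minor M j j)
  psd-plane {M = M} sm psd s j = subst (0ℚ ≤_)
    (trans (form-suc M sm s (δ j)) (cong₂ (λ p q → s * (M zero zero * s + p) + (s * p + q)) (∑-δ (row M) j) (form-δ (minor M) j)))
    (psd (s ∷ δ j))

  -- With a zero corner, the form on the plane of the first and one further basis vector is linear
  -- in the first coordinate, so a nonzero row entry would let it take any value.
  psd-zero-corner : ∀ {n} {M : Mat (suc n)} → Symmetric M → PSD M → M zero zero ≡ 0ℚ → ∀ j → row M j ≡ 0ℚ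
  psd-zero-corner {M = M} sm psd a≡0 j with row M j ≟ 0ℚ
  ... | yes b≡0 = b≡0
  ... | no  b≢0 = contradiction (subst (0ℚ ≤_) eq (psd-plane sm psd s j)) (λ 0≤-1 → <-irrefl refl (<-≤-trans (negative⁻¹ (- 1ℚ)) 0≤-1))
    where
    instance b≢0′ : NonZero (row M j)
             b≢0′ = ≢-nonZero b≢0
    N = minor M j j
    i = 1/ row M j
    -- Solves `2 s b + N = -1`, where `b` is `row M j`.
    s = (- ½) * (N + 1ℚ) * i
    open ≡-Reasoning
    eq : s * (M zero zero * s + row M j) + (s * row M j + N) ≡ - 1ℚ
    eq = begin
      s * (M zero zero * s + row M j) + (s * row M j + N)
        ≡⟨ cong (λ a → s * (a * s + row M j) + (s * row M j + N)) a≡0 ⟩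
      s * (0ℚ * s + row M j) + (s * row M j + N)
        ≡⟨ solve 3 (λ N i b → let s = con (- ½) :* (N :+ con 1ℚ) :* i in
                   s :* (con 0ℚ :* s :+ b) :+ (s :* b :+ N) := (:- (N :+ con 1ℚ)) :* (i :* b) :+ N) refl N i (row M j) ⟩
      (- (N + 1ℚ)) * (i * row M j) + N
        ≡⟨ cong (λ z → (- (N + 1ℚ)) * z + N) (*-inverseˡ (row M j)) ⟩
      (- (N + 1ℚ)) * 1ℚ + N
        ≡⟨ solve 1 (λ N → (:- (N :+ con 1ℚ)) :* con 1ℚ :+ N := con (- 1ℚ)) refl N ⟩
      - 1ℚ ∎

  psd? : ∀ {n} (M : Mat n) → Symmetric M → Dec (PSD M)
  psd? {zero}  M sm = yes (λ _ → ≤-refl)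
  psd? {suc n} M sm with <-cmp (M zero zero) 0ℚ
  ... | tri< a<0 _ _ = no (λ psd → <-irrefl refl (<-≤-trans a<0 (psd⇒diagonal≥0 {M = M} psd zero)))
  ... | tri> _ _ a>0 = map′ (psd-schur⁻¹ sm a>0) (psd-schur sm a>0) (psd? (schur M) (schur-symmetric M sm))
  ... | tri≈ _ a≡0 _ with all? (λ j → row M j ≟ 0ℚ)
  ...   | no  b≢0 = no (λ psd → b≢0 (psd-zero-corner sm psd a≡0))
  ...   | yes b≡0 = map′ (λ psd x → subst (0ℚ ≤_) (trans (sym (shape (x zero) (λ j → x (suc j)))) (form-cong M {y = x} (∷-head-tail x))) (psd (λ j → x (suc j))))
                         (λ psd y → subst (0ℚ ≤_) (shape 0ℚ y) (psd (0ℚ ∷ y)))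
                         (psd? (minor M) (λ i j → sm (suc i) (suc j)))
    where
    shape : ∀ s y → form M (s ∷ y) ≡ form (minor M) y
    shape s y = trans (form-suc M sm s y)
      (trans (cong₂ (λ a b → s * (a * s + b) + (s * b + form (minor M) y)) a≡0
               (∑-zero (λ j → row M j * y j) (λ j → trans (cong (_* y j) (b≡0 j)) (*-zeroˡ (y j)))))
        (solve 2 (λ s f → s :* (con 0ℚ :* s :+ con 0ℚ) :+ (s :* con 0ℚ :+ f) := f) refl s (form (minor M) y)))

-- Real matrices as sequences of rational ones, and kernels in the limit.

module RealMatrices where

  open import Data.Empty using (⊥-elim)
  open import Data.Fin.Base using (Fin; zero; suc)
  open import Data.Nat.Base as ℕ using (ℕ; zero; suc)
  import Data.Nat.Properties as ℕ
  open import Data.Product.Base using (Σ; _×_; _,_)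
  open import Data.Rational.Base hiding (_≃_)
  open import Data.Rational.Properties hiding (≡⇒≃)
  open import Data.Rational.Solver using (module +-*-Solver)
  open import Data.Vec.Functional using (Vector; foldr; _∷_)
  open import Relation.Binary.PropositionalEquality using (_≡_; refl; sym; trans; cong; cong₂; subst)
  open import Relation.Nullary using (¬_; yes; no)
  open import Relation.Nullary.Decidable using (toWitness)
  open RationalForms
  open +-*-Solver using (solve; _:=_; _:+_; _:*_; _:-_; :-_; con)

  Eventually : (ℕ → Set) → Set
  Eventually P = Σ ℕ λ N → ∀ n → N ℕ.≤ n → P n

  infixr 3 _⊗_
  _⊗_ : ∀ {P Q} → Eventually P → Eventually Q → Eventually (λ n → P n × Q n)
  (N , p) ⊗ (K , q) = N ℕ.⊔ K , λ n n≥ → p n (ℕ.m⊔n≤o⇒m≤o N K n≥) , q n (ℕ.m⊔n≤o⇒n≤o N K n≥)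

  eventually-map : ∀ {P Q : ℕ → Set} → (∀ n → P n → Q n) → Eventually P → Eventually Q
  eventually-map f (N , p) = N , λ n n≥ → f n (p n n≥)

  divide : ∀ T ε → Positive T → Positive ε → Σ ℚ λ d → Positive d × T * d ≡ ε
  divide T ε T>0 ε>0 = 1/T * ε , pos*pos⇒pos 1/T {{1/pos⇒pos T {{T>0}}}} ε {{ε>0}} ,
    trans (sym (*-assoc T 1/T ε)) (trans (cong (_* ε) (*-inverseʳ T {{T≢0}})) (*-identityˡ ε))
    where
    T≢0 : NonZero T
    T≢0 = pos⇒nonZero T {{T>0}}
    1/T = 1/_ T {{T≢0}}

  ≡⇒≃ : ∀ {x y} → (∀ n → seq x n ≡ seq y n) → x ≃ y
  ≡⇒≃ {x} {y} h ε ε>0 = 0 , λ n _ → subst (_≤ ε)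
    (sym (trans (cong (λ z → ∣ z - seq y n ∣) (h n)) (cong ∣_∣ (+-inverseʳ (seq y n)))))
    (<⇒≤ (positive⁻¹ ε {{ε>0}}))

  ≃-respˡ : ∀ {x x′ y} → (∀ n → seq x n ≡ seq x′ n) → x′ ≃ y → x ≃ y
  ≃-respˡ {x} {x′} {y} e h ε ε>0 = eventually-map (λ n → subst (λ z → ∣ z - seq y n ∣ ≤ ε) (sym (e n))) (h ε ε>0)

  bounded : ∀ x → Σ ℚ λ B → Positive B × Eventually (λ n → ∣ seq x n ∣ ≤ B)
  bounded x with isCauchy x 1ℚ _
  ... | N , p = 1ℚ + ∣ a ∣ , pos+nonNeg⇒pos 1ℚ ∣ a ∣ {{∣-∣-nonNeg a}} , N , λ n N≤n → begin
        ∣ seq x n ∣              ≡⟨ cong ∣_∣ (solve 2 (λ u w → u := (u :- w) :+ w) refl (seq x n) a) ⟩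
        ∣ (seq x n - a) + a ∣    ≤⟨ ∣p+q∣≤∣p∣+∣q∣ (seq x n - a) a ⟩
        ∣ seq x n - a ∣ + ∣ a ∣  ≤⟨ +-monoˡ-≤ ∣ a ∣ (p n N N≤n ℕ.≤-refl) ⟩
        1ℚ + ∣ a ∣               ∎
    where
    open ≤-Reasoning
    a = seq x N

  ∣*∣-mono : ∀ {a b A B} → ∣ a ∣ ≤ A → ∣ b ∣ ≤ B → ∣ a * b ∣ ≤ A * B
  ∣*∣-mono {a} {b} {A} {B} a≤A b≤B = begin
    ∣ a * b ∣      ≡⟨ ∣p*q∣≡∣p∣*∣q∣ a b ⟩
    ∣ a ∣ * ∣ b ∣  ≤⟨ *-monoʳ-≤-nonNeg ∣ b ∣ {{∣-∣-nonNeg b}} a≤A ⟩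
    A * ∣ b ∣      ≤⟨ *-monoˡ-≤-nonNeg A {{nonNegative (≤-trans (0≤∣p∣ a) a≤A)}} b≤B ⟩
    A * B          ∎
    where open ≤-Reasoning

  half-sum : ∀ ε → ½ * ε + ½ * ε ≡ ε
  half-sum ε = trans (sym (*-distribʳ-+ ε ½ ½)) (*-identityˡ ε)

  half>0 : ∀ ε → Positive ε → Positive (½ * ε)
  half>0 ε ε>0 = pos*pos⇒pos ½ ε {{ε>0}}

  +-cong-≃ : ∀ {x x′ y y′} → x ≃ x′ → y ≃ y′ → x +ᴿ y ≃ x′ +ᴿ y′
  +-cong-≃ {x} {x′} {y} {y′} p q ε ε>0 = eventually-map close (p (½ * ε) (half>0 ε ε>0) ⊗ q (½ * ε) (half>0 ε ε>0))
    where
    open ≤-Reasoning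
    close : ∀ n → ∣ seq x n - seq x′ n ∣ ≤ ½ * ε × ∣ seq y n - seq y′ n ∣ ≤ ½ * ε →
            ∣ (seq x n + seq y n) - (seq x′ n + seq y′ n) ∣ ≤ ε
    close n (u , w) = begin
      ∣ (seq x n + seq y n) - (seq x′ n + seq y′ n) ∣
        ≡⟨ cong ∣_∣ (solve 4 (λ a b c d → (a :+ b) :- (c :+ d) := (a :- c) :+ (b :- d)) refl (seq x n) (seq y n) (seq x′ n) (seq y′ n)) ⟩
      ∣ (seq x n - seq x′ n) + (seq y n - seq y′ n) ∣
        ≤⟨ ∣p+q∣≤∣p∣+∣q∣ (seq x n - seq x′ n) (seq y n - seq y′ n) ⟩
      ∣ seq x n - seq x′ n ∣ + ∣ seq y n - seq y′ n ∣
        ≤⟨ +-mono-≤ u w ⟩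
      ½ * ε + ½ * ε
        ≡⟨ half-sum ε ⟩
      ε ∎

  *-cong-≃ : ∀ {x x′ y y′} → x ≃ x′ → y ≃ y′ → x *ᴿ y ≃ x′ *ᴿ y′
  *-cong-≃ {x} {x′} {y} {y′} p q ε ε>0 = use (bounded x) (bounded y′)
    where
    open ≤-Reasoning
    use : (Σ ℚ λ A → Positive A × Eventually (λ n → ∣ seq x n ∣ ≤ A)) →
          (Σ ℚ λ B → Positive B × Eventually (λ n → ∣ seq y′ n ∣ ≤ B)) →
          Eventually (λ n → ∣ seq x n * seq y n - seq x′ n * seq y′ n ∣ ≤ ε)
    use (A , A>0 , bx) (B , B>0 , by) = share (divide (A + B) ε (pos+pos⇒pos A {{A>0}} B {{B>0}}) ε>0)
     where
     share : (Σ ℚ λ d → Positive d × (A + B) * d ≡ ε) → Eventually (λ n → ∣ seq x n * seq y n - seq x′ n * seq y′ n ∣ ≤ ε)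
     share (d , d>0 , collect) = eventually-map close ((bx ⊗ by) ⊗ (p d d>0 ⊗ q d d>0))
      where
      close : ∀ n → (∣ seq x n ∣ ≤ A × ∣ seq y′ n ∣ ≤ B) × (∣ seq x n - seq x′ n ∣ ≤ d × ∣ seq y n - seq y′ n ∣ ≤ d) →
              ∣ seq x n * seq y n - seq x′ n * seq y′ n ∣ ≤ ε
      close n ((a≤A , b≤B) , (u , w)) = begin
        ∣ seq x n * seq y n - seq x′ n * seq y′ n ∣
          ≡⟨ cong ∣_∣ (solve 4 (λ a b c d → a :* b :- c :* d := a :* (b :- d) :+ d :* (a :- c)) refl (seq x n) (seq y n) (seq x′ n) (seq y′ n)) ⟩
        ∣ seq x n * (seq y n - seq y′ n) + seq y′ n * (seq x n - seq x′ n) ∣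
          ≤⟨ ∣p+q∣≤∣p∣+∣q∣ (seq x n * (seq y n - seq y′ n)) (seq y′ n * (seq x n - seq x′ n)) ⟩
        ∣ seq x n * (seq y n - seq y′ n) ∣ + ∣ seq y′ n * (seq x n - seq x′ n) ∣
          ≤⟨ +-mono-≤ (∣*∣-mono a≤A w) (∣*∣-mono b≤B u) ⟩
        A * d + B * d
          ≡⟨ sym (*-distribʳ-+ d A B) ⟩
        (A + B) * d
          ≡⟨ collect ⟩
        ε ∎

  -- All real operations are termwise, so a real matrix is a sequence of rational ones.
  at : ∀ {n} → Matrix n → ℕ → Mat n
  at M m i j = seq (M i j) m

  atᵛ : ∀ {n} → Vector ℝ n → ℕ → Vector ℚ n
  atᵛ x m i = seq (x i) m

  ∑ᴿ : ∀ {n} → Vector ℝ n → ℝ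
  ∑ᴿ = foldr _+ᴿ_ 0ℝ

  at-∑ : ∀ {n} (f : Vector ℝ n) m → seq (∑ᴿ f) m ≡ ∑ (λ i → seq (f i) m)
  at-∑ {zero}  f m = refl
  at-∑ {suc n} f m = cong (seq (f zero) m +_) (at-∑ (λ i → f (suc i)) m)

  at-mul : ∀ {n} (M : Matrix n) x i m → seq ((M · x) i) m ≡ mul (at M m) (atᵛ x m) i
  at-mul M x i m = at-∑ (λ j → M i j *ᴿ x j) m

  SymmetricAt : ∀ {n} → Matrix n → Set
  SymmetricAt M = ∀ m → Symmetric (at M m)

  schurᴿ : ∀ {n} → Matrix (suc n) → Matrix n
  schurᴿ M i j = M zero zero *ᴿ M (suc i) (suc j) +ᴿ fromℚ (- 1ℚ) *ᴿ (M zero (suc i) *ᴿ M zero (suc j))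

  schurᴿ-cong : ∀ {n} {M N : Matrix (suc n)} → (∀ i j → M i j ≃ N i j) → ∀ i j → schurᴿ M i j ≃ schurᴿ N i j
  schurᴿ-cong {M = M} {N} h i j = +-cong-≃
    {M zero zero *ᴿ M (suc i) (suc j)} {N zero zero *ᴿ N (suc i) (suc j)}
    {fromℚ (- 1ℚ) *ᴿ (M zero (suc i) *ᴿ M zero (suc j))} {fromℚ (- 1ℚ) *ᴿ (N zero (suc i) *ᴿ N zero (suc j))}
    (*-cong-≃ {M zero zero} {N zero zero} {M (suc i) (suc j)} {N (suc i) (suc j)} (h zero zero) (h (suc i) (suc j)))
    (*-cong-≃ {fromℚ (- 1ℚ)} {fromℚ (- 1ℚ)} {M zero (suc i) *ᴿ M zero (suc j)} {N zero (suc i) *ᴿ N zero (suc j)}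
      (≡⇒≃ {fromℚ (- 1ℚ)} {fromℚ (- 1ℚ)} (λ _ → refl))
      (*-cong-≃ {M zero (suc i)} {N zero (suc i)} {M zero (suc j)} {N zero (suc j)} (h zero (suc i)) (h zero (suc j))))

  liftᴿ : ∀ {n} → Matrix (suc n) → Vector ℝ n → Vector ℝ (suc n)
  liftᴿ M y = (fromℚ (- 1ℚ) *ᴿ ∑ᴿ (λ j → M zero (suc j) *ᴿ y j)) ∷ (λ i → M zero zero *ᴿ y i)

  at-lift : ∀ {n} (M : Matrix (suc n)) y m i → atᵛ (liftᴿ M y) m i ≡ lift (at M m) (atᵛ y m) i
  at-lift M y m zero    = cong ((- 1ℚ) *_) (at-∑ (λ j → M zero (suc j) *ᴿ y j) m)
  at-lift M y m (suc i) = refl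

  mul-cong : ∀ {n} (M : Mat n) {x y} → (∀ i → x i ≡ y i) → ∀ i → mul M x i ≡ mul M y i
  mul-cong M h i = ∑-cong (λ j → cong (M i j *_) (h j))

  -- Strict positivity with a witness, as needed to divide by a real pivot.
  BoundedBelow : ℝ → Set
  BoundedBelow x = Σ ℚ λ d → Positive d × Eventually (λ n → d ≤ seq x n)

  -- A single late term decides between two rational cases: if it is at most ε/2, the tail is at
  -- most ε; otherwise the tail stays positive with a margin, which is excluded.
  ¬boundedBelow⇒≃0 : ∀ x → Eventually (λ n → 0ℚ ≤ seq x n) → ¬ BoundedBelow x → x ≃ 0ℝ
  ¬boundedBelow⇒≃0 x (K , x≥0) ¬pos ε ε>0 with isCauchy x (½ * ε) (half>0 ε ε>0)
  ... | N , p with seq x N ≤? ½ * ε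
  ...   | yes small = N ℕ.⊔ K , λ n n≥ → subst (λ z → ∣ z ∣ ≤ ε) (sym (+-identityʳ (seq x n)))
            (subst (_≤ ε) (sym (0≤p⇒∣p∣≡p (x≥0 n (ℕ.m⊔n≤o⇒n≤o N K n≥)))) (begin
              seq x n                          ≡⟨ solve 2 (λ u w → u := (u :- w) :+ w) refl (seq x n) (seq x N) ⟩
              (seq x n - seq x N) + seq x N    ≤⟨ +-mono-≤ (≤-trans (p≤∣p∣ _) (p n N (ℕ.m⊔n≤o⇒m≤o N K n≥) ℕ.≤-refl)) small ⟩
              ½ * ε + ½ * ε                    ≡⟨ half-sum ε ⟩
              ε ∎))
    where open ≤-Reasoning
  ...   | no large = N , λ n n≥ → ⊥-elim (¬pos (d , positive {d} d>0 , N , below))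
    where
    d = ½ * (seq x N - ½ * ε)
    gap : 0ℚ < seq x N - ½ * ε
    gap = subst (_< seq x N - ½ * ε) (+-inverseʳ (½ * ε)) (+-monoˡ-< (- (½ * ε)) (≰⇒> large))
    d>0 : 0ℚ < d
    d>0 = positive⁻¹ d {{pos*pos⇒pos ½ (seq x N - ½ * ε) {{positive gap}}}}
    below : ∀ n → N ℕ.≤ n → d ≤ seq x n
    below n n≥ = 0≤q-p⇒p≤q (subst (0ℚ ≤_)
      (solve 3 (λ a b e → (con ½ :* (a :- e)) :+ (e :- (a :- b)) := b :- (con ½ :* (a :- e))) refl (seq x N) (seq x n) (½ * ε))
      (0≤p+q (<⇒≤ d>0) (p≤q⇒0≤q-p (≤-trans (p≤∣p∣ (seq x N - seq x n)) (p N n ℕ.≤-refl n≥)))))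

  -- 0 ≤ a T² ∓ 2 T b + n with a ≤ ε / T and n ≤ ε T forces |b| ≤ ε.
  row-small : ∀ {n} {M : Mat (suc n)} → Symmetric M → PSD M → ∀ j {ε T B d} → Positive T →
    ε * T ≡ B → T * d ≡ ε → M zero zero ≤ d → minor M j j ≤ B → ∣ row M j ∣ ≤ ε
  row-small {M = M} sm psd j {ε} {T} {B} {d} T>0 εT Td a≤d n≤B = ∣p∣≤q
    (bound (- T) (solve 5 (λ T a b n z → let s = :- T in
        (s :* (a :* s :+ b) :+ (s :* b :+ n)) :+ ((T :* T) :* (z :- a)) := ((T :* T) :* z :+ n) :- (T :+ T) :* b) refl T a b n d))
    (bound T (solve 5 (λ T a b n z → let s = T in
        (s :* (a :* s :+ b) :+ (s :* b :+ n)) :+ ((T :* T) :* (z :- a)) := ((T :* T) :* z :+ n) :- (T :+ T) :* (:- b)) refl T a b n d))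
    where
    a = M zero zero
    b = row M j
    n = minor M j j
    open ≤-Reasoning
    T≥0 : 0ℚ ≤ T
    T≥0 = <⇒≤ (positive⁻¹ T {{T>0}})
    2T>0 : Positive (T + T)
    2T>0 = pos+pos⇒pos T {{T>0}} T {{T>0}}
    bound : ∀ s {w} → (s * (a * s + b) + (s * b + n)) + ((T * T) * (d - a)) ≡ ((T * T) * d + n) - (T + T) * w → w ≤ ε
    bound s {w} eq = *-cancelˡ-≤-pos (T + T) {{2T>0}} (begin
      (T + T) * w         ≤⟨ 0≤q-p⇒p≤q (subst (0ℚ ≤_) eq (0≤p+q (psd-plane sm psd s j) (0≤p*q (0≤p*q T≥0 T≥0) (p≤q⇒0≤q-p a≤d)))) ⟩
      (T * T) * d + n     ≤⟨ +-monoʳ-≤ ((T * T) * d) n≤B ⟩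
      (T * T) * d + B     ≡⟨ cong₂ _+_ (trans (*-assoc T T d) (cong (T *_) Td)) (sym εT) ⟩
      T * ε + ε * T       ≡⟨ solve 2 (λ T e → T :* e :+ e :* T := (T :+ T) :* e) refl T ε ⟩
      (T + T) * ε         ∎)

  -- Semidefiniteness gives b² ≤ a n for the corner a, a row entry b and a diagonal entry n; as n is
  -- bounded by some B, b tends to 0 with a. The choices T = B / ε and d = ε / T fit `row-small`.
  zero-corner-row : ∀ {n} (M : Matrix (suc n)) → SymmetricAt M → Eventually (λ m → PSD (at M m)) →
    M zero zero ≃ 0ℝ → ∀ j → M zero (suc j) ≃ 0ℝ
  zero-corner-row M sm psd a≃0 j ε ε>0 = use (bounded (M (suc j) (suc j)))
    where
    Goal : Set
    Goal = Eventually (λ m → ∣ seq (M zero (suc j)) m - 0ℚ ∣ ≤ ε)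
    use : (Σ ℚ λ B → Positive B × Eventually (λ m → ∣ seq (M (suc j) (suc j)) m ∣ ≤ B)) → Goal
    use (B , B>0 , nB) = scale (divide ε B ε>0 B>0)
     where
     scale : (Σ ℚ λ T → Positive T × ε * T ≡ B) → Goal
     scale (T , T>0 , εT) = shrink (divide T ε T>0 ε>0)
      where
      shrink : (Σ ℚ λ d → Positive d × T * d ≡ ε) → Goal
      shrink (d , d>0 , Td) = eventually-map small (psd ⊗ a≃0 d d>0 ⊗ nB)
       where
       small : ∀ m → PSD (at M m) × ∣ seq (M zero zero) m - 0ℚ ∣ ≤ d × ∣ seq (M (suc j) (suc j)) m ∣ ≤ B →
               ∣ seq (M zero (suc j)) m - 0ℚ ∣ ≤ ε
       small m (p , a≤d , n≤B) = subst (λ z → ∣ z ∣ ≤ ε) (sym (+-identityʳ _))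
         (row-small {M = at M m} (sm m) p j T>0 εT Td
           (≤-trans (p≤∣p∣ _) (subst (λ z → ∣ z ∣ ≤ d) (+-identityʳ _) a≤d))
           (≤-trans (p≤∣p∣ _) n≤B))

  δᴿ : ∀ {n} → Fin n → Vector ℝ n
  δᴿ i j = fromℚ (δ i j)

  1≄0 : ¬ 1ℝ ≃ 0ℝ
  1≄0 h with h ½ _
  ... | N , p = <-irrefl refl (<-≤-trans (toWitness {a? = ½ <? ∣ 1ℚ - 0ℚ ∣} _) (p N ℕ.≤-refl))

  Kernel : ∀ {n} → Matrix n → Set
  Kernel {n} M = Σ (Vector ℝ n) λ x → ¬ (∀ i → x i ≃ 0ℝ) × (∀ i → (M · x) i ≃ 0ℝ)

  zero-corner-kernel : ∀ {n} (M : Matrix (suc n)) → SymmetricAt M → Eventually (λ m → PSD (at M m)) →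
    M zero zero ≃ 0ℝ → Kernel M
  zero-corner-kernel M sm psd a≃0 = δᴿ zero , (λ h → 1≄0 (h zero)) , λ where
      zero    → ≃-respˡ {(M · δᴿ zero) zero} {M zero zero} {0ℝ} (column zero) a≃0
      (suc i) → ≃-respˡ {(M · δᴿ zero) (suc i)} {M zero (suc i)} {0ℝ} (λ m → trans (column (suc i) m) (sm m (suc i) zero))
                  (zero-corner-row M sm psd a≃0 i)
    where
    column : ∀ i m → seq ((M · δᴿ zero) i) m ≡ seq (M i zero) m
    column i m = trans (at-mul M (δᴿ zero) i m) (∑-δ (at M m i) zero)

  lift-kernel : ∀ {n} (M : Matrix (suc n)) → SymmetricAt M → BoundedBelow (M zero zero) → Kernel (schurᴿ M) → Kernel M
  lift-kernel M sm (d , d>0 , a≥d) (y , y≄0 , Sy≃0) = liftᴿ M y , nonzero , λ where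
      zero    → ≡⇒≃ {(M · liftᴿ M y) zero} {0ℝ} (λ m → trans (eq zero m) (mul-lift-zero (at M m) (atᵛ y m)))
      (suc i) → ≃-respˡ {(M · liftᴿ M y) (suc i)} {(schurᴿ M · y) i} {0ℝ}
                  (λ m → trans (eq (suc i) m) (trans (mul-lift-suc (at M m) (sm m) (atᵛ y m) i) (sym (at-mul (schurᴿ M) y i m))))
                  (Sy≃0 i)
    where
    eq : ∀ i m → seq ((M · liftᴿ M y) i) m ≡ mul (at M m) (lift (at M m) (atᵛ y m)) i
    eq i m = trans (at-mul M (liftᴿ M y) i m) (mul-cong (at M m) (at-lift M y m) i)
    nonzero : ¬ (∀ i → liftᴿ M y i ≃ 0ℝ)
    nonzero h = y≄0 λ i ε ε>0 → eventually-map (cancel i ε)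
      (a≥d ⊗ h (suc i) (d * ε) (pos*pos⇒pos d {{d>0}} ε {{ε>0}}))
      where
      open ≤-Reasoning
      cancel : ∀ i ε m → d ≤ seq (M zero zero) m × ∣ seq (M zero zero) m * seq (y i) m - 0ℚ ∣ ≤ d * ε → ∣ seq (y i) m - 0ℚ ∣ ≤ ε
      cancel i ε m (d≤a , small) = *-cancelˡ-≤-pos d {{d>0}} (begin
        d * ∣ seq (y i) m - 0ℚ ∣     ≡⟨ cong (λ z → d * ∣ z ∣) (+-identityʳ (seq (y i) m)) ⟩
        d * ∣ seq (y i) m ∣          ≤⟨ *-monoʳ-≤-nonNeg ∣ seq (y i) m ∣ {{∣-∣-nonNeg (seq (y i) m)}} (≤-trans d≤a (p≤∣p∣ a)) ⟩
        ∣ a ∣ * ∣ seq (y i) m ∣      ≡⟨ sym (∣p*q∣≡∣p∣*∣q∣ a (seq (y i) m)) ⟩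
        ∣ a * seq (y i) m ∣          ≡⟨ cong ∣_∣ (sym (+-identityʳ (a * seq (y i) m))) ⟩
        ∣ a * seq (y i) m - 0ℚ ∣     ≤⟨ small ⟩
        d * ε                        ∎)
        where a = seq (M zero zero) m

  boundedBelow-cong : ∀ {x y} → x ≃ y → BoundedBelow x → BoundedBelow y
  boundedBelow-cong {x} {y} h (d , d>0 , x≥d) = ½ * d , half>0 d d>0 , eventually-map below (x≥d ⊗ h (½ * d) (half>0 d d>0))
    where
    below : ∀ n → d ≤ seq x n × ∣ seq x n - seq y n ∣ ≤ ½ * d → ½ * d ≤ seq y n
    below n (d≤x , close) = 0≤q-p⇒p≤q (subst (0ℚ ≤_)
      (solve 3 (λ x y d → (x :- d) :+ (con ½ :* d :- (x :- y)) := y :- con ½ :* d) refl (seq x n) (seq y n) d)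
      (0≤p+q (p≤q⇒0≤q-p d≤x) (p≤q⇒0≤q-p (≤-trans (p≤∣p∣ _) close))))

  -- Either the corner tends to 0, and then so does its row, or it stays bounded below and we pass to the Schur complement.
  singular : ∀ {n} (M N : Matrix n) → (∀ i j → M i j ≃ N i j) → SymmetricAt M → SymmetricAt N →
    Eventually (λ m → PSD (at M m)) → Eventually (λ m → ¬ PSD (at N m)) → ¬ ¬ Kernel M
  singular {zero}  M N M≃N sM sN psd (K , ¬psd) _ = ¬psd K ℕ.≤-refl (λ _ → ≤-refl)
  singular {suc n} M N M≃N sM sN psd ¬psd ¬ker = ¬ker (zero-corner-kernel M sM psd
      (¬boundedBelow⇒≃0 (M zero zero) (eventually-map (λ m p → psd⇒diagonal≥0 {M = at M m} p zero) psd) λ a>0 →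
        singular (schurᴿ M) (schurᴿ N) (schurᴿ-cong {M = M} {N} M≃N)
          (λ m → schur-symmetric (at M m) (sM m)) (λ m → schur-symmetric (at N m) (sN m))
          (eventually-map (λ m (p , a>0) → psd-schur {M = at M m} (sM m) a>0 p) (psd ⊗ positive-corner {M} a>0))
          (eventually-map (λ m (¬p , a>0) p → ¬p (psd-schur⁻¹ {M = at N m} (sN m) a>0 p))
            (¬psd ⊗ positive-corner {N} (boundedBelow-cong {M zero zero} {N zero zero} (M≃N zero zero) a>0)))
          (λ ker → ¬ker (lift-kernel M sM a>0 ker))))
    where
    positive-corner : ∀ {L : Matrix (suc n)} → BoundedBelow (L zero zero) → Eventually (λ m → 0ℚ < seq (L zero zero) m)
    positive-corner (d , d>0 , a≥d) = eventually-map (λ m → <-≤-trans (positive⁻¹ d {{d>0}})) a≥d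

-- Bisection towards an eigenvalue of the adjacency matrix.

module SmallestEigenvalue where

  open import Data.Bool.Base using (true; false; if_then_else_)
  open import Data.Empty using (⊥)
  open import Data.Fin.Base using (Fin; zero; suc)
  open import Data.Fin.Properties as Fin using ()
  open import Data.Integer.Base as ℤ using (-[1+_])
  import Data.Integer.Properties as ℤ
  open import Data.Nat.Base as ℕ using (ℕ; zero; suc)
  import Data.Nat.Coprimality as ℕ
  import Data.Nat.Properties as ℕ
  open import Data.Product.Base using (Σ; _×_; _,_; proj₁; proj₂)
  open import Data.Rational.Base hiding (_≃_)
  open import Data.Rational.Properties hiding (≡⇒≃)
  open import Data.Rational.Solver using (module +-*-Solver)
  open import Data.Vec.Functional using (Vector)
  open import Relation.Binary.PropositionalEquality using (_≡_; refl; sym; trans; cong; cong₂; subst; module ≡-Reasoning)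
  open import Relation.Nullary using (¬_; Dec; yes; no; contradiction; does)
  open RationalForms
  open RealMatrices
  open +-*-Solver using (solve; _:=_; _:+_; _:*_; _:-_; :-_; con)

  -- Recursive rather than `n / 1`, whose normalisation is awkward for induction; `n/1≡natℚ`
  -- reconciles the two.
  natℚ : ℕ → ℚ
  natℚ zero    = 0ℚ
  natℚ (suc n) = 1ℚ + natℚ n

  natℚ-+ : ∀ m n → natℚ (m ℕ.+ n) ≡ natℚ m + natℚ n
  natℚ-+ zero    n = sym (+-identityˡ (natℚ n))
  natℚ-+ (suc m) n = trans (cong (1ℚ +_) (natℚ-+ m n)) (sym (+-assoc 1ℚ (natℚ m) (natℚ n)))

  0≤natℚ : ∀ n → 0ℚ ≤ natℚ n
  0≤natℚ zero    = ≤-refl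
  0≤natℚ (suc n) = 0≤p+q (<⇒≤ (positive⁻¹ 1ℚ)) (0≤natℚ n)

  natℚ-cancel-≤ : ∀ m n → natℚ m ≤ natℚ n → m ℕ.≤ n
  natℚ-cancel-≤ zero    n       h = ℕ.z≤n
  natℚ-cancel-≤ (suc m) zero    h = contradiction (<-≤-trans (positive⁻¹ 1ℚ)
    (subst (_≤ 1ℚ + natℚ m) (+-identityʳ 1ℚ) (+-monoʳ-≤ 1ℚ (0≤natℚ m)))) (λ 0<s → <-irrefl refl (<-≤-trans 0<s h))
  natℚ-cancel-≤ (suc m) (suc n) h = ℕ.s≤s (natℚ-cancel-≤ m n (+-cancelˡ-≤ 1ℚ h))
    where
    +-cancelˡ-≤ : ∀ r {p q} → r + p ≤ r + q → p ≤ q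
    +-cancelˡ-≤ r {p} {q} h = 0≤q-p⇒p≤q (subst (0ℚ ≤_)
      (solve 3 (λ r p q → (r :+ q) :- (r :+ p) := q :- p) refl r p q) (p≤q⇒0≤q-p h))

  n/1 : ∀ n → ℤ.+ n / 1 ≡ mkℚ (ℤ.+ n) 0 (ℕ.sym (ℕ.1-coprimeTo n))
  n/1 n = normalize-coprime (ℕ.sym (ℕ.1-coprimeTo n))

  n/1≡natℚ : ∀ n → ℤ.+ n / 1 ≡ natℚ n
  n/1≡natℚ zero    = refl
  n/1≡natℚ (suc n) = trans (sym step) (cong (1ℚ +_) (n/1≡natℚ n))
    where
    step : 1ℚ + (ℤ.+ n / 1) ≡ ℤ.+ suc n / 1
    step = trans (cong (1ℚ +_) (n/1 n)) (cong (_/ 1) (cong (ℤ._+_ (ℤ.+ 1)) (ℤ.*-identityʳ (ℤ.+ n))))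

  -n/1≡-natℚ : ∀ n → (ℤ.- (ℤ.+ n)) / 1 ≡ - natℚ n
  -n/1≡-natℚ zero    = refl
  -n/1≡-natℚ (suc n) = cong -_ (n/1≡natℚ (suc n))

  pow2 : ℕ → ℚ
  pow2 zero    = 1ℚ
  pow2 (suc n) = pow2 n + pow2 n

  1≤pow2 : ∀ n → 1ℚ ≤ pow2 n
  1≤pow2 zero    = ≤-refl
  1≤pow2 (suc n) = ≤-trans (1≤pow2 n) (subst (_≤ pow2 n + pow2 n) (+-identityʳ (pow2 n))
    (+-monoʳ-≤ (pow2 n) (≤-trans (<⇒≤ (positive⁻¹ 1ℚ)) (1≤pow2 n))))

  natℚ≤pow2 : ∀ n → natℚ n ≤ pow2 n
  natℚ≤pow2 zero    = <⇒≤ (positive⁻¹ 1ℚ)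
  natℚ≤pow2 (suc n) = +-mono-≤ (1≤pow2 n) (natℚ≤pow2 n)

  archimedean : ∀ p → Σ ℕ λ N → p ≤ pow2 N
  archimedean p@(mkℚ (ℤ.+ n) d c) = n , ≤-trans p≤n (subst (_≤ pow2 n) (trans (sym (n/1≡natℚ n)) (n/1 n)) (natℚ≤pow2 n))
    where
    p≤n : p ≤ mkℚ (ℤ.+ n) 0 (ℕ.sym (ℕ.1-coprimeTo n))
    p≤n = *≤* (ℤ.*-monoˡ-≤-nonNeg (ℤ.+ n) (ℤ.+≤+ (ℕ.s≤s ℕ.z≤n)))
  archimedean p@(mkℚ -[1+ n ] d c) = 0 , ≤-trans (<⇒≤ (negative⁻¹ p)) (<⇒≤ (positive⁻¹ 1ℚ))

  δ-sym : ∀ {n} (i j : Fin n) → δ i j ≡ δ j i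
  δ-sym zero    zero    = refl
  δ-sym zero    (suc j) = refl
  δ-sym (suc i) zero    = refl
  δ-sym (suc i) (suc j) = δ-sym i j

  δ-≟ : ∀ {n} (i j : Fin n) → δ i j ≡ (if does (i Fin.≟ j) then 1ℚ else 0ℚ)
  δ-≟ zero    zero    = refl
  δ-≟ zero    (suc j) = refl
  δ-≟ (suc i) zero    = refl
  δ-≟ (suc i) (suc j) = δ-≟ i j

  ∑-const : ∀ n c → ∑ {n} (λ _ → c) ≡ natℚ n * c
  ∑-const zero    c = sym (*-zeroˡ c)
  ∑-const (suc n) c = trans (cong (c +_) (∑-const n c))
    (solve 2 (λ c m → c :+ m :* c := (con 1ℚ :+ m) :* c) refl c (natℚ n))

  ∑-+ : ∀ {n} (f g : Vector ℚ n) → ∑ (λ i → f i + g i) ≡ ∑ f + ∑ g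
  ∑-+ {zero}  f g = refl
  ∑-+ {suc n} f g = trans (cong (f zero + g zero +_) (∑-+ (λ i → f (suc i)) (λ i → g (suc i))))
    (solve 4 (λ a b c d → (a :+ b) :+ (c :+ d) := (a :+ c) :+ (b :+ d)) refl (f zero) (g zero) _ _)

  shift : ∀ {n} → Mat n → ℚ → Mat n
  shift A t i j = A i j + ((- 1ℚ) * t) * δ i j

  mul-shift : ∀ {n} (A : Mat n) t x i → mul (shift A t) x i ≡ mul A x i - t * x i
  mul-shift A t x i = begin
    ∑ (λ j → (A i j + ((- 1ℚ) * t) * δ i j) * x j)
      ≡⟨ ∑-cong (λ j → solve 4 (λ a t d x → (a :+ (con (- 1ℚ) :* t) :* d) :* x := con 1ℚ :* (a :* x) :+ (:- t) :* (x :* d)) refl (A i j) t (δ i j) (x j)) ⟩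
    ∑ (λ j → 1ℚ * (A i j * x j) + (- t) * (x j * δ i j))
      ≡⟨ ∑-linear 1ℚ (- t) (λ j → A i j * x j) (λ j → x j * δ i j) ⟩
    1ℚ * mul A x i + (- t) * ∑ (λ j → x j * δ i j)
      ≡⟨ cong (λ z → 1ℚ * mul A x i + (- t) * z) (∑-δ x i) ⟩
    1ℚ * mul A x i + (- t) * x i
      ≡⟨ solve 3 (λ m t x → con 1ℚ :* m :+ (:- t) :* x := m :- t :* x) refl (mul A x i) t (x i) ⟩
    mul A x i - t * x i ∎
    where open ≡-Reasoning

  form-shift : ∀ {n} (A : Mat n) t x → form (shift A t) x ≡ form A x - t * (x ∙ x)
  form-shift A t x = begin
    ∑ (λ i → x i * mul (shift A t) x i)
      ≡⟨ ∑-cong (λ i → trans (cong (x i *_) (mul-shift A t x i))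
           (solve 3 (λ x m t → x :* (m :- t :* x) := con 1ℚ :* (x :* m) :+ (:- t) :* (x :* x)) refl (x i) (mul A x i) t)) ⟩
    ∑ (λ i → 1ℚ * (x i * mul A x i) + (- t) * (x i * x i))
      ≡⟨ ∑-linear 1ℚ (- t) (λ i → x i * mul A x i) (λ i → x i * x i) ⟩
    1ℚ * form A x + (- t) * (x ∙ x)
      ≡⟨ solve 3 (λ m t x → con 1ℚ :* m :+ (:- t) :* x := m :- t :* x) refl (form A x) t (x ∙ x) ⟩
    form A x - t * (x ∙ x) ∎
    where open ≡-Reasoning

  0≤x∙x : ∀ {n} (x : Vector ℚ n) → 0ℚ ≤ x ∙ x
  0≤x∙x x = ∑-nonneg (λ i → x i * x i) (λ i → 0≤p*p (x i))

  psd-shift-mono : ∀ {n} (A : Mat n) {s t} → s ≤ t → PSD (shift A t) → PSD (shift A s)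
  psd-shift-mono A {s} {t} s≤t psd x = subst (0ℚ ≤_)
    (trans (cong (_+ (t - s) * (x ∙ x)) (form-shift A t x))
      (trans (solve 4 (λ f s t q → (f :- t :* q) :+ (t :- s) :* q := f :- s :* q) refl (form A x) s t (x ∙ x))
        (sym (form-shift A s x))))
    (0≤p+q (psd x) (0≤p*q (p≤q⇒0≤q-p s≤t) (0≤x∙x x)))

  ≃-difference : ∀ {x y z} → (∀ n → seq x n ≡ seq y n - seq z n) → x ≃ 0ℝ → y ≃ z
  ≃-difference {x} h x≃0 ε ε>0 = eventually-map
    (λ n → subst (λ d → ∣ d ∣ ≤ ε) (trans (+-identityʳ (seq x n)) (h n))) (x≃0 ε ε>0)

  module _ {v : ℕ} (G : Graph v) where
    open Graph G

    adjℚ : Mat v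
    adjℚ i j = if adj i j then 1ℚ else 0ℚ

    adjℚ-symmetric : Symmetric adjℚ
    adjℚ-symmetric i j = cong (λ b → if b then 1ℚ else 0ℚ) (symm i j)

    shift-symmetric : ∀ t → Symmetric (shift adjℚ t)
    shift-symmetric t i j = cong₂ (λ p q → p + ((- 1ℚ) * t) * q) (adjℚ-symmetric i j) (δ-sym i j)

    -- Starting point of the bisection. Spreading `2 v` times the squared norm over all pairs gives
    -- each pair `x i * x i + x j * x j`, which absorbs the term of a possible edge.
    psd-shift-low : PSD (shift adjℚ (- (natℚ v + natℚ v)))
    psd-shift-low x = subst (0ℚ ≤_) (trans eq (sym (form-shift adjℚ (- (natℚ v + natℚ v)) x)))
      (∑-nonneg (λ i → ∑ (entry i)) (λ i → ∑-nonneg (entry i) (λ j → entry≥0 (adj i j) (x i) (x j))))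
      where
      entry : Fin v → Fin v → ℚ
      entry i j = x i * (adjℚ i j * x j) + (x i * x i + x j * x j)
      entry≥0 : ∀ b p q → 0ℚ ≤ p * ((if b then 1ℚ else 0ℚ) * q) + (p * p + q * q)
      entry≥0 true p q = subst (0ℚ ≤_)
        (solve 2 (λ p q → con ½ :* ((p :+ q) :* (p :+ q) :+ (p :* p :+ q :* q)) := p :* (con 1ℚ :* q) :+ (p :* p :+ q :* q)) refl p q)
        (0≤p*q (<⇒≤ (positive⁻¹ ½)) (0≤p+q (0≤p*p (p + q)) (0≤p+q (0≤p*p p) (0≤p*p q))))
      entry≥0 false p q = subst (0ℚ ≤_)
        (solve 2 (λ p q → p :* p :+ q :* q := p :* (con 0ℚ :* q) :+ (p :* p :+ q :* q)) refl p q) (0≤p+q (0≤p*p p) (0≤p*p q))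
      open ≡-Reasoning
      V = natℚ v
      S = x ∙ x
      inner : ∀ i → ∑ (entry i) ≡ x i * mul adjℚ x i + (V * (x i * x i) + S)
      inner i = begin
        ∑ (entry i)
          ≡⟨ ∑-+ (λ j → x i * (adjℚ i j * x j)) (λ j → x i * x i + x j * x j) ⟩
        ∑ (λ j → x i * (adjℚ i j * x j)) + ∑ (λ j → x i * x i + x j * x j)
          ≡⟨ cong₂ _+_ (∑-scale (x i) (λ j → adjℚ i j * x j)) (∑-+ (λ _ → x i * x i) (λ j → x j * x j)) ⟩
        x i * mul adjℚ x i + (∑ {v} (λ _ → x i * x i) + S)
          ≡⟨ cong (λ z → x i * mul adjℚ x i + (z + S)) (∑-const v (x i * x i)) ⟩
        x i * mul adjℚ x i + (V * (x i * x i) + S) ∎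
      eq : ∑ (λ i → ∑ (entry i)) ≡ form adjℚ x - (- (V + V)) * S
      eq = begin
        ∑ (λ i → ∑ (entry i))
          ≡⟨ ∑-cong inner ⟩
        ∑ (λ i → x i * mul adjℚ x i + (V * (x i * x i) + S))
          ≡⟨ ∑-+ (λ i → x i * mul adjℚ x i) (λ i → V * (x i * x i) + S) ⟩
        form adjℚ x + ∑ (λ i → V * (x i * x i) + S)
          ≡⟨ cong (form adjℚ x +_) (∑-+ (λ i → V * (x i * x i)) (λ _ → S)) ⟩
        form adjℚ x + (∑ (λ i → V * (x i * x i)) + ∑ {v} (λ _ → S))
          ≡⟨ cong (form adjℚ x +_) (cong₂ _+_ (∑-scale V (λ i → x i * x i)) (∑-const v S)) ⟩
        form adjℚ x + (V * S + V * S)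
          ≡⟨ solve 3 (λ f V S → f :+ (V :* S :+ V :* S) := f :- (:- (V :+ V)) :* S) refl (form adjℚ x) V S ⟩
        form adjℚ x - (- (V + V)) * S ∎

    record Bracket : Set where
      field
        lo hi : ℚ
        psd-lo : PSD (shift adjℚ lo)
        ¬psd-hi : ¬ PSD (shift adjℚ hi)

    open Bracket

    lo<hi : ∀ b → lo b < hi b
    lo<hi b = ≰⇒> (λ hi≤lo → ¬psd-hi b (psd-shift-mono adjℚ hi≤lo (psd-lo b)))

    mid : Bracket → ℚ
    mid b = ½ * (lo b + hi b)

    -- The decision is an argument, so that facts about a step can be proved by cases on it without
    -- unfolding `psd?`.
    bisect′ : ∀ b → Dec (PSD (shift adjℚ (mid b))) → Bracket
    bisect′ b (yes psd) = record { lo = mid b ; hi = hi b ; psd-lo = psd ; ¬psd-hi = ¬psd-hi b }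
    bisect′ b (no ¬psd) = record { lo = lo b ; hi = mid b ; psd-lo = psd-lo b ; ¬psd-hi = ¬psd }

    bisect : Bracket → Bracket
    bisect b = bisect′ b (psd? (shift adjℚ (mid b)) (shift-symmetric (mid b)))

    mid-above : ∀ b → lo b ≤ mid b
    mid-above b = 0≤q-p⇒p≤q (subst (0ℚ ≤_) (solve 2 (λ l h → con ½ :* (h :- l) := con ½ :* (l :+ h) :- l) refl (lo b) (hi b))
      (0≤p*q (<⇒≤ (positive⁻¹ ½)) (p≤q⇒0≤q-p (<⇒≤ (lo<hi b)))))

    mid-below : ∀ b → mid b ≤ hi b
    mid-below b = 0≤q-p⇒p≤q (subst (0ℚ ≤_) (solve 2 (λ l h → con ½ :* (h :- l) := h :- con ½ :* (l :+ h)) refl (lo b) (hi b))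
      (0≤p*q (<⇒≤ (positive⁻¹ ½)) (p≤q⇒0≤q-p (<⇒≤ (lo<hi b)))))

    bisect′-spec : ∀ b d → lo b ≤ lo (bisect′ b d) × hi (bisect′ b d) ≤ hi b ×
      (hi (bisect′ b d) - lo (bisect′ b d)) + (hi (bisect′ b d) - lo (bisect′ b d)) ≡ hi b - lo b
    bisect′-spec b (yes psd) = mid-above b , ≤-refl ,
      solve 2 (λ l h → let m = con ½ :* (l :+ h) in (h :- m) :+ (h :- m) := h :- l) refl (lo b) (hi b)
    bisect′-spec b (no ¬psd) = ≤-refl , mid-below b ,
      solve 2 (λ l h → let m = con ½ :* (l :+ h) in (m :- l) :+ (m :- l) := h :- l) refl (lo b) (hi b)

    bisect-spec : ∀ b → lo b ≤ lo (bisect b) × hi (bisect b) ≤ hi b ×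
      (hi (bisect b) - lo (bisect b)) + (hi (bisect b) - lo (bisect b)) ≡ hi b - lo b
    bisect-spec b = bisect′-spec b (psd? (shift adjℚ (mid b)) (shift-symmetric (mid b)))

    module _ (b₀ : Bracket) where

      bracket : ℕ → Bracket
      bracket zero    = b₀
      bracket (suc n) = bisect (bracket n)

      width : ℕ → ℚ
      width n = hi (bracket n) - lo (bracket n)

      width-pow2 : ∀ n → pow2 n * width n ≡ width 0
      width-pow2 zero    = *-identityˡ (width 0)
      width-pow2 (suc n) = trans (solve 2 (λ p w → (p :+ p) :* w := p :* (w :+ w)) refl (pow2 n) (width (suc n)))
        (trans (cong (pow2 n *_) (proj₂ (proj₂ (bisect-spec (bracket n))))) (width-pow2 n))

      nested : ∀ {m n} → m ℕ.≤′ n → lo (bracket m) ≤ lo (bracket n) × hi (bracket n) ≤ hi (bracket m)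
      nested ℕ.≤′-refl = ≤-refl , ≤-refl
      nested {m} {suc n} (ℕ.≤′-step m≤n) =
        ≤-trans (proj₁ (nested m≤n)) (proj₁ (bisect-spec (bracket n))) ,
        ≤-trans (proj₁ (proj₂ (bisect-spec (bracket n)))) (proj₂ (nested m≤n))

      width-small : ∀ ε → Positive ε → Σ ℕ λ N → width N ≤ ε
      width-small ε ε>0 = use (divide ε (width 0) ε>0 w>0)
        where
        w>0 : Positive (width 0)
        w>0 = positive (subst (_< width 0) (+-inverseʳ (lo b₀)) (+-monoˡ-< (- lo b₀) (lo<hi b₀)))
        use : (Σ ℚ λ T → Positive T × ε * T ≡ width 0) → Σ ℕ λ N → width N ≤ ε
        use (T , T>0 , eq) = enough (archimedean T)
          where
          enough : (Σ ℕ λ N → T ≤ pow2 N) → Σ ℕ λ N → width N ≤ ε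
          enough (N , T≤) = N , *-cancelˡ-≤-pos (pow2 N) {{positive (<-≤-trans (positive⁻¹ 1ℚ) (1≤pow2 N))}} (begin
            pow2 N * width N  ≡⟨ width-pow2 N ⟩
            width 0           ≡⟨ sym eq ⟩
            ε * T             ≤⟨ *-monoˡ-≤-nonNeg ε {{pos⇒nonNeg ε {{ε>0}}}} T≤ ⟩
            ε * pow2 N        ≡⟨ *-comm ε (pow2 N) ⟩
            pow2 N * ε        ∎)
            where open ≤-Reasoning

      within : ∀ {p q N ε} → width N ≤ ε → lo (bracket N) ≤ p → p ≤ hi (bracket N) →
        lo (bracket N) ≤ q → q ≤ hi (bracket N) → ∣ p - q ∣ ≤ ε
      within {p} {q} {N} w lp ph lq qh = ∣p∣≤q (≤-trans (gap lq ph) w)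
        (≤-trans (subst (_≤ width N) (solve 2 (λ p q → q :- p := :- (p :- q)) refl p q) (gap lp qh)) w)
        where
        gap : ∀ {a b} → lo (bracket N) ≤ a → b ≤ hi (bracket N) → b - a ≤ width N
        gap la bh = +-mono-≤ bh (neg-antimono-≤ la)

      lo≤hi : ∀ n → lo (bracket n) ≤ hi (bracket n)
      lo≤hi n = <⇒≤ (lo<hi (bracket n))

      lo-in : ∀ {N n} → N ℕ.≤ n → lo (bracket N) ≤ lo (bracket n) × lo (bracket n) ≤ hi (bracket N)
      lo-in {N} {n} N≤n = proj₁ nst , ≤-trans (lo≤hi n) (proj₂ nst)
        where nst = nested (ℕ.≤⇒≤′ N≤n)

      hi-in : ∀ {N n} → N ℕ.≤ n → lo (bracket N) ≤ hi (bracket n) × hi (bracket n) ≤ hi (bracket N)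
      hi-in {N} {n} N≤n = ≤-trans (proj₁ nst) (lo≤hi n) , proj₂ nst
        where nst = nested (ℕ.≤⇒≤′ N≤n)

      loℝ hiℝ : ℝ
      loℝ = mkℝ (λ n → lo (bracket n)) λ ε ε>0 → let N , w = width-small ε ε>0 in
        N , λ m n m≥ n≥ → within {N = N} w (proj₁ (lo-in m≥)) (proj₂ (lo-in m≥)) (proj₁ (lo-in n≥)) (proj₂ (lo-in n≥))
      hiℝ = mkℝ (λ n → hi (bracket n)) λ ε ε>0 → let N , w = width-small ε ε>0 in
        N , λ m n m≥ n≥ → within {N = N} w (proj₁ (hi-in m≥)) (proj₂ (hi-in m≥)) (proj₁ (hi-in n≥)) (proj₂ (hi-in n≥))

      lo≃hi : loℝ ≃ hiℝ
      lo≃hi ε ε>0 = let N , w = width-small ε ε>0 in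
        N , λ n n≥ → within {N = N} w (proj₁ (lo-in n≥)) (proj₂ (lo-in n≥)) (proj₁ (hi-in n≥)) (proj₂ (hi-in n≥))

      shiftᴿ : ℝ → Matrix v
      shiftᴿ t i j = adjacencyMatrix G i j +ᴿ (fromℚ (- 1ℚ) *ᴿ t) *ᴿ fromℚ (δ i j)

      at-adjacency : ∀ m i j → seq (adjacencyMatrix G i j) m ≡ adjℚ i j
      at-adjacency m i j with adj i j
      ... | true  = refl
      ... | false = refl

      at-shift : ∀ t m i j → at (shiftᴿ t) m i j ≡ shift adjℚ (seq t m) i j
      at-shift t m i j = cong (_+ ((- 1ℚ) * seq t m) * δ i j) (at-adjacency m i j)

      at-shift-symmetric : ∀ t → SymmetricAt (shiftᴿ t)
      at-shift-symmetric t m i j = trans (at-shift t m i j) (trans (shift-symmetric (seq t m) i j) (sym (at-shift t m j i)))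

      shiftᴿ-cong : ∀ i j → shiftᴿ loℝ i j ≃ shiftᴿ hiℝ i j
      shiftᴿ-cong i j = +-cong-≃ {A} {A} {(-1ᴿ *ᴿ loℝ) *ᴿ D} {(-1ᴿ *ᴿ hiℝ) *ᴿ D} (≡⇒≃ {A} {A} (λ _ → refl))
        (*-cong-≃ { -1ᴿ *ᴿ loℝ} { -1ᴿ *ᴿ hiℝ} {D} {D}
          (*-cong-≃ { -1ᴿ} { -1ᴿ} {loℝ} {hiℝ} (≡⇒≃ { -1ᴿ} { -1ᴿ} (λ _ → refl)) lo≃hi) (≡⇒≃ {D} {D} (λ _ → refl)))
        where
        A = adjacencyMatrix G i j
        D = fromℚ (δ i j)
        -1ᴿ = fromℚ (- 1ℚ)

      shiftᴿ-psd : ∀ m → PSD (at (shiftᴿ loℝ) m)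
      shiftᴿ-psd m x = subst (0ℚ ≤_)
        (sym (form-congᴹ {M = at (shiftᴿ loℝ) m} {shift adjℚ (lo (bracket m))} (at-shift loℝ m) x)) (psd-lo (bracket m) x)

      shiftᴿ-¬psd : ∀ m → ¬ PSD (at (shiftᴿ hiℝ) m)
      shiftᴿ-¬psd m psd = ¬psd-hi (bracket m) λ x → subst (0ℚ ≤_)
        (form-congᴹ {M = at (shiftᴿ hiℝ) m} {shift adjℚ (hi (bracket m))} (at-shift hiℝ m) x) (psd x)

      at-mul-shiftᴿ : ∀ t x i m → seq ((shiftᴿ t · x) i) m ≡ seq ((adjacencyMatrix G · x) i) m - seq (t *ᴿ x i) m
      at-mul-shiftᴿ t x i m = trans (at-mul (shiftᴿ t) x i m)
        (trans (mul-shift (at (adjacencyMatrix G) m) (seq t m) (atᵛ x m) i)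
          (cong (λ z → z - seq (t *ᴿ x i) m) (sym (at-mul (adjacencyMatrix G) x i m))))

      kernel-row : ∀ t x i → (shiftᴿ t · x) i ≃ 0ℝ → (adjacencyMatrix G · x) i ≃ t *ᴿ x i
      kernel-row t x i = ≃-difference {(shiftᴿ t · x) i} {(adjacencyMatrix G · x) i} {t *ᴿ x i} (at-mul-shiftᴿ t x i)

      kernel⇒eigenvalue : ∀ t → Kernel (shiftᴿ t) → IsEigenvalue (adjacencyMatrix G) t
      kernel⇒eigenvalue t (x , x≄0 , ker) = x , x≄0 , λ i → kernel-row t x i (ker i)

      -- The matrices at the lower ends are semidefinite, those at the upper ends are not, and both
      -- sequences have the same limit, so elimination must meet a vanishing pivot. Which pivot it
      -- is cannot be decided.
      eigenvalue : ¬ ¬ IsEigenvalue (adjacencyMatrix G) loℝ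
      eigenvalue ¬eig = singular (shiftᴿ loℝ) (shiftᴿ hiℝ) shiftᴿ-cong (at-shift-symmetric loℝ) (at-shift-symmetric hiℝ)
        (0 , λ m _ → shiftᴿ-psd m) (0 , λ m _ → shiftᴿ-¬psd m) (λ ker → ¬eig (kernel⇒eigenvalue loℝ ker))

    -- A rational vector with a negative value keeps it after a slight decrease of the shift, so
    -- bisection would yield an eigenvalue below `-l` by a fixed amount.
    psd-of-smallestEigenvalue : ∀ l λmin → IsSmallestEigenvalue (adjacencyMatrix G) λmin →
      fromℤ (ℤ.- (ℤ.+ l)) ≤ᴿ λmin → PSD (shift adjℚ (- natℚ l))
    psd-of-smallestEigenvalue l λmin (_ , least) -l≤λmin z = ≮⇒≥ (λ neg → refute neg)
      where
      t = - natℚ l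
      F = form (shift adjℚ t) z
      S = z ∙ z
      refute : ¬ F < 0ℚ
      -- ε = -F / (1 + S) makes the value at shift t - ε equal to F + ε S = -ε.
      refute neg = use (divide (1ℚ + S) (- F) (pos+nonNeg⇒pos 1ℚ S {{nonNegative (0≤x∙x z)}}) (positive (neg-antimono-< neg)))
        where
        use : ¬ (Σ ℚ λ ε → Positive ε × (1ℚ + S) * ε ≡ - F)
        use (ε , ε>0 , eq) = eigenvalue b₀ λ eig →
            clash (least (loℝ b₀) eig (¼ * ε) ¼ε>0) (-l≤λmin (¼ * ε) ¼ε>0)
          where
          -- Two real comparisons are chained, each with tolerance ε/4, which leaves half of the gap
          -- ε.
          ¼ = ½ * ½
          ¼ε>0 : Positive (¼ * ε)
          ¼ε>0 = pos*pos⇒pos ¼ ε {{ε>0}}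
          value : form (shift adjℚ (t - ε)) z ≡ - ε
          value = begin
            form (shift adjℚ (t - ε)) z
              ≡⟨ form-shift adjℚ (t - ε) z ⟩
            form adjℚ z - (t - ε) * S
              ≡⟨ solve 4 (λ f t e s → f :- (t :- e) :* s := ((f :- t :* s) :+ (con 1ℚ :+ s) :* e) :- e) refl (form adjℚ z) t ε S ⟩
            ((form adjℚ z - t * S) + (1ℚ + S) * ε) - ε
              ≡⟨ cong₂ (λ p q → (p + q) - ε) (sym (form-shift adjℚ t z)) eq ⟩
            (F + - F) - ε
              ≡⟨ solve 2 (λ f e → (f :+ (:- f)) :- e := :- e) refl F ε ⟩
            - ε ∎
            where open ≡-Reasoning
          ¬psd : ¬ PSD (shift adjℚ (t - ε))
          ¬psd psd = <-irrefl refl (<-≤-trans (neg-antimono-< (positive⁻¹ ε {{ε>0}})) (subst (0ℚ ≤_) value (psd z)))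
          b₀ : Bracket
          b₀ = record { lo = - (natℚ v + natℚ v) ; hi = t - ε ; psd-lo = psd-shift-low ; ¬psd-hi = ¬psd }
          clash : Eventually (λ n → seq λmin n ≤ lo (bracket b₀ n) + ¼ * ε) →
                  Eventually (λ n → (ℤ.- (ℤ.+ l)) / 1 ≤ seq λmin n + ¼ * ε) → ⊥
          clash p q = contra (p ⊗ q)
            where
            contra : Eventually (λ n → seq λmin n ≤ lo (bracket b₀ n) + ¼ * ε × (ℤ.- (ℤ.+ l)) / 1 ≤ seq λmin n + ¼ * ε) → ⊥
            contra (N , h) = <-irrefl refl (<-≤-trans (positive⁻¹ (½ * ε) {{half>0 ε ε>0}}) (subst (½ * ε ≤_) (+-inverseʳ t) (begin
              ½ * ε                                       ≡⟨ solve 2 (λ t e → con ½ :* e := (t :- t) :+ con ½ :* e) refl t ε ⟩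
              (t - t) + ½ * ε                             ≤⟨ +-monoˡ-≤ (½ * ε) (+-monoˡ-≤ (- t) t≤) ⟩
              ((((t - ε) + ¼ * ε) + ¼ * ε) - t) + ½ * ε   ≡⟨ solve 2 (λ t e → let q = (con ½ :* con ½) :* e in ((((t :- e) :+ q) :+ q) :- t) :+ con ½ :* e := t :- t) refl t ε ⟩
              t - t                                       ∎)))
              where
              open ≤-Reasoning
              t≤ : t ≤ ((t - ε) + ¼ * ε) + ¼ * ε
              t≤ = begin
                t                                    ≡⟨ sym (-n/1≡-natℚ l) ⟩
                (ℤ.- (ℤ.+ l)) / 1                      ≤⟨ proj₂ (h N ℕ.≤-refl) ⟩
                seq λmin N + ¼ * ε                   ≤⟨ +-monoˡ-≤ (¼ * ε) (proj₁ (h N ℕ.≤-refl)) ⟩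
                (lo (bracket b₀ N) + ¼ * ε) + ¼ * ε  ≤⟨ +-monoˡ-≤ (¼ * ε) (+-monoˡ-≤ (¼ * ε) (proj₂ (lo-in b₀ {0} {N} ℕ.z≤n))) ⟩
                ((t - ε) + ¼ * ε) + ¼ * ε            ∎

-- The form A + l I on multisets of vertices.

module Weights where

  open import Data.Bool.Base using (Bool; if_then_else_)
  open import Data.Fin.Base using (Fin)
  open import Data.Fin.Properties as Fin using ()
  open import Data.List.Base using (List; map)
  open import Data.Nat.Base
  open import Data.Nat.ListAction using (sum)
  open import Relation.Nullary using (does)

  -- K is A + l I, and lists of vertices are multisets: Semidefinite is zᵀ K z ≥ 0 for z = 1_X - 1_Y.
  module Weight {v : ℕ} (G : Graph v) (l : ℕ) where
    open Graph G

    eqᵇ : Fin v → Fin v → Bool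
    eqᵇ x y = does (x Fin.≟ y)

    K : Fin v → Fin v → ℕ
    K x y = (if eqᵇ x y then l else 0) + (if adj x y then 1 else 0)

    K₁ : Fin v → List (Fin v) → ℕ
    K₁ x Y = sum (map (K x) Y)

    K₂ : List (Fin v) → List (Fin v) → ℕ
    K₂ X Y = sum (map (λ x → K₁ x Y) X)

    Semidefinite : Set
    Semidefinite = ∀ X Y → K₂ X Y + K₂ Y X ≤ K₂ X X + K₂ Y Y

module WeightForm where

  open import Data.Bool.Base using (true; false; if_then_else_)
  open import Data.Fin.Base using (Fin)
  open import Data.Fin.Properties as Fin using ()
  open import Data.List.Base using (List; []; _∷_; map)
  open import Data.Nat.Base as ℕ using (ℕ)
  open import Data.Nat.ListAction using (sum)
  import Data.Nat.Properties as ℕ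
  open import Data.Rational.Base hiding (_≃_)
  open import Data.Rational.Properties hiding (≡⇒≃)
  open import Data.Rational.Solver using (module +-*-Solver)
  open import Data.Vec.Functional using (Vector)
  open import Relation.Binary.PropositionalEquality using (_≡_; refl; sym; trans; cong; cong₂; subst; module ≡-Reasoning)
  open import Relation.Nullary using (does)
  open RationalForms
  open RealMatrices
  open SmallestEigenvalue
  open Weights
  open +-*-Solver using (solve; _:=_; _:+_; _:*_; _:-_; :-_; con)

  module _ {v : ℕ} (G : Graph v) (l : ℕ) where
    open Graph G
    open Weight G l

    Kℚ : Mat v
    Kℚ = shift (adjℚ G) (- natℚ l)

    K≡Kℚ : ∀ x y → natℚ (K x y) ≡ Kℚ x y
    K≡Kℚ x y = trans (natℚ-+ (if does (x Fin.≟ y) then l else 0) (if adj x y then 1 else 0))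
      (trans (cong₂ _+_ (diagonal (does (x Fin.≟ y))) (edge (adj x y)))
        (trans (cong (λ d → ((- 1ℚ) * (- natℚ l)) * d + adjℚ G x y) (sym (δ-≟ x y)))
          (+-comm (((- 1ℚ) * (- natℚ l)) * δ x y) (adjℚ G x y))))
      where
      diagonal : ∀ b → natℚ (if b then l else 0) ≡ ((- 1ℚ) * (- natℚ l)) * (if b then 1ℚ else 0ℚ)
      diagonal true  = solve 1 (λ n → n := (con (- 1ℚ) :* (:- n)) :* con 1ℚ) refl (natℚ l)
      diagonal false = solve 1 (λ n → con 0ℚ := (con (- 1ℚ) :* (:- n)) :* con 0ℚ) refl (natℚ l)
      edge : ∀ b → natℚ (if b then 1 else 0) ≡ (if b then 1ℚ else 0ℚ)
      edge true  = refl
      edge false = refl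

    indicator : List (Fin v) → Vector ℚ v
    indicator []      i = 0ℚ
    indicator (x ∷ X) i = δ x i + indicator X i

    ∙-indicator : ∀ f x X → f ∙ indicator (x ∷ X) ≡ f x + f ∙ indicator X
    ∙-indicator f x X = begin
      ∑ (λ i → f i * (δ x i + indicator X i))
        ≡⟨ ∑-cong (λ i → *-distribˡ-+ (f i) (δ x i) (indicator X i)) ⟩
      ∑ (λ i → f i * δ x i + f i * indicator X i)
        ≡⟨ ∑-+ (λ i → f i * δ x i) (λ i → f i * indicator X i) ⟩
      ∑ (λ i → f i * δ x i) + f ∙ indicator X
        ≡⟨ cong (_+ f ∙ indicator X) (∑-δ f x) ⟩
      f x + f ∙ indicator X ∎
      where open ≡-Reasoning

    ∙-indicator-sum : ∀ (g : Fin v → ℕ) f → (∀ x → natℚ (g x) ≡ f x) → ∀ X → natℚ (sum (map g X)) ≡ f ∙ indicator X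
    ∙-indicator-sum g f h []      = sym (∑-zero (λ i → f i * 0ℚ) (λ i → *-zeroʳ (f i)))
    ∙-indicator-sum g f h (x ∷ X) = begin
      natℚ (g x ℕ.+ sum (map g X))        ≡⟨ natℚ-+ (g x) (sum (map g X)) ⟩
      natℚ (g x) + natℚ (sum (map g X))   ≡⟨ cong₂ _+_ (h x) (∙-indicator-sum g f h X) ⟩
      f x + f ∙ indicator X               ≡⟨ sym (∙-indicator f x X) ⟩
      f ∙ indicator (x ∷ X)               ∎
      where open ≡-Reasoning

    K₂≡ : ∀ X Y → natℚ (K₂ X Y) ≡ mul Kℚ (indicator Y) ∙ indicator X
    K₂≡ X Y = ∙-indicator-sum (λ x → K₁ x Y) (mul Kℚ (indicator Y))
      (λ x → ∙-indicator-sum (K x) (Kℚ x) (K≡Kℚ x) Y) X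

    ∙-difference : ∀ f (p q : Vector ℚ v) → f ∙ (λ i → p i - q i) ≡ f ∙ p - f ∙ q
    ∙-difference f p q = begin
      ∑ (λ i → f i * (p i - q i))
        ≡⟨ ∑-cong (λ i → solve 3 (λ f p q → f :* (p :- q) := con 1ℚ :* (f :* p) :+ con (- 1ℚ) :* (f :* q)) refl (f i) (p i) (q i)) ⟩
      ∑ (λ i → 1ℚ * (f i * p i) + (- 1ℚ) * (f i * q i))
        ≡⟨ ∑-linear 1ℚ (- 1ℚ) (λ i → f i * p i) (λ i → f i * q i) ⟩
      1ℚ * (f ∙ p) + (- 1ℚ) * (f ∙ q)
        ≡⟨ solve 2 (λ p q → con 1ℚ :* p :+ con (- 1ℚ) :* q := p :- q) refl (f ∙ p) (f ∙ q) ⟩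
      f ∙ p - f ∙ q ∎
      where open ≡-Reasoning

    ∙-comm : ∀ (p q : Vector ℚ v) → p ∙ q ≡ q ∙ p
    ∙-comm p q = ∑-cong (λ i → *-comm (p i) (q i))

    form-difference : ∀ (p q : Vector ℚ v) → form Kℚ (λ i → p i - q i) ≡
      (mul Kℚ p ∙ p - mul Kℚ p ∙ q) - (mul Kℚ q ∙ p - mul Kℚ q ∙ q)
    form-difference p q = begin
      form Kℚ z
        ≡⟨ ∑-cong (λ i → cong (z i *_) (∙-difference (Kℚ i) p q)) ⟩
      z ∙ (λ i → mul Kℚ p i - mul Kℚ q i)
        ≡⟨ ∙-difference z (mul Kℚ p) (mul Kℚ q) ⟩
      z ∙ mul Kℚ p - z ∙ mul Kℚ q
        ≡⟨ cong₂ _-_ (trans (∙-comm z (mul Kℚ p)) (∙-difference (mul Kℚ p) p q))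
                     (trans (∙-comm z (mul Kℚ q)) (∙-difference (mul Kℚ q) p q)) ⟩
      (mul Kℚ p ∙ p - mul Kℚ p ∙ q) - (mul Kℚ q ∙ p - mul Kℚ q ∙ q) ∎
      where
      open ≡-Reasoning
      z : Vector ℚ v
      z i = p i - q i

    -- The value at a difference of two indicator vectors, with the mixed terms moved to the other
    -- side so that no subtraction remains.
    K₂-psd : PSD Kℚ → ∀ X Y → K₂ X Y ℕ.+ K₂ Y X ℕ.≤ K₂ X X ℕ.+ K₂ Y Y
    K₂-psd psd X Y = natℚ-cancel-≤ _ _ (0≤q-p⇒p≤q (subst (0ℚ ≤_) eq (psd (λ i → p i - q i))))
      where
      p = indicator X
      q = indicator Y
      regroup : ∀ a b c d → (a - b) - (c - d) ≡ (a + d) - (c + b)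
      regroup = solve 4 (λ a b c d → (a :- b) :- (c :- d) := (a :+ d) :- (c :+ b)) refl
      nats : ∀ X Y X′ Y′ → natℚ (K₂ X Y ℕ.+ K₂ X′ Y′) ≡ mul Kℚ (indicator Y) ∙ indicator X + mul Kℚ (indicator Y′) ∙ indicator X′
      nats X Y X′ Y′ = trans (natℚ-+ (K₂ X Y) (K₂ X′ Y′)) (cong₂ _+_ (K₂≡ X Y) (K₂≡ X′ Y′))
      eq : form Kℚ (λ i → p i - q i) ≡ natℚ (K₂ X X ℕ.+ K₂ Y Y) - natℚ (K₂ X Y ℕ.+ K₂ Y X)
      eq = trans (form-difference p q)
        (trans (regroup (mul Kℚ p ∙ p) (mul Kℚ p ∙ q) (mul Kℚ q ∙ p) (mul Kℚ q ∙ q))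
          (sym (cong₂ _-_ (nats X X Y Y) (nats X Y Y X))))

-- Counting in lists and generic choices.

module Counting where

  open import Data.Bool.Base using (Bool; true; false; not; _∨_; if_then_else_)
  open import Data.Bool.ListAction using (any)
  open import Data.List.Base using (List; []; _∷_; _++_; length)
  open import Data.List.Membership.Propositional using (_∈_)
  open import Data.List.Membership.Propositional.Properties using (∈-∃++; ∈-++⁻; ∈-++⁺ˡ; ∈-++⁺ʳ)
  open import Data.List.Relation.Binary.Sublist.Propositional using (_⊆_; []; _∷_; _∷ʳ_; minimum)
  open import Data.List.Relation.Binary.Sublist.Propositional.Properties using (All-resp-⊆)
  open import Data.List.Relation.Unary.All as All using (All; []; _∷_)
  open import Data.List.Relation.Unary.AllPairs using (AllPairs; []; _∷_)
  open import Data.List.Relation.Unary.Any using (here; there)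
  open import Data.Nat.Base
  open import Data.Nat.Properties
  open import Data.Product.Base using (Σ; ∃; _×_; _,_)
  open import Data.Sum.Base using (inj₁; inj₂)
  open import Level using (0ℓ)
  open import Relation.Binary.Core using (Rel)
  open import Relation.Binary.PropositionalEquality using (_≡_; _≢_; refl; sym; trans; cong; subst)
  open import Relation.Nullary using (contradiction)
  open import Algebra.Properties.CommutativeSemigroup +-commutativeSemigroup using (interchange; x∙yz≈y∙xz)

  private variable
    A : Set

  bit : Bool → ℕ
  bit b = if b then 1 else 0

  count : (A → Bool) → List A → ℕ
  count p []       = 0
  count p (x ∷ xs) = bit (p x) + count p xs

  count-++ : ∀ (p : A → Bool) xs ys → count p (xs ++ ys) ≡ count p xs + count p ys
  count-++ p []       ys = refl
  count-++ p (x ∷ xs) ys = trans (cong (bit (p x) +_) (count-++ p xs ys)) (sym (+-assoc (bit (p x)) (count p xs) (count p ys)))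

  count-not : ∀ (p : A → Bool) xs → count p xs + count (λ x → not (p x)) xs ≡ length xs
  count-not p []       = refl
  count-not p (x ∷ xs) with p x
  ... | true  = cong suc (count-not p xs)
  ... | false = trans (+-suc (count p xs) _) (cong suc (count-not p xs))

  count-all : ∀ (p : A → Bool) {xs} → All (λ x → p x ≡ true) xs → count p xs ≡ length xs
  count-all p []         = refl
  count-all p (px ∷ pxs) rewrite px = cong suc (count-all p pxs)

  count-none : ∀ (p : A → Bool) {xs} → All (λ x → p x ≡ false) xs → count p xs ≡ 0
  count-none p []         = refl
  count-none p (px ∷ pxs) rewrite px = count-none p pxs

  count-∨ : ∀ (p q : A → Bool) xs → count (λ x → p x ∨ q x) xs ≤ count p xs + count q xs
  count-∨ p q []       = z≤n
  count-∨ p q (x ∷ xs) = subst (bit (p x ∨ q x) + count (λ x → p x ∨ q x) xs ≤_)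
    (interchange (bit (p x)) (bit (q x)) (count p xs) (count q xs))
    (+-mono-≤ (bit-∨ (p x) (q x)) (count-∨ p q xs))
    where
    bit-∨ : ∀ a b → bit (a ∨ b) ≤ bit a + bit b
    bit-∨ true  b = s≤s z≤n
    bit-∨ false b = ≤-refl

  -- The union bound. With `avoid` it makes all generic choices below: bound what each condition
  -- spoils, then choose among the rest.
  count-any : ∀ {B : Set} (p : B → A → Bool) ts xs {b} → All (λ t → count (p t) xs ≤ b) ts →
    count (λ x → any (λ t → p t x) ts) xs ≤ length ts * b
  count-any p []       xs []       = ≤-reflexive (count-none (λ _ → false) {xs} (All.universal (λ _ → refl) xs))
  count-any p (t ∷ ts) xs (h ∷ hs) = ≤-trans (count-∨ (p t) (λ x → any (λ t → p t x) ts) xs)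
    (+-mono-≤ h (count-any p ts xs hs))

  any-false : ∀ {B : Set} (p : B → Bool) ts → any p ts ≡ false → All (λ t → p t ≡ false) ts
  any-false p []       h = []
  any-false p (t ∷ ts) h with p t in eq
  ... | false = eq ∷ any-false p ts h

  any-true : ∀ {B : Set} (p : B → Bool) ts → any p ts ≡ true → ∃ λ t → t ∈ ts × p t ≡ true
  any-true p (t ∷ ts) h with p t in eq
  ... | true  = t , here refl , eq
  ... | false with any-true p ts h
  ...   | u , u∈ , pu = u , there u∈ , pu

  any-intro : ∀ {B : Set} (p : B → Bool) {ts t} → t ∈ ts → p t ≡ true → any p ts ≡ true
  any-intro p (here refl) pt rewrite pt = refl
  any-intro p {s ∷ ts} (there t∈) pt with p s
  ... | true  = refl
  ... | false = any-intro p t∈ pt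

  ∨-false : ∀ {a b} → a ∨ b ≡ false → a ≡ false × b ≡ false
  ∨-false {false} h = refl , h

  pick : ∀ (p : A → Bool) xs n → n ≤ count p xs →
    Σ (List A) λ ys → ys ⊆ xs × length ys ≡ n × All (λ x → p x ≡ true) ys
  pick p xs       zero    h = [] , minimum xs , refl , []
  pick p (x ∷ xs) (suc n) h with p x in eq
  ... | true with pick p xs n (s≤s⁻¹ h)
  ...   | ys , sub , len , all = x ∷ ys , refl ∷ sub , cong suc len , eq ∷ all
  pick p (x ∷ xs) (suc n) h | false with pick p xs (suc n) h
  ...   | ys , sub , len , all = ys , x ∷ʳ sub , len , all

  sieve : ∀ (p : A → Bool) xs → Σ (List A) λ ys → ys ⊆ xs × length ys ≡ count p xs × All (λ x → p x ≡ true) ys ×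
    (∀ {z} → z ∈ xs → p z ≡ true → z ∈ ys)
  sieve p [] = [] , [] , refl , [] , λ ()
  sieve p (x ∷ xs) with sieve p xs
  ... | ys , sub , len , all , complete with p x in eq
  ...   | true  = x ∷ ys , refl ∷ sub , cong suc len , eq ∷ all ,
                  λ { (here refl) _ → here refl ; (there z∈) pz → there (complete z∈ pz) }
  ...   | false = ys , x ∷ʳ sub , len , all ,
                  λ { (here refl) pz → contradiction (trans (sym eq) pz) λ () ; (there z∈) pz → complete z∈ pz }

  not-true : ∀ {b} → not b ≡ true → b ≡ false
  not-true {false} _ = refl

  avoid : ∀ (p : A → Bool) xs n → n + count p xs ≤ length xs →
    Σ (List A) λ ys → ys ⊆ xs × length ys ≡ n × All (λ x → p x ≡ false) ys
  avoid p xs n h with pick (λ x → not (p x)) xs n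
      (+-cancelʳ-≤ (count p xs) n _ (subst (n + count p xs ≤_) (trans (sym (count-not p xs)) (+-comm (count p xs) _)) h))
  ... | ys , sub , len , all = ys , sub , len , All.map not-true all

  AllPairs-resp-⊆ : ∀ {R : Rel A 0ℓ} {xs ys} → ys ⊆ xs → AllPairs R xs → AllPairs R ys
  AllPairs-resp-⊆ []           []       = []
  AllPairs-resp-⊆ (_ ∷ʳ sub)   (_ ∷ rs) = AllPairs-resp-⊆ sub rs
  AllPairs-resp-⊆ (refl ∷ sub) (r ∷ rs) = All-resp-⊆ sub r ∷ AllPairs-resp-⊆ sub rs

  count-remove : ∀ (q : A → Bool) as {x} bs → count q (as ++ x ∷ bs) ≡ bit (q x) + count q (as ++ bs)
  count-remove q []       bs = refl
  count-remove q (a ∷ as) {x} bs = trans (cong (bit (q a) +_) (count-remove q as bs)) (x∙yz≈y∙xz (bit (q a)) (bit (q x)) _)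

  -- Each counted element of `xs` is removed from `ys` when it is met, so only `xs` has to be free
  -- of repetitions.
  count-unique : ∀ (p q : A → Bool) {xs ys} → AllPairs _≢_ xs →
    (∀ {x} → x ∈ xs → p x ≡ true → x ∈ ys × q x ≡ true) → count p xs ≤ count q ys
  count-unique p q {[]}     {ys} _          h = z≤n
  count-unique p q {x ∷ xs} {ys} (x∉ ∷ uxs) h with p x in px
  ... | false = count-unique p q uxs (λ y∈ → h (there y∈))
  ... | true with h (here refl) px
  ...   | x∈ys , qx with ∈-∃++ x∈ys
  ...     | as , bs , refl = begin
    suc (count p xs)                 ≤⟨ s≤s (count-unique p q uxs keep) ⟩
    suc (count q (as ++ bs))         ≡⟨ cong (λ b → bit b + count q (as ++ bs)) (sym qx) ⟩
    bit (q x) + count q (as ++ bs)   ≡⟨ sym (count-remove q as bs) ⟩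
    count q (as ++ x ∷ bs)           ∎
    where
    open ≤-Reasoning
    keep : ∀ {y} → y ∈ xs → p y ≡ true → y ∈ as ++ bs × q y ≡ true
    keep y∈ py with h (there y∈) py
    ... | y∈ys , qy with ∈-++⁻ as y∈ys
    ...   | inj₁ y∈as          = ∈-++⁺ˡ y∈as , qy
    ...   | inj₂ (here refl)   = contradiction refl (All.lookup x∉ y∈)
    ...   | inj₂ (there y∈bs)  = ∈-++⁺ʳ as y∈bs , qy

  count-mono : ∀ (p q : A → Bool) xs → (∀ x → p x ≡ true → q x ≡ true) → count p xs ≤ count q xs
  count-mono p q []       h = z≤n
  count-mono p q (x ∷ xs) h = +-mono-≤ (bit-mono (p x) (q x) (h x)) (count-mono p q xs h)
    where
    bit-mono : ∀ a b → (a ≡ true → b ≡ true) → bit a ≤ bit b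
    bit-mono true  b h rewrite h refl = ≤-refl
    bit-mono false b h = z≤n

-- Arithmetic of the test vectors, Ramsey numbers and calculus of weights.

module Combinatorics where

  open import Data.Bool.Base using (Bool; true; false; not; _∨_; _∧_; if_then_else_; T)
  open import Data.Bool.ListAction using (any)
  open import Data.Empty using (⊥; ⊥-elim)
  open import Data.Fin.Base using (Fin; zero; suc)
  open import Data.Fin.Properties as Fin using ()
  open import Data.Fin.Subset using (∣_∣; _∩_)
  open import Data.List.Base using (List; []; _∷_; _++_; length; map; [_]; allFin; tabulate)
  open import Data.List.Membership.Propositional using (_∈_)
  open import Data.List.Membership.Propositional.Properties using (∈-allFin)
  open import Data.List.Properties using (length-++; length-tabulate)
  open import Data.List.Relation.Binary.Sublist.Propositional using (_⊆_; []; _∷_; _∷ʳ_; minimum; lookup; ⊆-trans)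
  open import Data.List.Relation.Binary.Sublist.Propositional.Properties using (All-resp-⊆)
  open import Data.List.Relation.Unary.All as All using (All; []; _∷_)
  open import Data.List.Relation.Unary.All.Properties as All using ()
  open import Data.List.Relation.Unary.AllPairs as AllPairs using (AllPairs; []; _∷_)
  open import Data.List.Relation.Unary.AllPairs.Properties as AllPairs using ()
  open import Data.List.Relation.Unary.Any using (here; there)
  open import Data.List.Relation.Unary.Unique.Propositional.Properties using (allFin⁺)
  open import Data.Nat.Base
  open import Data.Nat.ListAction using (sum)
  open import Data.Nat.Properties
  open import Data.Nat.Solver using (module +-*-Solver)
  open import Data.Product.Base using (Σ; ∃; _×_; _,_; proj₁; proj₂)
  open import Data.Sum.Base using (_⊎_; inj₁; inj₂)
  import Data.Vec.Base as Vec
  open import Relation.Binary.PropositionalEquality using (_≡_; _≢_; refl; sym; trans; cong; cong₂; subst; subst₂; module ≡-Reasoning)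
  open import Relation.Nullary using (¬_; contradiction; yes; no)
  open import Relation.Nullary.Decidable using (dec-true; dec-false)
  open import Algebra.Properties.CommutativeSemigroup +-commutativeSemigroup using (interchange)
  open Weights
  open Counting
  open +-*-Solver using (solve; _:=_; _:+_; _:*_; con)

  rep : ∀ {A : Set} → ℕ → List A → List A
  rep zero    X = []
  rep (suc n) X = X ++ rep n X

  -- The form of the test vector is `l (l² - d)`.
  star-arith : ∀ t d → let l = suc t in
    2 * (l * 1 * d) + 2 * (l * 0 * 0) ≤ l * l * l + 1 * 1 * (l * d) + 0 * 0 * 0 + 2 * (1 * 0 * 0) → d ≤ l * l
  star-arith t d h = *-cancelˡ-≤ l (+-cancelʳ-≤ (l * d) (l * d) (l * (l * l)) (subst₂ _≤_
    (solve 2 (λ l d → con 2 :* (l :* con 1 :* d) :+ con 2 :* (l :* con 0 :* con 0) := l :* d :+ l :* d) refl l d)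
    (solve 2 (λ l d → l :* l :* l :+ con 1 :* con 1 :* (l :* d) :+ con 0 :* con 0 :* con 0 :+ con 2 :* (con 1 :* con 0 :* con 0) := l :* (l :* l) :+ l :* d) refl l d)
    h))
    where l = suc t

  -- The form of the test vector is `t n (a² - n (a - t l))`. Hence a = t l + 1 is the least number
  -- of neighbours that bounds the number n of non-neighbours, and the bound is a², which is `h`.
  split-arith : ∀ t n a → let l = suc t in .{{NonZero (t * n)}} → a ≡ suc (t * l) →
    2 * (n * (t * n) * (a * 1)) + 2 * (n * a * (a * n)) ≤
    n * n * (a * a + t * a) + (t * n) * (t * n) * l + a * a * (n * n + t * n) + 2 * ((t * n) * a * 0) → n ≤ a * a
  split-arith t n a refl h = +-cancelʳ-≤ (t * n * l) n (a * a) (subst (_≤ a * a + t * n * l)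
      (solve 3 (λ t n l → n :* (con 1 :+ t :* l) := n :+ t :* n :* l) refl t n l)
      (*-cancelˡ-≤ (t * n) (+-cancelˡ-≤ (2 * (a * a * (n * n)) + t * (n * n) * a) _ _ (subst₂ _≤_
        (solve 3 (λ t n a → con 2 :* (n :* (t :* n) :* (a :* con 1)) :+ con 2 :* (n :* a :* (a :* n)) :=
                   (con 2 :* (a :* a :* (n :* n)) :+ t :* (n :* n) :* a) :+ (t :* n) :* (n :* a)) refl t n a)
        (solve 4 (λ t n a l → n :* n :* (a :* a :+ t :* a) :+ (t :* n) :* (t :* n) :* l :+ a :* a :* (n :* n :+ t :* n) :+ con 2 :* ((t :* n) :* a :* con 0) :=
                   (con 2 :* (a :* a :* (n :* n)) :+ t :* (n :* n) :* a) :+ (t :* n) :* (a :* a :+ t :* n :* l)) refl t n a l)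
        h))))
    where l = suc t

  -- The form of the test vector is `l n (l² t - n)`: the terms `l³ n²` of y and the l cliques
  -- cancel, and the further neighbour makes the rest negative as soon as n exceeds `l² t`. This is
  -- the origin of `n₀`.
  fan-arith : ∀ t n → let l = suc t in .{{NonZero n}} →
    2 * ((l * n) * n * 1) + 2 * ((l * n) * l * (l * n)) ≤
    (l * n) * (l * n) * l + n * n * l + l * l * (l * (n * n + t * n)) + 2 * (n * l * 0) → n ≤ l * l * t
  fan-arith t n@(suc n-1) h = *-cancelˡ-≤ (l * n) (+-cancelˡ-≤ (2 * (l * l * l * (n * n)) + l * (n * n)) _ _ (subst₂ _≤_
    (solve 2 (λ l n → con 2 :* ((l :* n) :* n :* con 1) :+ con 2 :* ((l :* n) :* l :* (l :* n)) :=
               (con 2 :* (l :* l :* l :* (n :* n)) :+ l :* (n :* n)) :+ (l :* n) :* n) refl l n)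
    (solve 3 (λ l n t → (l :* n) :* (l :* n) :* l :+ n :* n :* l :+ l :* l :* (l :* (n :* n :+ t :* n)) :+ con 2 :* (n :* l :* con 0) :=
               (con 2 :* (l :* l :* l :* (n :* n)) :+ l :* (n :* n)) :+ (l :* n) :* (l :* l :* t)) refl l n t)
    h))
    where l = suc t

  -- The usual Ramsey recursion; the extra 1 is the vertex whose neighbours and non-neighbours are
  -- separated.
  ram : ℕ → ℕ → ℕ
  ram zero    d       = 0
  ram (suc s) zero    = 0
  ram (suc s) (suc d) = suc (ram s (suc d) + ram (suc s) d)

  -- l = t + 1 is the bound on the eigenvalue and a = l(l-1) + 1; h bounds the number of non-neighbours in a clique,
  -- q₀, q₁, q₂ are sizes that cliques need, and D bounds the number of vertices at distance 2.
  module Constants (t : ℕ) where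

    l a h n₀ q₀ q₁ q₂ R₀ D : ℕ
    l  = suc t
    a  = suc (t * l)
    h  = a * a
    n₀ = suc (l * l * t)
    q₀ = n₀ + (1 + ((1 + l * n₀) * a + l * (t * l)))
    q₁ = suc h + (a * suc h + a)
    q₂ = (a + (suc h * suc h + 1)) + (1 + suc (l * l) * suc h)
    R₀ = ram (suc h) (suc (l * l))
    D  = l * R₀

    ram′ : ℕ → ℕ
    ram′ s = ram s (suc (l * l))

  module WeightProperties {v : ℕ} (G : Graph v) (t : ℕ) where
    open Graph G
    open Weight G (suc t) public
    open Constants t public

    V : Set
    V = Fin v

    -- Equality is excluded, so `nadj y u ≡ false` says that `u` belongs to the closed neighbourhood
    -- of `y`.
    nadj : V → V → Bool
    nadj x y = not (eqᵇ x y ∨ adj x y)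

    Adj NAdj : V → V → Set
    Adj x y  = adj x y ≡ true
    NAdj x y = nadj x y ≡ true

    Clique Indep : List V → Set
    Clique = AllPairs Adj
    Indep  = AllPairs NAdj

    eqᵇ-refl : ∀ x → eqᵇ x x ≡ true
    eqᵇ-refl x = dec-true (x Fin.≟ x) refl

    eqᵇ-≢ : ∀ {x y} → x ≢ y → eqᵇ x y ≡ false
    eqᵇ-≢ {x} {y} = dec-false (x Fin.≟ y)

    eqᵇ-≡ : ∀ {x y} → eqᵇ x y ≡ true → x ≡ y
    eqᵇ-≡ {x} {y} h with x Fin.≟ y
    ... | yes x≡y = x≡y

    eqᵇ-sym : ∀ x y → eqᵇ x y ≡ eqᵇ y x
    eqᵇ-sym x y with x Fin.≟ y
    ... | yes refl = sym (eqᵇ-refl x)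
    ... | no x≢y   = sym (eqᵇ-≢ (λ y≡x → x≢y (sym y≡x)))

    adj-sym : ∀ {x y} → Adj x y → Adj y x
    adj-sym {x} {y} = trans (symm y x)

    adj⇒≢ : ∀ {x y} → Adj x y → x ≢ y
    adj⇒≢ {x} xy refl with trans (sym xy) (irrefl x)
    ... | ()

    nadj⇒≢ : ∀ {x y} → NAdj x y → x ≢ y
    nadj⇒≢ {x} xy refl rewrite eqᵇ-refl x with xy
    ... | ()

    nadj⇒¬adj : ∀ {x y} → NAdj x y → adj x y ≡ false
    nadj⇒¬adj {x} {y} h = proj₂ (∨-false {eqᵇ x y} (not-true h))

    nadj-intro : ∀ {x y} → x ≢ y → adj x y ≡ false → NAdj x y
    nadj-intro x≢y ¬xy rewrite eqᵇ-≢ x≢y | ¬xy = refl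

    nadj-false : ∀ {x y} → nadj x y ≡ false → x ≡ y ⊎ Adj x y
    nadj-false {x} {y} h with eqᵇ x y in eq | adj x y
    ... | true  | _    = inj₁ (eqᵇ-≡ eq)
    ... | false | true = inj₂ refl

    adj⇒¬nadj : ∀ {x y} → Adj x y → nadj x y ≡ false
    adj⇒¬nadj {x} {y} xy rewrite xy with eqᵇ x y
    ... | true  = refl
    ... | false = refl

    trichotomy : ∀ x y → bit (eqᵇ x y) + (bit (adj x y) + bit (nadj x y)) ≡ 1
    trichotomy x y with eqᵇ x y in eq
    ... | true rewrite eqᵇ-≡ {x} {y} eq | irrefl y = refl
    ... | false with adj x y
    ...   | true  = refl
    ...   | false = refl

    count-trichotomy : ∀ x ys → count (eqᵇ x) ys + (count (adj x) ys + count (nadj x) ys) ≡ length ys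
    count-trichotomy x []       = refl
    count-trichotomy x (y ∷ ys) = begin
      (bit (eqᵇ x y) + count (eqᵇ x) ys) + ((bit (adj x y) + count (adj x) ys) + (bit (nadj x y) + count (nadj x) ys))
        ≡⟨ cong ((bit (eqᵇ x y) + count (eqᵇ x) ys) +_) (interchange (bit (adj x y)) _ _ _) ⟩
      (bit (eqᵇ x y) + count (eqᵇ x) ys) + ((bit (adj x y) + bit (nadj x y)) + (count (adj x) ys + count (nadj x) ys))
        ≡⟨ interchange (bit (eqᵇ x y)) _ _ _ ⟩
      (bit (eqᵇ x y) + (bit (adj x y) + bit (nadj x y))) + (count (eqᵇ x) ys + (count (adj x) ys + count (nadj x) ys))
        ≡⟨ cong₂ _+_ (trichotomy x y) (count-trichotomy x ys) ⟩
      suc (length ys) ∎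
      where open ≡-Reasoning

    count-eq : ∀ x {ys} → AllPairs _≢_ ys → count (eqᵇ x) ys ≤ 1
    count-eq x []         = z≤n
    count-eq x {y ∷ ys} (y∉ ∷ u) with eqᵇ x y in eq
    ... | false = count-eq x u
    ... | true  = ≤-reflexive (cong suc (count-none (eqᵇ x) (All.map (λ y≢z → eqᵇ-≢ (λ x≡z → y≢z (trans (sym (eqᵇ-≡ {x} {y} eq)) x≡z))) y∉)))

    clique-unique : ∀ {Q} → Clique Q → AllPairs _≢_ Q
    clique-unique = AllPairs.map adj⇒≢

    clique-adj : ∀ {Q x y} → Clique Q → x ∈ Q → y ∈ Q → x ≢ y → Adj x y
    clique-adj (q ∷ cq) (here refl) (here refl) x≢y = contradiction refl x≢y
    clique-adj (q ∷ cq) (here refl) (there y∈)  x≢y = All.lookup q y∈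
    clique-adj (q ∷ cq) (there x∈)  (here refl) x≢y = adj-sym (All.lookup q x∈)
    clique-adj (q ∷ cq) (there x∈)  (there y∈)  x≢y = clique-adj cq x∈ y∈ x≢y

    K-adj : ∀ {x y} → Adj x y → K x y ≡ 1
    K-adj {x} {y} xy rewrite eqᵇ-≢ (adj⇒≢ xy) | xy = refl

    K-nadj : ∀ {x y} → NAdj x y → K x y ≡ 0
    K-nadj {x} {y} xy rewrite eqᵇ-≢ (nadj⇒≢ xy) | nadj⇒¬adj xy = refl

    K-self : ∀ x → K x x ≡ l
    K-self x rewrite eqᵇ-refl x | irrefl x = +-identityʳ l

    K-sym : ∀ x y → K x y ≡ K y x
    K-sym x y rewrite eqᵇ-sym x y | symm x y = refl

    K₂-++ˡ : ∀ X X′ Y → K₂ (X ++ X′) Y ≡ K₂ X Y + K₂ X′ Y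
    K₂-++ˡ []      X′ Y = refl
    K₂-++ˡ (x ∷ X) X′ Y = trans (cong (K₁ x Y +_) (K₂-++ˡ X X′ Y)) (sym (+-assoc (K₁ x Y) (K₂ X Y) (K₂ X′ Y)))

    K₂-∷ʳ : ∀ X y Y → K₂ X (y ∷ Y) ≡ K₁ y X + K₂ X Y
    K₂-∷ʳ []      y Y = refl
    K₂-∷ʳ (x ∷ X) y Y = trans (cong₂ (λ a b → (a + K₁ x Y) + b) (K-sym x y) (K₂-∷ʳ X y Y))
      (interchange (K y x) (K₁ x Y) (K₁ y X) (K₂ X Y))

    K₂-[] : ∀ X → K₂ X [] ≡ 0
    K₂-[] []      = refl
    K₂-[] (x ∷ X) = K₂-[] X

    K₂-sym : ∀ X Y → K₂ X Y ≡ K₂ Y X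
    K₂-sym []      Y = sym (K₂-[] Y)
    K₂-sym (x ∷ X) Y = trans (cong (K₁ x Y +_) (K₂-sym X Y)) (sym (K₂-∷ʳ Y x X))

    K₂-++ʳ : ∀ X Y Y′ → K₂ X (Y ++ Y′) ≡ K₂ X Y + K₂ X Y′
    K₂-++ʳ X Y Y′ = trans (K₂-sym X (Y ++ Y′)) (trans (K₂-++ˡ Y Y′ X) (cong₂ _+_ (K₂-sym Y X) (K₂-sym Y′ X)))

    K₂-repˡ : ∀ n X Y → K₂ (rep n X) Y ≡ n * K₂ X Y
    K₂-repˡ zero    X Y = refl
    K₂-repˡ (suc n) X Y = trans (K₂-++ˡ X (rep n X) Y) (cong (K₂ X Y +_) (K₂-repˡ n X Y))

    K₂-repʳ : ∀ n X Y → K₂ X (rep n Y) ≡ n * K₂ X Y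
    K₂-repʳ n X Y = trans (K₂-sym X (rep n Y)) (trans (K₂-repˡ n Y X) (cong (n *_) (K₂-sym Y X)))

    K₁-adj : ∀ {x Y} → All (Adj x) Y → K₁ x Y ≡ length Y
    K₁-adj []       = refl
    K₁-adj (h ∷ hs) = cong₂ _+_ (K-adj h) (K₁-adj hs)

    K₁-nadj : ∀ {x Y} → All (NAdj x) Y → K₁ x Y ≡ 0
    K₁-nadj []       = refl
    K₁-nadj (h ∷ hs) = cong₂ _+_ (K-nadj h) (K₁-nadj hs)

    K₂-adj : ∀ {X Y} → All (λ x → All (Adj x) Y) X → K₂ X Y ≡ length X * length Y
    K₂-adj []       = refl
    K₂-adj (h ∷ hs) = cong₂ _+_ (K₁-adj h) (K₂-adj hs)

    K₂-nadj : ∀ {X Y} → All (λ x → All (NAdj x) Y) X → K₂ X Y ≡ 0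
    K₂-nadj []       = refl
    K₂-nadj (h ∷ hs) = cong₂ _+_ (K₁-nadj h) (K₂-nadj hs)

    K₂-single : ∀ x → K₂ [ x ] [ x ] ≡ l
    K₂-single x = trans (+-identityʳ _) (trans (+-identityʳ _) (K-self x))

    K₂-∷ : ∀ x S → K₂ (x ∷ S) (x ∷ S) ≡ (l + K₁ x S) + (K₁ x S + K₂ S S)
    K₂-∷ x S = cong₂ (λ a b → (a + K₁ x S) + b) (K-self x) (K₂-∷ʳ S x S)

    K₂-clique : ∀ {S} → Clique S → K₂ S S ≡ length S * length S + t * length S
    K₂-clique {[]}    []       = sym (*-zeroʳ t)
    K₂-clique {x ∷ S} (h ∷ hs) = begin
      K₂ (x ∷ S) (x ∷ S)                       ≡⟨ K₂-∷ x S ⟩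
      (l + K₁ x S) + (K₁ x S + K₂ S S)         ≡⟨ cong₂ (λ a b → (l + a) + (a + b)) (K₁-adj h) (K₂-clique hs) ⟩
      (l + n) + (n + (n * n + t * n))          ≡⟨ solve 2 (λ n t → ((con 1 :+ t) :+ n) :+ (n :+ (n :* n :+ t :* n)) :=
                                                     (con 1 :+ n) :* (con 1 :+ n) :+ t :* (con 1 :+ n)) refl n t ⟩
      suc n * suc n + t * suc n                ∎
      where
      open ≡-Reasoning
      n = length S

    K₂-indep : ∀ {S} → Indep S → K₂ S S ≡ l * length S
    K₂-indep {[]}    []       = sym (*-zeroʳ l)
    K₂-indep {x ∷ S} (h ∷ hs) = begin
      K₂ (x ∷ S) (x ∷ S)                       ≡⟨ K₂-∷ x S ⟩
      (l + K₁ x S) + (K₁ x S + K₂ S S)         ≡⟨ cong₂ (λ a b → (l + a) + (a + b)) (K₁-nadj h) (K₂-indep hs) ⟩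
      (l + 0) + (0 + l * length S)             ≡⟨ solve 2 (λ l n → (l :+ con 0) :+ (con 0 :+ l :* n) := l :* (con 1 :+ n)) refl l (length S) ⟩
      l * suc (length S)                       ∎
      where open ≡-Reasoning

    K₂-disjoint-++ : ∀ {S T} → K₂ S T ≡ 0 → K₂ (S ++ T) (S ++ T) ≡ K₂ S S + K₂ T T
    K₂-disjoint-++ {S} {T} h = begin
      K₂ (S ++ T) (S ++ T)                         ≡⟨ K₂-++ˡ S T (S ++ T) ⟩
      K₂ S (S ++ T) + K₂ T (S ++ T)                ≡⟨ cong₂ _+_ (K₂-++ʳ S S T) (K₂-++ʳ T S T) ⟩
      (K₂ S S + K₂ S T) + (K₂ T S + K₂ T T)        ≡⟨ cong₂ (λ a b → (K₂ S S + a) + (b + K₂ T T)) h (trans (K₂-sym T S) h) ⟩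
      (K₂ S S + 0) + K₂ T T                        ≡⟨ cong (_+ K₂ T T) (+-identityʳ _) ⟩
      K₂ S S + K₂ T T                              ∎
      where open ≡-Reasoning

  -- Configurations forbidden by semidefiniteness.

  module Obstructions {v : ℕ} (G : Graph v) (t : ℕ) .{{_ : NonZero t}}
    (psd : Weight.Semidefinite G (suc t)) where
    open Graph G
    open WeightProperties G t public

    -- The value at `p X - q Y - r Z`, multiplicities being realised by repeated lists. Up to sign,
    -- every test vector has this shape.
    psd₃ : ∀ p q r X Y Z → 2 * (p * q * K₂ X Y) + 2 * (p * r * K₂ X Z) ≤
      p * p * K₂ X X + q * q * K₂ Y Y + r * r * K₂ Z Z + 2 * (q * r * K₂ Y Z)
    psd₃ p q r X Y Z = subst₂ _≤_ left right (psd P N)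
      where
      open ≡-Reasoning
      P = rep p X
      N = rep q Y ++ rep r Z
      PN : K₂ P N ≡ p * (q * K₂ X Y + r * K₂ X Z)
      PN = trans (K₂-repˡ p X N) (cong (p *_) (trans (K₂-++ʳ X (rep q Y) (rep r Z)) (cong₂ _+_ (K₂-repʳ q X Y) (K₂-repʳ r X Z))))
      left : K₂ P N + K₂ N P ≡ 2 * (p * q * K₂ X Y) + 2 * (p * r * K₂ X Z)
      left = trans (cong₂ _+_ PN (trans (K₂-sym N P) PN))
        (solve 5 (λ p q r a b → p :* (q :* a :+ r :* b) :+ p :* (q :* a :+ r :* b) := con 2 :* (p :* q :* a) :+ con 2 :* (p :* r :* b)) refl p q r _ _)
      YN : ∀ W → K₂ W N ≡ q * K₂ W Y + r * K₂ W Z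
      YN W = trans (K₂-++ʳ W (rep q Y) (rep r Z)) (cong₂ _+_ (K₂-repʳ q W Y) (K₂-repʳ r W Z))
      NN : K₂ N N ≡ q * (q * K₂ Y Y + r * K₂ Y Z) + r * (q * K₂ Y Z + r * K₂ Z Z)
      NN = trans (K₂-++ˡ (rep q Y) (rep r Z) N) (cong₂ _+_
        (trans (K₂-repˡ q Y N) (cong (q *_) (YN Y)))
        (trans (K₂-repˡ r Z N) (cong (r *_) (trans (YN Z) (cong (λ z → q * z + r * K₂ Z Z) (K₂-sym Z Y))))))
      right : K₂ P P + K₂ N N ≡ p * p * K₂ X X + q * q * K₂ Y Y + r * r * K₂ Z Z + 2 * (q * r * K₂ Y Z)
      right = trans (cong₂ _+_ (trans (K₂-repˡ p X P) (cong (p *_) (K₂-repʳ p X X))) NN)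
        (solve 7 (λ p q r a b c d → p :* (p :* a) :+ (q :* (q :* b :+ r :* d) :+ r :* (q :* d :+ r :* c)) :=
           p :* p :* a :+ q :* q :* b :+ r :* r :* c :+ con 2 :* (q :* r :* d)) refl p q r _ _ _ _)

    -- Test vector: l on x and -1 on S.
    star-bound : ∀ {x S} → Indep S → All (Adj x) S → length S ≤ l * l
    star-bound {x} {S} ind xS = star-arith t (length S) (subst₂ _≤_
      (cong₂ (λ a b → 2 * (l * 1 * a) + 2 * (l * 0 * b)) (trans (+-identityʳ _) (K₁-adj xS)) refl)
      (cong₂ (λ a b → l * l * a + 1 * 1 * b + 0 * 0 * 0 + 2 * (1 * 0 * 0)) (K₂-single x) (K₂-indep ind))
      (subst (λ z → 2 * (l * 1 * K₂ [ x ] S) + 2 * (l * 0 * 0) ≤ l * l * K₂ [ x ] [ x ] + 1 * 1 * K₂ S S + 0 * 0 * 0 + 2 * (1 * 0 * z))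
        (K₂-[] S) (psd₃ l 1 0 [ x ] S [])))

    -- Test vector: -n on a neighbours of x in Q, a on n = h + 1 non-neighbours (so the sum over Q vanishes), t n on x.
    split-bound : ∀ {Q x} → Clique Q → a ≤ count (adj x) Q → h < count (nadj x) Q → ⊥
    split-bound {Q} {x} cq a≤ h< with pick (adj x) Q a a≤ | pick (nadj x) Q (suc h) h<
    ... | N , N⊆ , |N| , xN | U , U⊆ , |U| , xU = <-irrefl refl (split-arith t n a {{m*n≢0 t n}} refl (subst₂ _≤_
        (cong₂ (λ p q → 2 * (n * (t * n) * p) + 2 * (n * a * q))
          (trans (K₂-adj {N} {[ x ]} (All.map (λ xu → adj-sym xu ∷ []) xN)) (cong (_* 1) |N|))
          (trans (K₂-adj NU) (cong₂ _*_ |N| |U|)))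
        (cong₂ _+_ (cong₂ _+_ (cong₂ _+_
            (cong (n * n *_) (trans (K₂-clique (AllPairs-resp-⊆ N⊆ cq)) (cong (λ m → m * m + t * m) |N|)))
            (cong ((t * n) * (t * n) *_) (K₂-single x)))
            (cong (a * a *_) (trans (K₂-clique (AllPairs-resp-⊆ U⊆ cq)) (cong (λ m → m * m + t * m) |U|))))
          (cong (λ z → 2 * ((t * n) * a * z)) (K₂-nadj {[ x ]} {U} (xU ∷ []))))
        (psd₃ n (t * n) a N [ x ] U)))
      where
      n = suc h
      NU : All (λ u → All (Adj u) U) N
      NU = All.tabulate λ {u} u∈ → All.tabulate λ {w} w∈ → clique-adj cq (lookup N⊆ u∈) (lookup U⊆ w∈)
        λ { refl → contradiction (trans (sym (All.lookup xN u∈)) (nadj⇒¬adj (All.lookup xU w∈))) λ () }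

  -- Fans of cliques and Ramsey's theorem.

  module Fans {v : ℕ} (G : Graph v) (t : ℕ) .{{_ : NonZero t}}
    (psd : Weight.Semidefinite G (suc t)) where
    open Graph G
    open Obstructions G t psd public

    -- By `split-bound` there is nothing between few and almost all: a fat vertex has at most `h`
    -- non-neighbours in the clique, any other at most `t l` neighbours.
    fat : V → List V → Bool
    fat u Q = a ≤ᵇ count (adj u) Q

    fat-false : ∀ {u Q} → fat u Q ≡ false → count (adj u) Q ≤ t * l
    fat-false {u} {Q} f with a ≤? count (adj u) Q
    ... | yes a≤ = contradiction (trans (sym f) (T⇒true (≤⇒≤ᵇ a≤))) λ ()
      where
      T⇒true : ∀ {b} → T b → b ≡ true
      T⇒true {true} _ = refl
    ... | no  a≰ = s≤s⁻¹ (≰⇒> a≰)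

    fat-true : ∀ {u Q} → fat u Q ≡ true → a ≤ count (adj u) Q
    fat-true {u} {Q} f = ≤ᵇ⇒≤ a (count (adj u) Q) (subst T (sym f) _)

    fat-nonadjacent : ∀ {u Q} → Clique Q → fat u Q ≡ true → count (nadj u) Q ≤ h
    fat-nonadjacent {u} {Q} cq f with count (nadj u) Q ≤? h
    ... | yes ≤h = ≤h
    ... | no  ≰h = ⊥-elim (split-bound {Q} {u} cq (fat-true {u} {Q} f) (≰⇒> ≰h))

    -- Newer cliques come first; up to t l exceptional vertices, each has at most t l neighbours in every older clique.
    data Fan (q : ℕ) (y : V) : List (List V) → Set where
      []   : Fan q y []
      cons : ∀ {Q Qs} → Clique Q → All (λ u → nadj y u ≡ false) Q → q ≤ length Q →
             All (λ Q′ → count (λ u → fat u Q′) Q ≤ t * l) Qs → Fan q y Qs → Fan q y (Q ∷ Qs)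

    count-closed : ∀ {x Q b} → Clique Q → count (adj x) Q ≤ b → count (λ u → not (nadj x u)) Q ≤ suc b
    count-closed {x} {Q} cq ≤b = ≤-trans (count-mono _ (λ u → eqᵇ x u ∨ adj x u) Q (λ u → not-not))
      (≤-trans (count-∨ (eqᵇ x) (adj x) Q) (+-mono-≤ (count-eq x (clique-unique cq)) ≤b))
      where
      not-not : ∀ {b} → not (not b) ≡ true → b ≡ true
      not-not {true} _ = refl

    -- Budget inside a clique of size q: n vertices to be chosen, y itself, at most `a` vertices
    -- equal or adjacent to each earlier choice, and `t l` exceptional vertices per older clique.
    -- The number of earlier choices is bounded by the final total `T + m n`, so the budget survives
    -- the recursion.
    Room : ℕ → ℕ → ℕ → ℕ → Set
    Room q n T m = n + (1 + ((T + m * n) * a + m * (t * l))) ≤ q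

    -- `T` holds the vertices to which no edge is allowed. Newer cliques are served first: their
    -- unexceptional vertices have few neighbours in each older clique, so these neighbours can be
    -- avoided later.
    transversal : ∀ q n {y Qs} T → Fan q y Qs → All (λ Q → All (λ u → fat u Q ≡ false) T) Qs →
      Room q n (length T) (length Qs) →
      Σ (List V) λ S → length S ≡ length Qs * n × All (Adj y) S × All (λ u → All (NAdj u) S) T ×
        K₂ S S ≡ length Qs * (n * n + t * n)
    transversal q n T [] _ _ = [] , refl , [] , All.universal (λ _ → []) T , refl
    transversal q n {y} {Q ∷ Qs} T (cons cq yQ q≤ new fan) (sparse ∷ sparses) room
      with avoid bad Q n (≤-trans (+-monoʳ-≤ n count-bad) (≤-trans (≤-trans (+-monoʳ-≤ n (+-monoʳ-≤ 1 (+-mono-≤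
        (*-monoˡ-≤ a (m≤m+n (length T) (suc (length Qs) * n))) (*-monoˡ-≤ (t * l) (n≤1+n (length Qs)))))) room) q≤))
      where
      bad : V → Bool
      bad u = eqᵇ y u ∨ (any (λ x → not (nadj x u)) T ∨ any (λ Q′ → fat u Q′) Qs)
      count-bad : count bad Q ≤ 1 + (length T * a + length Qs * (t * l))
      count-bad = ≤-trans (count-∨ (eqᵇ y) _ Q) (+-mono-≤ (count-eq y (clique-unique cq))
        (≤-trans (count-∨ (λ u → any (λ x → not (nadj x u)) T) _ Q) (+-mono-≤
          (count-any (λ x u → not (nadj x u)) T Q (All.map (λ {x} f → count-closed cq (fat-false {x} {Q} f)) sparse))
          (count-any (λ Q′ u → fat u Q′) Qs Q new))))
    ... | S₁ , S₁⊆ , |S₁| , good with transversal q n (S₁ ++ T) fan sparses′ room′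
      where
      sparses′ : All (λ Q′ → All (λ u → fat u Q′ ≡ false) (S₁ ++ T)) Qs
      sparses′ = All.tabulate λ Q′∈ → All.++⁺
        (All.map (λ {u} g → All.lookup (any-false (λ Q′ → fat u Q′) Qs (proj₂ (∨-false (proj₂ (∨-false {eqᵇ y u} g))))) Q′∈) good)
        (All.lookup sparses Q′∈)
      room′ : Room q n (length (S₁ ++ T)) (length Qs)
      room′ = ≤-trans (+-monoʳ-≤ n (+-monoʳ-≤ 1 (+-mono-≤ (≤-reflexive (cong (_* a)
          (trans (cong (_+ length Qs * n) (trans (length-++ S₁) (cong (_+ length T) |S₁|)))
            (solve 3 (λ n T m → (n :+ T) :+ m := T :+ (n :+ m)) refl n (length T) (length Qs * n)))))
        (*-monoˡ-≤ (t * l) (n≤1+n (length Qs)))))) room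
    ...   | S₂ , |S₂| , yS₂ , NS₂ , KS₂ = S₁ ++ S₂ ,
        trans (length-++ S₁) (cong₂ _+_ |S₁| |S₂|) ,
        All.++⁺ yS₁ yS₂ ,
        All.tabulate (λ x∈ → All.++⁺ (All.map (λ {u} g → not-not-false (All.lookup (any-false (λ x → not (nadj x u)) T (proj₁ (∨-false (proj₂ (∨-false {eqᵇ y u} g))))) x∈)) good)
          (All.lookup (All.++⁻ʳ S₁ NS₂) x∈)) ,
        trans (K₂-disjoint-++ {S₁} {S₂} (K₂-nadj (All.++⁻ˡ S₁ NS₂)))
          (cong₂ _+_ (trans (K₂-clique (AllPairs-resp-⊆ S₁⊆ cq)) (cong (λ m → m * m + t * m) |S₁|)) KS₂)
      where
      not-not-false : ∀ {b} → not b ≡ false → b ≡ true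
      not-not-false {true} _ = refl
      yS₁ : All (Adj y) S₁
      yS₁ = All.zipWith (λ {u} (g , n) → adjacent g (nadj-false n)) (good , All-resp-⊆ S₁⊆ yQ)
        where
        adjacent : ∀ {u} → eqᵇ y u ∨ _ ≡ false → y ≡ u ⊎ Adj y u → Adj y u
        adjacent {u} g (inj₁ refl) = contradiction (trans (sym (eqᵇ-refl y)) (proj₁ (∨-false {eqᵇ y u} g))) λ ()
        adjacent g (inj₂ yu)   = yu

    -- Test vector: l n₀ on y, -n₀ on w and -l on a transversal of the fan.
    fan-bound : ∀ {q y w Qs} → q₀ ≤ q → Fan q y Qs → length Qs ≡ l → Adj y w → All (λ Q → fat w Q ≡ false) Qs → ⊥
    fan-bound {q} {y} {w} {Qs} q₀≤q fan |Qs| yw sparse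
      with transversal q n₀ {y} {Qs} [ w ] fan (All.map (λ f → f ∷ []) sparse)
             (subst (λ m → Room q n₀ 1 m) (sym |Qs|) q₀≤q)
    ... | S , |S| , yS , (wS ∷ []) , KS = <-irrefl refl (fan-arith t n₀ (subst₂ _≤_
        (cong₂ (λ p q → 2 * ((l * n₀) * n₀ * p) + 2 * ((l * n₀) * l * q))
          (K₂-adj {[ y ]} {[ w ]} ((yw ∷ []) ∷ []))
          (trans (K₂-adj {[ y ]} {S} (yS ∷ [])) (trans (+-identityʳ _) (trans |S| (cong (_* n₀) |Qs|)))))
        (cong₂ _+_ (cong₂ _+_ (cong₂ _+_
            (cong ((l * n₀) * (l * n₀) *_) (K₂-single y))
            (cong (n₀ * n₀ *_) (K₂-single w)))
            (cong (l * l *_) (trans KS (cong (_* (n₀ * n₀ + t * n₀)) |Qs|))))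
          (cong (λ z → 2 * (n₀ * l * z)) (K₂-nadj {[ w ]} {S} (wS ∷ []))))
        (psd₃ (l * n₀) n₀ l [ y ] [ w ] S)))

    ramsey : ∀ s d {xs} → AllPairs _≢_ xs → ram s d ≤ length xs →
      (Σ (List V) λ ys → ys ⊆ xs × Clique ys × length ys ≡ s) ⊎ (Σ (List V) λ ys → ys ⊆ xs × Indep ys × length ys ≡ d)
    ramsey zero    d       {xs} u r = inj₁ ([] , minimum xs , [] , refl)
    ramsey (suc s) zero    {xs} u r = inj₂ ([] , minimum xs , [] , refl)
    ramsey (suc s) (suc d) {x ∷ xs} (x∉ ∷ u) (s≤s r) with ram s (suc d) ≤? count (adj x) xs
    ... | yes r₁ with pick (adj x) xs (count (adj x) xs) ≤-refl
    ...   | zs , zs⊆ , |zs| , xzs with ramsey s (suc d) (AllPairs-resp-⊆ zs⊆ u) (subst (ram s (suc d) ≤_) (sym |zs|) r₁)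
    ...     | inj₁ (ys , ys⊆ , cl , |ys|) = inj₁ (x ∷ ys , refl ∷ ⊆-trans ys⊆ zs⊆ , All-resp-⊆ ys⊆ xzs ∷ cl , cong suc |ys|)
    ...     | inj₂ (ys , ys⊆ , ind , |ys|) = inj₂ (ys , x ∷ʳ ⊆-trans ys⊆ zs⊆ , ind , |ys|)
    ramsey (suc s) (suc d) {x ∷ xs} (x∉ ∷ u) (s≤s r) | no r₁ with pick (nadj x) xs (count (nadj x) xs) ≤-refl
    ...   | zs , zs⊆ , |zs| , xzs with ramsey (suc s) d (AllPairs-resp-⊆ zs⊆ u) (subst (ram (suc s) d ≤_) (sym |zs|) r₂)
      where
      split : count (adj x) xs + count (nadj x) xs ≡ length xs
      split = subst (λ z → z + (count (adj x) xs + count (nadj x) xs) ≡ length xs)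
        (count-none (eqᵇ x) (All.map eqᵇ-≢ x∉)) (count-trichotomy x xs)
      r₂ : ram (suc s) d ≤ count (nadj x) xs
      r₂ = +-cancelˡ-≤ (ram s (suc d)) _ _ (≤-trans r (subst (_≤ ram s (suc d) + count (nadj x) xs) split
        (+-monoˡ-≤ (count (nadj x) xs) (<⇒≤ (≰⇒> r₁)))))
    ...     | inj₁ (ys , ys⊆ , cl , |ys|) = inj₁ (ys , x ∷ʳ ⊆-trans ys⊆ zs⊆ , cl , |ys|)
    ...     | inj₂ (ys , ys⊆ , ind , |ys|) = inj₂ (x ∷ ys , refl ∷ ⊆-trans ys⊆ zs⊆ , All-resp-⊆ ys⊆ xzs ∷ ind , cong suc |ys|)

    clique-in-neighbourhood : ∀ s {x xs} → AllPairs _≢_ xs → All (Adj x) xs → ram′ s ≤ length xs →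
      Σ (List V) λ ys → ys ⊆ xs × Clique ys × length ys ≡ s
    clique-in-neighbourhood s u xs r with ramsey s (suc (l * l)) u r
    ... | inj₁ cl = cl
    ... | inj₂ (ys , ys⊆ , ind , |ys|) =
      contradiction (subst (_≤ l * l) |ys| (star-bound ind (All-resp-⊆ ys⊆ xs))) (<-irrefl refl)

  ∧-true : ∀ {a b} → a ∧ b ≡ true → a ≡ true × b ≡ true
  ∧-true {true} h = refl , h

  not-false : ∀ {b} → not b ≡ false → b ≡ true
  not-false {true} _ = refl

  -- Connectedness enters through this edge only; the sets used are neighbourhoods and balls of
  -- radius 2.
  walk-exit : ∀ {v} (G : Graph v) (p : Fin v → Bool) {n x z} → Walk G n x z → p x ≡ true → p z ≡ false →
    ∃ λ b → ∃ λ b′ → Graph.adj G b b′ ≡ true × p b ≡ true × p b′ ≡ false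
  walk-exit G p nil px pz = contradiction (trans (sym px) pz) λ ()
  walk-exit G p (cons {x = x} {y = y} xy w) px pz with p y in py
  ... | true  = walk-exit G p w py pz
  ... | false = x , y , xy , px , py

  -- Vertices at distance 2, and fat vertices of large cliques.

  module Sesqui {v : ℕ} (G : Graph v) (t : ℕ) .{{_ : NonZero t}}
    (psd : Weight.Semidefinite G (suc t))
    where
    open Graph G
    open Fans G t psd public

    verts : List V
    verts = allFin v

    verts-unique : AllPairs _≢_ verts
    verts-unique = allFin⁺ v

    d2 : V → V → Bool
    d2 x y = nadj x y ∧ any (λ z → adj x z ∧ adj z y) verts

    d2-intro : ∀ {x y z} → NAdj x y → Adj x z → Adj z y → d2 x y ≡ true
    d2-intro {x} {y} {z} xy xz zy rewrite xy = any-intro (λ z → adj x z ∧ adj z y) (∈-allFin z) (cong₂ _∧_ xz zy)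

    d2-elim : ∀ {x y} → d2 x y ≡ true → NAdj x y × ∃ λ z → Adj x z × Adj z y
    d2-elim {x} {y} xy with ∧-true {nadj x y} xy
    ... | nxy , e with any-true (λ z → adj x z ∧ adj z y) verts e
    ...   | z , _ , e′ = nxy , z , ∧-true {adj x z} e′

    common : V → V → V → Bool
    common x y z = adj x z ∧ adj y z

    select : ∀ (p : V → Bool) → Σ (List V) λ ys → ys ⊆ verts × length ys ≡ count p verts × All (λ x → p x ≡ true) ys ×
      (∀ z → p z ≡ true → z ∈ ys)
    select p with sieve p verts
    ... | ys , ys⊆ , |ys| , all , complete = ys , ys⊆ , |ys| , all , λ z → complete (∈-allFin z)

    select-unique : ∀ {ys} → ys ⊆ verts → AllPairs _≢_ ys
    select-unique ys⊆ = AllPairs-resp-⊆ ys⊆ verts-unique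

    clique-++ : ∀ {U Z} → Clique U → Clique Z → All (λ u → All (Adj u) Z) U → Clique (U ++ Z)
    clique-++ = AllPairs.++⁺

    split-bound-++ : ∀ {U Z x} → Clique U → Clique Z → All (λ u → All (Adj u) Z) U →
      All (Adj x) U → All (NAdj x) Z → length U ≡ a → length Z ≡ suc h → ⊥
    split-bound-++ {U} {Z} {x} cU cZ UZ xU xZ |U| |Z| = split-bound {U ++ Z} {x} (clique-++ cU cZ UZ)
      (subst (a ≤_) (sym (count-++ (adj x) U Z)) (≤-trans (≤-reflexive (trans (sym |U|) (sym (count-all (adj x) xU)))) (m≤m+n _ _)))
      (subst (h <_) (sym (count-++ (nadj x) U Z)) (≤-trans (≤-reflexive (trans (sym |Z|) (sym (count-all (nadj x) xZ)))) (m≤n+m _ _)))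

    count-nonadj : ∀ {u Q b} → Clique Q → count (nadj u) Q ≤ b → count (λ z → not (adj u z)) Q ≤ suc b
    count-nonadj {u} {Q} cq ≤b = ≤-trans (count-mono _ (λ z → eqᵇ u z ∨ nadj u z) Q (λ z → weaken (eqᵇ u z) (adj u z)))
      (≤-trans (count-∨ (eqᵇ u) (nadj u) Q) (+-mono-≤ (count-eq u (clique-unique cq)) ≤b))
      where
      weaken : ∀ p q → not q ≡ true → p ∨ not (p ∨ q) ≡ true
      weaken true  q     _ = refl
      weaken false false _ = refl

    -- Otherwise `a` fat vertices of `P`, with `h + 1` vertices of `Q` adjacent to all of them but
    -- not to `y`, form a clique that contradicts `split-bound` at `y`. In `Q` each of the `a`
    -- vertices spoils at most `h + 1` vertices and `y` at most `a`, which explains `q₁`.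
    few-fat : ∀ {y P Q} → Clique P → All (Adj y) P → Clique Q → q₁ ≤ length Q → fat y Q ≡ false →
      count (λ u → fat u Q) P ≤ t * l
    few-fat {y} {P} {Q} cP yP cQ |Q| sparse with count (λ u → fat u Q) P ≤? t * l
    ... | yes few = few
    ... | no many with pick (λ u → fat u Q) P a (≰⇒> many)
    ...   | U , U⊆ , |U| , fatU with avoid bad Q (suc h) (≤-trans (+-monoʳ-≤ (suc h) count-bad) |Q|)
      where
      bad : V → Bool
      bad z = any (λ u → not (adj u z)) U ∨ not (nadj y z)
      count-bad : count bad Q ≤ a * suc h + a
      count-bad = ≤-trans (count-∨ (λ z → any (λ u → not (adj u z)) U) _ Q) (+-mono-≤
        (subst (λ m → count (λ z → any (λ u → not (adj u z)) U) Q ≤ m * suc h) |U|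
          (count-any (λ u z → not (adj u z)) U Q (All.map (λ {u} f → count-nonadj cQ (fat-nonadjacent {u} {Q} cQ f)) fatU)))
        (count-closed {y} {Q} cQ (fat-false {y} {Q} sparse)))
    ...     | Z , Z⊆ , |Z| , good = ⊥-elim (split-bound-++ {U} {Z} {y} (AllPairs-resp-⊆ U⊆ cP) (AllPairs-resp-⊆ Z⊆ cQ)
        (All.tabulate λ u∈ → All.map (λ {z} g → not-false (All.lookup (any-false (λ u → not (adj u z)) U (proj₁ (∨-false g))) u∈)) good)
        (All-resp-⊆ U⊆ yP)
        (All.map (λ {z} g → not-false (proj₂ (∨-false {any (λ u → not (adj u z)) U} g))) good) |U| |Z|)

    -- Among `R₀` such vertices there is a clique of size `h + 1` or an independent set of size
    -- `l² + 1`. The clique extends by `a` vertices of `Q` adjacent to all of it, contradicting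
    -- `split-bound` at `x`; the independent set has a common neighbour in `Q`, contradicting
    -- `star-bound`. `q₂` leaves room for either choice.
    few-nonneighbours : ∀ {x Q ys} → Clique Q → All (λ u → nadj x u ≡ false) Q → q₂ ≤ length Q →
      AllPairs _≢_ ys → All (NAdj x) ys → All (λ y → fat y Q ≡ true) ys → length ys ≤ R₀
    few-nonneighbours {x} {Q} {ys} cQ xQ |Q| uys xys fatys with R₀ ≤? length ys
    ... | no R≰ = <⇒≤ (≰⇒> R≰)
    ... | yes R≤ = ⊥-elim (refute (ramsey (suc h) (suc (l * l)) uys R≤))
      where
      bad : List V → V → Bool
      bad Z z = any (λ y → not (adj y z)) Z
      count-bad : ∀ {Z} → Z ⊆ ys → count (bad Z) Q ≤ length Z * suc h
      count-bad {Z} Z⊆ = count-any (λ y z → not (adj y z)) Z Q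
        (All.map (λ {y} f → count-nonadj cQ (fat-nonadjacent {y} {Q} cQ f)) (All-resp-⊆ Z⊆ fatys))
      good-adj : ∀ {Z z} → bad Z z ≡ false → All (λ y → Adj y z) Z
      good-adj {Z} {z} g = All.map not-false (any-false (λ y → not (adj y z)) Z g)
      refute : (Σ (List V) λ Z → Z ⊆ ys × Clique Z × length Z ≡ suc h) ⊎ (Σ (List V) λ Z → Z ⊆ ys × Indep Z × length Z ≡ suc (l * l)) → ⊥
      refute (inj₁ (Z , Z⊆ , cZ , |Z|)) with avoid (λ z → bad Z z ∨ eqᵇ x z) Q a (≤-trans (+-monoʳ-≤ a
          (≤-trans (count-∨ (bad Z) (eqᵇ x) Q) (+-mono-≤ (subst (λ m → count (bad Z) Q ≤ m * suc h) |Z| (count-bad Z⊆)) (count-eq x (clique-unique cQ)))))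
          (≤-trans (m≤m+n _ _) |Q|))
      ... | U , U⊆ , |U| , good = split-bound-++ {U} {Z} {x} (AllPairs-resp-⊆ U⊆ cQ) cZ
          (All.map (λ {u} g → All.map adj-sym (good-adj (proj₁ (∨-false {bad Z u} g)))) good)
          (All.zipWith (λ {u} (g , n) → adjacent u (proj₂ (∨-false {bad Z u} g)) (nadj-false n)) (good , All-resp-⊆ U⊆ xQ))
          (All-resp-⊆ Z⊆ xys) |U| |Z|
        where
        adjacent : ∀ u → eqᵇ x u ≡ false → x ≡ u ⊎ Adj x u → Adj x u
        adjacent u e (inj₁ refl) = contradiction (trans (sym (eqᵇ-refl x)) e) λ ()
        adjacent u e (inj₂ xu)   = xu
      refute (inj₂ (I , I⊆ , iI , |I|)) with avoid (bad I) Q 1 (≤-trans (+-monoʳ-≤ 1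
          (subst (λ m → count (bad I) Q ≤ m * suc h) |I| (count-bad I⊆))) (≤-trans (m≤n+m _ (a + (suc h * suc h + 1))) |Q|))
      ... | u ∷ [] , _ , _ , g ∷ [] = <-irrefl refl (subst (_≤ l * l) |I| (star-bound iI (All.map adj-sym (good-adj g))))

    fan-all : ∀ {q y Qs} → Fan q y Qs → All (λ Q → Clique Q × All (λ u → nadj y u ≡ false) Q × q ≤ length Q) Qs
    fan-all []                    = []
    fan-all (cons cQ yQ q≤ _ fan) = (cQ , yQ , q≤) ∷ fan-all fan

    -- Large c: the number of non-neighbours is bounded.

    module LargeCommon (q c : ℕ) (q₀≤q : q₀ ≤ q) (q₁≤q : q₁ ≤ q) (q₂≤q : q₂ ≤ q) (ram≤c : ram′ q ≤ c) (D<c : D < c)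
      (common-count : ∀ {x y} → d2 x y ≡ true → count (common x y) verts ≡ c)
      (connected : Connected G) where

      common-clique : ∀ {x y} → d2 x y ≡ true → Σ (List V) λ Q → Clique Q × length Q ≡ q × All (Adj x) Q × All (Adj y) Q
      common-clique {x} {y} xy with select (common x y)
      ... | zs , zs⊆ , |zs| , xyzs , _ with clique-in-neighbourhood q {x} (select-unique zs⊆) (All.map (λ e → proj₁ (∧-true e)) xyzs)
            (subst (ram′ q ≤_) (sym (trans |zs| (common-count xy))) ram≤c)
      ...   | Q , Q⊆ , cQ , |Q| = Q , cQ , |Q| , All-resp-⊆ Q⊆ (All.map (λ e → proj₁ (∧-true e)) xyzs) ,
              All-resp-⊆ Q⊆ (All.map (λ {z} e → proj₂ (∧-true {adj x z} e)) xyzs)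

      Cover : V → Set
      Cover x = Σ (List (List V)) λ Qs → length Qs ≤ l × Fan q x Qs × (∀ y → d2 x y ≡ true → any (fat y) Qs ≡ true)

      -- Greedy: if a vertex `y` at distance 2 is fat for no clique of the fan, a clique in the
      -- common neighbourhood of `x` and `y` prolongs the fan, its exceptional vertices being
      -- bounded by `few-fat`.
      cover-from : ∀ x m Qs → m + length Qs ≡ l → Fan q x Qs → Cover x
      cover-from x m Qs eq fan with any (λ y → d2 x y ∧ not (any (fat y) Qs)) verts in more
      ... | false = Qs , subst (length Qs ≤_) eq (m≤n+m (length Qs) m) , fan , covered
        where
        covered : ∀ y → d2 x y ≡ true → any (fat y) Qs ≡ true
        covered y xy with any (fat y) Qs in e | All.lookup (any-false (λ y → d2 x y ∧ not (any (fat y) Qs)) verts more) (∈-allFin y)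
        ... | true  | _ = refl
        ... | false | f rewrite xy with f
        ...   | ()
      ... | true with any-true (λ y → d2 x y ∧ not (any (fat y) Qs)) verts more
      ...   | y , _ , e with ∧-true {d2 x y} e
      ...     | xy , ne with common-clique xy
      ...       | P , cP , |P| , xP , yP = extend m eq
        where
        sparse : All (λ Q → fat y Q ≡ false) Qs
        sparse = any-false (fat y) Qs (not-true ne)
        new : All (λ Q → count (λ u → fat u Q) P ≤ t * l) Qs
        new = All.zipWith (λ {Q} (f , (cQ , _ , q≤)) → few-fat {y} {P} {Q} cP yP cQ (≤-trans q₁≤q q≤) f) (sparse , fan-all fan)
        extend : ∀ m → m + length Qs ≡ l → Cover x
        extend (suc m) eq = cover-from x m (P ∷ Qs) (trans (+-suc m (length Qs)) eq)
          (cons cP (All.map adj⇒¬nadj xP) (≤-reflexive (sym |P|)) new fan)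
        -- With `l` cliques present, a vertex of `P` fat for none of them would be a neighbour of
        -- `x` that `fan-bound` excludes.
        extend zero eq with avoid (λ u → any (fat u) Qs) P 1 (≤-trans (+-monoʳ-≤ 1
            (subst (λ m → count (λ u → any (fat u) Qs) P ≤ m * (t * l)) eq (count-any (λ Q u → fat u Q) Qs P new)))
            (subst (1 + l * (t * l) ≤_) (sym |P|) (≤-trans room q₀≤q)))
          where
          room : 1 + l * (t * l) ≤ q₀
          room = ≤-trans (+-monoʳ-≤ 1 (m≤n+m (l * (t * l)) ((1 + l * n₀) * a))) (m≤n+m _ n₀)
        ... | w ∷ [] , w⊆ , _ , g ∷ [] = ⊥-elim (fan-bound {q} {x} {w} {Qs} q₀≤q fan eq (All.head (All-resp-⊆ w⊆ xP)) (any-false (fat w) Qs g))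

      cover : ∀ x → Cover x
      cover x = cover-from x l [] (+-identityʳ l) []

      d2-count : ∀ x → count (d2 x) verts ≤ D
      d2-count x with cover x
      ... | Qs , |Qs| , fan , covers = ≤-trans (count-mono (d2 x) (λ y → any (λ Q → nadj x y ∧ fat y Q) Qs) verts near)
          (≤-trans (count-any (λ Q y → nadj x y ∧ fat y Q) Qs verts (All.map few (fan-all fan))) (*-monoˡ-≤ R₀ |Qs|))
        where
        near : ∀ y → d2 x y ≡ true → any (λ Q → nadj x y ∧ fat y Q) Qs ≡ true
        near y xy with any-true (fat y) Qs (covers y xy)
        ... | Q , Q∈ , f = any-intro (λ Q → nadj x y ∧ fat y Q) Q∈ (cong₂ _∧_ (proj₁ (d2-elim xy)) f)
        few : ∀ {Q} → Clique Q × All (λ u → nadj x u ≡ false) Q × q ≤ length Q → count (λ y → nadj x y ∧ fat y Q) verts ≤ R₀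
        few {Q} (cQ , xQ , q≤) with select (λ y → nadj x y ∧ fat y Q)
        ... | ys , ys⊆ , |ys| , e , _ = subst (_≤ R₀) |ys| (few-nonneighbours {x} {Q} {ys} cQ xQ (≤-trans q₂≤q q≤) (select-unique ys⊆)
            (All.map (λ {y} e → proj₁ (∧-true {nadj x y} e)) e) (All.map (λ {y} e → proj₂ (∧-true {nadj x y} e)) e))

      -- Otherwise an edge leads from some `b` at distance 2 to some `b′` at distance 3 from `x`.
      -- The `c` common neighbours of `x` and `b` are then at distance 2 from `b′` through `b`, but
      -- by `d2-count` there are at most `D < c` such vertices.
      diameter-two : ∀ x z → NAdj x z → d2 x z ≡ true
      diameter-two x z xz with d2 x z in far
      ... | true  = refl
      ... | false with walk-exit G (λ u → not (nadj x u) ∨ d2 x u) (proj₂ (connected x z))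
                         (cong (λ b → not (not (b ∨ adj x x)) ∨ d2 x x) (eqᵇ-refl x))
                         (cong₂ (λ a b → not a ∨ b) xz far)
      ...   | b , b′ , bb′ , near , far′ = ⊥-elim (cases (nadj x b) refl near)
        where
        xb′ : NAdj x b′
        xb′ = not-false (proj₁ (∨-false {not (nadj x b′)} far′))
        ¬d2 : d2 x b′ ≡ false
        ¬d2 = proj₂ (∨-false {not (nadj x b′)} far′)
        no-path : ∀ {u} → Adj x u → Adj u b′ → ⊥
        no-path xu ub′ = contradiction (trans (sym ¬d2) (d2-intro xb′ xu ub′)) λ ()
        cases : ∀ n → nadj x b ≡ n → not n ∨ d2 x b ≡ true → ⊥
        cases false nxb _ with nadj-false nxb
        ... | inj₁ refl = contradiction (trans (sym bb′) (nadj⇒¬adj xb′)) λ ()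
        ... | inj₂ xb   = no-path xb bb′
        cases true _ xb = <-irrefl refl (≤-trans D<c (≤-trans
            (subst (_≤ count (d2 b′) verts) (common-count xb) (count-mono (common x b) (d2 b′) verts step)) (d2-count b′)))
          where
          step : ∀ u → common x b u ≡ true → d2 b′ u ≡ true
          step u e with ∧-true {adj x u} e
          ... | xu , bu = d2-intro {b′} {u} {b} (nadj-intro b′≢u ¬b′u) (adj-sym bb′) bu
            where
            b′≢u : b′ ≢ u
            b′≢u refl = contradiction (trans (sym xu) (nadj⇒¬adj xb′)) λ ()
            ¬b′u : adj b′ u ≡ false
            ¬b′u with adj b′ u in e′
            ... | false = refl
            ... | true  = ⊥-elim (no-path xu (adj-sym e′))

      nonneighbour-count : ∀ x → count (nadj x) verts ≤ D
      nonneighbour-count x = ≤-trans (count-mono (nadj x) (d2 x) verts (diameter-two x)) (d2-count x)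

  -- Bounded c: lines through a vertex.

  module Lines {v : ℕ} (G : Graph v) (t : ℕ) .{{_ : NonZero t}}
    (psd : Weight.Semidefinite G (suc t))
    where
    open Graph G
    open Sesqui G t psd

    fat-sparse : ∀ {u Q} → count (adj u) Q ≤ t * l → fat u Q ≡ false
    fat-sparse {u} {Q} ≤tl with fat u Q in e
    ... | false = refl
    ... | true  = contradiction (≤-trans (fat-true {u} {Q} e) ≤tl) (<-irrefl refl)

    mem : V → List V → Bool
    mem u L = any (eqᵇ u) L

    mem-∈ : ∀ {u L} → mem u L ≡ true → u ∈ L
    mem-∈ {u} {L} m with any-true (eqᵇ u) L m
    ... | z , z∈ , e = subst (_∈ L) (sym (eqᵇ-≡ {u} {z} e)) z∈

    ∈-mem : ∀ {u L} → u ∈ L → mem u L ≡ true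
    ∈-mem {u} u∈ = any-intro (eqᵇ u) u∈ (eqᵇ-refl u)

    mem-false : ∀ {u L} → mem u L ≡ false → ¬ u ∈ L
    mem-false m u∈ = contradiction (trans (sym m) (∈-mem u∈)) λ ()

    -- The members of `Q` satisfy the condition as well, each being its own witness by
    -- irreflexivity, so `x` ranges over all vertices.
    Maximal : List V → Set
    Maximal Q = ∀ x → any (λ u → not (adj x u)) Q ≡ true

    extend-over : ∀ xs Q → Clique Q → Σ (List V) λ L → Clique L × (∀ {u} → u ∈ Q → u ∈ L) × length Q ≤ length L ×
      (∀ {x} → x ∈ xs → any (λ u → not (adj x u)) L ≡ true)
    extend-over []       Q cQ = Q , cQ , (λ u∈ → u∈) , ≤-refl , λ ()
    extend-over (x ∷ xs) Q cQ with any (λ u → not (adj x u)) Q in e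
    ... | true with extend-over xs Q cQ
    ...   | L , cL , Q⊆ , |L| , max with any-true (λ u → not (adj x u)) Q e
    ...     | z , z∈ , xz = L , cL , Q⊆ , |L| , λ { (here refl) → any-intro (λ u → not (adj x u)) (Q⊆ z∈) xz ; (there y∈) → max y∈ }
    extend-over (x ∷ xs) Q cQ | false with extend-over xs (x ∷ Q) (All.map not-false (any-false (λ u → not (adj x u)) Q e) ∷ cQ)
    ...   | L , cL , Q⊆ , |L| , max = L , cL , (λ u∈ → Q⊆ (there u∈)) , ≤-trans (n≤1+n _) |L| ,
            λ { (here refl) → any-intro (λ u → not (adj x u)) (Q⊆ (here refl)) (cong not (irrefl x)) ; (there y∈) → max y∈ }

    extend : ∀ Q → Clique Q → Σ (List V) λ L → Clique L × Maximal L × (∀ {u} → u ∈ Q → u ∈ L) × length Q ≤ length L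
    extend Q cQ with extend-over verts Q cQ
    ... | L , cL , Q⊆ , |L| , max = L , cL , (λ x → max (∈-allFin x)) , Q⊆ , |L|

    -- `m₀` is the least size of a line, above `c + h`. As `ram′ m₁ ≤ k`, every vertex is on a line
    -- with more than `m₁` vertices; `room₁` and `room₂` make such a line long enough for the
    -- choices in `uncovered-bound`.
    module SmallCommon (m₀ m₁ c k : ℕ) (q₀≤m₀ : q₀ ≤ m₀) (c+h<m₀ : suc c + suc h ≤ m₀) (m₀≤m₁ : m₀ ≤ m₁)
      (room₁ : 1 + (l * (t * l) + ram′ m₀) ≤ m₁) (room₂ : 1 + (a + ram′ m₀ * (t * l)) ≤ m₁) (m₁≤k : ram′ m₁ ≤ k)
      (degree : ∀ x → count (adj x) verts ≡ k)
      (common-count : ∀ {x y} → d2 x y ≡ true → count (common x y) verts ≡ c) where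

      R₁ : ℕ
      R₁ = ram′ m₀

      record Line (L : List V) : Set where
        field
          clique  : Clique L
          maximal : Maximal L
          large   : m₀ ≤ length L
      open Line

      -- If `x` has a neighbour on `L`, it is at distance 2 from a non-neighbour `u` on `L`, and all
      -- its neighbours on `L` are common with `u`: at most `c`. So `L` contains more than `h`
      -- non-neighbours, and `split-bound` sharpens `c` to `t l`.
      line-sparse : ∀ {L x} → Line L → ¬ x ∈ L → count (adj x) L ≤ t * l
      line-sparse {L} {x} line x∉ with count (adj x) L ≤? t * l
      ... | yes ≤tl = ≤tl
      ... | no  ≰tl with pick (adj x) L 1 (≤-trans (s≤s z≤n) (≰⇒> ≰tl)) | any-true (λ u → not (adj x u)) L (maximal line x)
      ...   | z ∷ [] , z⊆ , _ , xz ∷ [] | u , u∈ , ¬xu = ⊥-elim (split-bound {L} {x} (clique line) (≰⇒> ≰tl) many)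
        where
        x≢u : x ≢ u
        x≢u refl = x∉ u∈
        u≢ : ∀ {w} → Adj x w → u ≢ w
        u≢ xw refl = contradiction (trans (sym xw) (not-true ¬xu)) λ ()
        xu : d2 x u ≡ true
        xu = d2-intro (nadj-intro x≢u (not-true ¬xu)) xz (adj-sym (clique-adj (clique line) u∈ (lookup z⊆ (here refl)) (u≢ xz)))
        few : count (adj x) L ≤ c
        few = subst (count (adj x) L ≤_) (common-count xu) (count-unique (adj x) (common x u) (clique-unique (clique line))
          λ {w} w∈ xw → ∈-allFin w , cong₂ _∧_ xw (clique-adj (clique line) u∈ w∈ (u≢ xw)))
        many : h < count (nadj x) L
        many = +-cancelˡ-≤ (suc c) (suc h) _ (≤-trans c+h<m₀ (≤-trans (large line) (begin
          length L
            ≡⟨ sym (count-trichotomy x L) ⟩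
          count (eqᵇ x) L + (count (adj x) L + count (nadj x) L)
            ≤⟨ +-mono-≤ (count-eq x (clique-unique (clique line))) (+-monoˡ-≤ _ few) ⟩
          suc c + count (nadj x) L ∎)))
          where open ≤-Reasoning

      uncovered : V → List (List V) → V → Bool
      uncovered y Ls u = adj y u ∧ not (any (mem u) Ls)

      uncovered-∉ : ∀ {y Ls u L} → uncovered y Ls u ≡ true → L ∈ Ls → ¬ u ∈ L
      uncovered-∉ {y} {Ls} {u} e L∈ = mem-false (All.lookup (any-false (mem u) Ls (not-true (proj₂ (∧-true {adj y u} e)))) L∈)

      LineThrough : V → List V → Set
      LineThrough y L = Line L × y ∈ L

      -- The second alternative has one line less, and the `t l` saved pays for the uncovered
      -- vertices in `uncovered-bound`.
      Covering : V → Set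
      Covering y = Σ (List (List V)) λ Ls → All (LineThrough y) Ls ×
        ((length Ls ≤ l × (∀ u → uncovered y Ls u ≡ false)) ⊎ (length Ls ≤ t × count (uncovered y Ls) verts ≤ R₁))

      -- The lines form a fan, so `l` of them leave nothing uncovered by `fan-bound`. With fewer
      -- lines, `R₁` uncovered neighbours contain a clique that extends to a further line through
      -- `y`.
      grow : ∀ y m Ls → m + length Ls ≡ l → All (LineThrough y) Ls → Fan q₀ y Ls → Covering y
      grow y zero Ls eq lines fan = Ls , lines , inj₁ (≤-reflexive eq , none)
        where
        none : ∀ u → uncovered y Ls u ≡ false
        none w with uncovered y Ls w in e
        ... | false = refl
        ... | true  = ⊥-elim (fan-bound {q₀} {y} {w} {Ls} ≤-refl fan eq (proj₁ (∧-true e))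
          (All.tabulate λ {L} L∈ → fat-sparse {w} {L} (line-sparse (proj₁ (All.lookup lines L∈)) (uncovered-∉ {y} {Ls} {w} e L∈))))
      grow y (suc m) Ls eq lines fan with R₁ ≤? count (uncovered y Ls) verts
      ... | no R≰ = Ls , lines , inj₂ (s≤s⁻¹ (subst (suc (length Ls) ≤_) eq (s≤s (m≤n+m (length Ls) m))) , <⇒≤ (≰⇒> R≰))
      ... | yes R≤ with select (uncovered y Ls)
      ...   | zs , zs⊆ , |zs| , all , _ with clique-in-neighbourhood m₀ {y} (select-unique zs⊆) (All.map (λ e → proj₁ (∧-true e)) all) (subst (R₁ ≤_) (sym |zs|) R≤)
      ...     | [] , _ , _ , |P| = contradiction (subst (q₀ ≤_) (sym |P|) q₀≤m₀) λ ()
      ...     | w ∷ P , P⊆ , cP , |P| with extend (y ∷ w ∷ P) (All-resp-⊆ P⊆ (All.map (λ e → proj₁ (∧-true e)) all) ∷ cP)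
      ...       | L , cL , max , Q⊆L , |L| = grow y m (L ∷ Ls) (trans (+-suc m (length Ls)) eq) ((line , Q⊆L (here refl)) ∷ lines)
                  (cons cL closed (≤-trans q₀≤m₀ (large line)) (All.tabulate new) fan)
        where
        line : Line L
        line = record { clique = cL ; maximal = max ; large = ≤-trans (≤-trans (≤-reflexive (sym |P|)) (n≤1+n _)) |L| }
        -- The line passes through `y`, which is why fans are allowed to use the closed
        -- neighbourhood.
        closed : All (λ u → nadj y u ≡ false) L
        closed = All.tabulate λ {u} u∈ → closed-at u u∈
          where
          closed-at : ∀ u → u ∈ L → nadj y u ≡ false
          closed-at u u∈ with nadj y u in e
          ... | false = refl
          ... | true  = contradiction (trans (sym (clique-adj cL (Q⊆L (here refl)) u∈ (nadj⇒≢ e))) (nadj⇒¬adj e)) λ ()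
        -- By `line-sparse`, a vertex of `L` off `L′` is not fat for `L′`; those on `L′` are
        -- neighbours of `w`, which is off `L′`, so there are at most `t l`.
        new : ∀ {L′} → L′ ∈ Ls → count (λ u → fat u L′) L ≤ t * l
        new {L′} L′∈ = ≤-trans (count-unique (λ u → fat u L′) (adj w) (clique-unique cL) shared) (line-sparse line′ w∉)
          where
          line′ : Line L′
          line′ = proj₁ (All.lookup lines L′∈)
          w∉ : ¬ w ∈ L′
          w∉ = uncovered-∉ {y} {Ls} {w} (All.head (All-resp-⊆ P⊆ all)) L′∈
          shared : ∀ {u} → u ∈ L → fat u L′ ≡ true → u ∈ L′ × Adj w u
          shared {u} u∈ f with mem u L′ in e
          ... | true  = mem-∈ e , clique-adj cL (Q⊆L (there (here refl))) u∈ λ { refl → w∉ (mem-∈ e) }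
          ... | false = contradiction (trans (sym f) (fat-sparse {u} {L′} (line-sparse line′ (mem-false e)))) λ ()

      covering : ∀ y → Covering y
      covering y = grow y l [] (+-identityʳ l) [] []

      count-covered : ∀ {y Ls b} (p : V → Bool) → All (λ L → count p L ≤ b) Ls →
        count (λ z → adj y z ∧ p z) verts ≤ length Ls * b + count (λ z → uncovered y Ls z ∧ p z) verts
      count-covered {y} {Ls} {b} p bound = ≤-trans
        (count-mono _ (λ z → any (λ L → mem z L ∧ p z) Ls ∨ (uncovered y Ls z ∧ p z)) verts split)
        (≤-trans (count-∨ (λ z → any (λ L → mem z L ∧ p z) Ls) _ verts)
          (+-monoˡ-≤ _ (count-any (λ L z → mem z L ∧ p z) Ls verts (All.map (λ {L} → inside {L}) bound))))
        where
        inside : ∀ {L} → count p L ≤ b → count (λ z → mem z L ∧ p z) verts ≤ b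
        inside {L} ≤b = ≤-trans (count-unique (λ z → mem z L ∧ p z) p {verts} {L} verts-unique
          (λ {z} _ e → mem-∈ {z} {L} (proj₁ (∧-true {mem z L} e)) , proj₂ (∧-true {mem z L} e))) ≤b
        split : ∀ z → adj y z ∧ p z ≡ true → any (λ L → mem z L ∧ p z) Ls ∨ (uncovered y Ls z ∧ p z) ≡ true
        split z e with ∧-true {adj y z} e
        ... | yz , pz rewrite yz | pz with any (mem z) Ls in m
        ...   | false = ∨-true-right (any (λ L → mem z L ∧ true) Ls)
          where
          ∨-true-right : ∀ b → b ∨ true ≡ true
          ∨-true-right true  = refl
          ∨-true-right false = refl
        ...   | true with any-true (mem z) Ls m
        ...     | L , L∈ , zL rewrite any-intro (λ L → mem z L ∧ true) {t = L} L∈ (cong (_∧ true) zL) = refl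

      nonadjacent-∉ : ∀ {y u L} → LineThrough y L → NAdj y u → ¬ u ∈ L
      nonadjacent-∉ (line , y∈) yu u∈ = contradiction (trans (sym (clique-adj (clique line) y∈ u∈ (nadj⇒≢ yu))) (nadj⇒¬adj yu)) λ ()

      common-bound : ∀ {y u Ls} → All (LineThrough y) Ls → d2 y u ≡ true →
        c ≤ length Ls * (t * l) + count (λ z → uncovered y Ls z ∧ adj u z) verts
      common-bound {y} {u} {Ls} lines yu = subst (_≤ length Ls * (t * l) + count (λ z → uncovered y Ls z ∧ adj u z) verts) (common-count yu) (count-covered {y} {Ls} (adj u)
        (All.map (λ lt → line-sparse (proj₁ lt) (nonadjacent-∉ lt (proj₁ (d2-elim yu)))) lines))

      covered-bound : ∀ {y u Ls} → All (LineThrough y) Ls → length Ls ≤ l → (∀ z → uncovered y Ls z ≡ false) → d2 y u ≡ true → c ≤ l * (t * l)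
      covered-bound {y} {u} {Ls} lines |Ls| none yu = ≤-trans (common-bound lines yu)
        (subst (_≤ l * (t * l)) (sym (trans (cong (length Ls * (t * l) +_)
          (count-none (λ z → uncovered y Ls z ∧ adj u z) (All.universal (λ z → cong (_∧ adj u z) (none z)) verts))) (+-identityʳ _)))
          (*-monoˡ-≤ (t * l) |Ls|))

      line-through : ∀ w → Σ (List V) λ Q → Line Q × w ∈ Q × m₁ < length Q
      line-through w with select (adj w)
      ... | zs , zs⊆ , |zs| , wzs , _ with clique-in-neighbourhood m₁ {w} (select-unique zs⊆) wzs (subst (ram′ m₁ ≤_) (sym (trans |zs| (degree w))) m₁≤k)
      ...   | P , P⊆ , cP , |P| with extend (w ∷ P) (All-resp-⊆ P⊆ wzs ∷ cP)
      ...     | Q , cQ , max , P⊆Q , |Q| = Q ,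
                record { clique = cQ ; maximal = max ; large = ≤-trans m₀≤m₁ (<⇒≤ m₁<) } , P⊆Q (here refl) , m₁<
        where
        m₁< : m₁ < length Q
        m₁< = subst (λ m → suc m ≤ length Q) |P| |Q|

      -- The lines through `y` contribute at most `t (t l)` common neighbours with `u`. The
      -- uncovered ones are neighbours of `y` on `Q`, and `y` is off `Q`, so they add at most `t l`;
      -- as l = t + 1, the sum is `l (t l)`.
      uncovered-bound : ∀ {y w Ls} → All (LineThrough y) Ls → length Ls ≤ t → count (uncovered y Ls) verts ≤ R₁ →
        uncovered y Ls w ≡ true → c ≤ l * (t * l)
      uncovered-bound {y} {w} {Ls} lines |Ls| R≤ unc with line-through w
      ... | Q , line , w∈ , m₁< with select (uncovered y Ls)
      ...   | Ns , _ , |Ns| , _ , complete with avoid bad Q 1 (≤-trans (+-monoʳ-≤ 1 count-bad) (≤-trans room₂ (<⇒≤ m₁<)))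
        where
        w∉ : ∀ {L} → L ∈ Ls → ¬ w ∈ L
        w∉ = uncovered-∉ {y} {Ls} {w} unc
        meets : ∀ {L} → L ∈ Ls → count (λ z → mem z Q) L ≤ t * l
        meets {L} L∈ = ≤-trans (count-unique (λ z → mem z Q) (adj w) (clique-unique (clique lineL))
            (λ {z} z∈ e → z∈ , clique-adj (clique line) w∈ (mem-∈ e) λ { refl → w∉ L∈ z∈ }))
            (line-sparse lineL (w∉ L∈))
          where lineL = proj₁ (All.lookup lines L∈)
        -- If `y` were on `Q`, the rest of `Q` would consist of neighbours of `y`: at most `t l` on
        -- each line, where they are neighbours of `w`, and at most `R₁` uncovered ones, too few for
        -- `m₁ < length Q`.
        y∉ : ¬ y ∈ Q
        y∉ y∈ = <-irrefl refl (≤-trans m₁< (≤-trans (begin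
          length Q
            ≡⟨ sym (count-trichotomy y Q) ⟩
          count (eqᵇ y) Q + (count (adj y) Q + count (nadj y) Q)
            ≤⟨ +-mono-≤ (count-eq y (clique-unique (clique line))) (+-mono-≤ adjs (≤-reflexive none)) ⟩
          1 + ((l * (t * l) + R₁) + 0)
            ≡⟨ cong suc (+-identityʳ _) ⟩
          1 + (l * (t * l) + R₁) ∎) room₁))
          where
          open ≤-Reasoning
          none : count (nadj y) Q ≡ 0
          none = count-none (nadj y) (All.tabulate λ {u} u∈ → closed-at u u∈)
            where
            closed-at : ∀ u → u ∈ Q → nadj y u ≡ false
            closed-at u u∈ with nadj y u in e
            ... | false = refl
            ... | true  = contradiction (trans (sym (clique-adj (clique line) y∈ u∈ (nadj⇒≢ e))) (nadj⇒¬adj e)) λ ()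
          adjs : count (adj y) Q ≤ l * (t * l) + R₁
          adjs = ≤-trans (count-unique (adj y) (λ z → adj y z ∧ mem z Q) (clique-unique (clique line))
              (λ {z} z∈ yz → ∈-allFin z , cong₂ _∧_ yz (∈-mem z∈)))
            (≤-trans (count-covered {y} {Ls} (λ z → mem z Q) (All.tabulate meets))
              (+-mono-≤ (*-monoˡ-≤ (t * l) (≤-trans |Ls| (n≤1+n t)))
                (≤-trans (count-mono _ (uncovered y Ls) verts (λ z e → proj₁ (∧-true e))) R≤)))
        bad : V → Bool
        bad u = not (nadj y u) ∨ any (λ z → not (mem z Q) ∧ adj z u) Ns
        count-outside : ∀ z → count (λ u → not (mem z Q) ∧ adj z u) Q ≤ t * l
        count-outside z with mem z Q in e
        ... | true  = subst (_≤ t * l) (sym (count-none (λ _ → false) (All.universal (λ _ → refl) Q))) z≤n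
        ... | false = line-sparse line (mem-false e)
        count-bad : count bad Q ≤ a + R₁ * (t * l)
        count-bad = ≤-trans (count-∨ (λ u → not (nadj y u)) _ Q) (+-mono-≤ (count-closed {y} {Q} (clique line) (line-sparse line y∉))
          (≤-trans (count-any (λ z u → not (mem z Q) ∧ adj z u) Ns Q (All.universal count-outside Ns))
            (*-monoˡ-≤ (t * l) (subst (_≤ R₁) (sym |Ns|) R≤))))
      ...     | u ∷ [] , u⊆ , _ , g ∷ [] = ≤-trans (common-bound lines yu) (subst (_≤ l * (t * l)) (+-comm _ (length Ls * (t * l)))
                  (+-mono-≤ (≤-trans rest (line-sparse line y∉)) (*-monoˡ-≤ (t * l) |Ls|)))
        where
        u∈ : u ∈ Q
        u∈ = lookup u⊆ (here refl)
        yw : Adj y w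
        yw = proj₁ (∧-true unc)
        nyu : NAdj y u
        nyu = not-false (proj₁ (∨-false {not (nadj y u)} g))
        w≢u : w ≢ u
        w≢u refl = contradiction (trans (sym yw) (nadj⇒¬adj nyu)) λ ()
        yu : d2 y u ≡ true
        yu = d2-intro nyu yw (clique-adj (clique line) w∈ u∈ w≢u)
        y∉ : ¬ y ∈ Q
        y∉ y∈ = contradiction (trans (sym (clique-adj (clique line) y∈ u∈ (nadj⇒≢ nyu))) (nadj⇒¬adj nyu)) λ ()
        rest : count (λ z → uncovered y Ls z ∧ adj u z) verts ≤ count (adj y) Q
        rest = count-unique (λ z → uncovered y Ls z ∧ adj u z) (adj y) verts-unique inside
          where
          inside : ∀ {z} → z ∈ verts → uncovered y Ls z ∧ adj u z ≡ true → z ∈ Q × Adj y z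
          inside {z} _ e with ∧-true {uncovered y Ls z} e
          ... | e₁ , uz with mem z Q in m
          ...   | true  = mem-∈ m , proj₁ (∧-true e₁)
          ...   | false = contradiction
                  (trans (sym (cong₂ (λ b b′ → not b ∧ b′) m (adj-sym uz)))
                    (All.lookup (any-false (λ z → not (mem z Q) ∧ adj z u) Ns (proj₂ (∨-false {not (nadj y u)} g))) (complete z e₁))) λ ()

      common-count-bound : ∀ {y u} → d2 y u ≡ true → c ≤ l * (t * l)
      common-count-bound {y} yu with covering y
      ... | Ls , lines , inj₁ (|Ls| , none) = covered-bound lines |Ls| none yu
      ... | Ls , lines , inj₂ (|Ls| , few) with any (uncovered y Ls) verts in e
      ...   | false = covered-bound lines (≤-trans |Ls| (n≤1+n t)) (λ z → All.lookup (any-false (uncovered y Ls) verts e) (∈-allFin z)) yu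
      ...   | true with any-true (uncovered y Ls) verts e
      ...     | w , _ , unc = uncovered-bound {y} {w} {Ls} lines |Ls| few unc

  -- Radial weights on the regular tree.

  2mn≤m²+n² : ∀ m n → 2 * (m * n) ≤ m * m + n * n
  2mn≤m²+n² m n with ≤-total m n
  ... | inj₁ m≤n = ordered m n m≤n
    where
    ordered : ∀ m n → m ≤ n → 2 * (m * n) ≤ m * m + n * n
    ordered m n m≤n with m≤n⇒∃[o]m+o≡n m≤n
    ... | d , refl = subst (2 * (m * (m + d)) ≤_)
      (solve 2 (λ m d → con 2 :* (m :* (m :+ d)) :+ d :* d := m :* m :+ (m :+ d) :* (m :+ d)) refl m d) (m≤m+n _ (d * d))
  ... | inj₂ n≤m with m≤n⇒∃[o]m+o≡n n≤m
  ...   | d , refl = subst (2 * ((n + d) * n) ≤_)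
      (solve 2 (λ n d → con 2 :* ((n :+ d) :* n) :+ d :* d := (n :+ d) :* (n :+ d) :+ n :* n) refl n d) (m≤m+n _ (d * d))

  -- U i / q^i solves the eigenvalue-s equation on the (q+1)-regular tree as long as it is positive; as s² < 4q,
  -- it reaches zero, where truncated subtraction keeps it a subsolution.  W clears the denominators.
  module Profile (s q : ℕ) (s²<4q : s * s < 4 * q) where

    U : ℕ → ℕ
    U 0             = 1
    U 1             = q
    U (suc (suc i)) = s * U (suc i) ∸ q * U i

    instance
      q≢0 : NonZero q
      q≢0 = >-nonZero (*-cancelˡ-< 4 0 q (≤-<-trans z≤n s²<4q))

      4q≢0 : NonZero (4 * q)
      4q≢0 = m*n≢0 4 q

    r : ℕ
    r = 4 * q * q

    -- For positive `x` this is `y / x ≤ q - i / (4 q)`: the ratio of consecutive values starts at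
    -- `q` and drops by at least `1 / (4 q)` per step, so it is exhausted after `r = 4 q²` steps.
    Decay : ℕ → ℕ → ℕ → Set
    Decay i x y = 4 * q * y + i * x ≤ r * x

    -- For ρ = y / x the next ratio is s - q / ρ, and the drop is (ρ² - s ρ + q) / ρ ≥ (q - s² / 4)
    -- / q ≥ 1 / (4 q), because ρ ≤ q and s² < 4 q holds between integers.
    decay-step : ∀ i x y → Decay i x y → Decay (suc i) y (s * y ∸ q * x)
    decay-step i zero y d = subst (λ y → Decay (suc i) y (s * y ∸ q * 0)) (sym y≡0)
      (subst (Decay (suc i) 0) (sym (trans (cong (_∸ q * 0) (*-zeroʳ s)) (0∸n≡0 (q * 0)))) (≤-reflexive
        (solve 2 (λ q i → con 4 :* q :* con 0 :+ i :* con 0 := con 4 :* q :* q :* con 0) refl q (suc i))))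
      where
      y≡0 : y ≡ 0
      y≡0 = n≤0⇒n≡0 (*-cancelˡ-≤ (4 * q) (≤-trans (m≤m+n (4 * q * y) (i * 0))
        (≤-trans d (≤-reflexive (trans (*-zeroʳ r) (sym (*-zeroʳ (4 * q))))))))
    decay-step i x@(suc _) y d with ≤-total (s * y) (q * x)
    ... | inj₁ sy≤qx = subst (λ z → Decay (suc i) y z) (sym (m≤n⇒m∸n≡0 sy≤qx))
            (subst (λ z → z + suc i * y ≤ r * y) (sym (*-zeroʳ (4 * q))) (step y d))
      where
      step : ∀ y → Decay i x y → suc i * y ≤ r * y
      step zero    d = ≤-reflexive (trans (*-zeroʳ i) (sym (*-zeroʳ r)))
      step y@(suc _) d = *-monoˡ-≤ y (*-cancelʳ-< x i r (<-≤-trans (m<n+m (i * x) {4 * q * y} (>-nonZero⁻¹ _ {{m*n≢0 (4 * q) y}})) d))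
    ... | inj₂ qx≤sy = *-cancelˡ-≤ x (begin
      x * (4 * q * z + suc i * y)
        ≡⟨ solve 5 (λ x q z i y → x :* (con 4 :* q :* z :+ (con 1 :+ i) :* y) := (con 4 :* q :* (x :* z) :+ i :* x :* y) :+ x :* y) refl x q z i y ⟩
      (4 * q * (x * z) + i * x * y) + x * y
        ≤⟨ +-monoʳ-≤ (4 * q * (x * z) + i * x * y) (*-monoʳ-≤ x y≤qx) ⟩
      (4 * q * (x * z) + i * x * y) + x * (q * x)
        ≡⟨ solve 5 (λ x q z i y → (con 4 :* q :* (x :* z) :+ i :* x :* y) :+ x :* (q :* x) := q :* (con 4 :* (x :* z) :+ x :* x) :+ i :* x :* y) refl x q z i y ⟩
      q * (4 * (x * z) + x * x) + i * x * y
        ≤⟨ +-monoˡ-≤ (i * x * y) (*-monoʳ-≤ q key) ⟩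
      q * (4 * (y * y)) + i * x * y
        ≡⟨ solve 4 (λ x q i y → q :* (con 4 :* (y :* y)) :+ i :* x :* y := (con 4 :* q :* y :+ i :* x) :* y) refl x q i y ⟩
      (4 * q * y + i * x) * y
        ≤⟨ *-monoˡ-≤ y d ⟩
      r * x * y
        ≡⟨ solve 3 (λ x r y → r :* x :* y := x :* (r :* y)) refl x r y ⟩
      x * (r * y) ∎)
      where
      open ≤-Reasoning
      z = s * y ∸ q * x
      y≤qx : y ≤ q * x
      y≤qx = *-cancelˡ-≤ (4 * q) (≤-trans (m≤m+n (4 * q * y) (i * x)) (≤-trans d (≤-reflexive (*-assoc (4 * q) q x))))
      -- The discriminant estimate: `(2 y - s x)² ≥ 0` combined with `s² + 1 ≤ 4 q`.
      key : 4 * (x * z) + x * x ≤ 4 * (y * y)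
      key = +-cancelˡ-≤ (4 * q * (x * x)) _ _ (begin
        4 * q * (x * x) + (4 * (x * z) + x * x)
          ≡⟨ solve 3 (λ x q z → con 4 :* q :* (x :* x) :+ (con 4 :* (x :* z) :+ x :* x) := con 4 :* (x :* (z :+ q :* x)) :+ x :* x) refl x q z ⟩
        4 * (x * (z + q * x)) + x * x
          ≡⟨ cong (λ w → 4 * (x * w) + x * x) (m∸n+n≡m qx≤sy) ⟩
        4 * (x * (s * y)) + x * x
          ≡⟨ solve 3 (λ x s y → con 4 :* (x :* (s :* y)) :+ x :* x := con 2 :* ((con 2 :* y) :* (s :* x)) :+ x :* x) refl x s y ⟩
        2 * ((2 * y) * (s * x)) + x * x
          ≤⟨ +-monoˡ-≤ (x * x) (2mn≤m²+n² (2 * y) (s * x)) ⟩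
        ((2 * y) * (2 * y) + (s * x) * (s * x)) + x * x
          ≡⟨ solve 3 (λ x s y → ((con 2 :* y) :* (con 2 :* y) :+ (s :* x) :* (s :* x)) :+ x :* x := (con 1 :+ s :* s) :* (x :* x) :+ con 4 :* (y :* y)) refl x s y ⟩
        suc (s * s) * (x * x) + 4 * (y * y)
          ≤⟨ +-monoˡ-≤ (4 * (y * y)) (*-monoˡ-≤ (x * x) s²<4q) ⟩
        4 * q * (x * x) + 4 * (y * y) ∎)

    decay : ∀ i → Decay i (U i) (U (suc i))
    decay zero    = ≤-reflexive (trans (+-identityʳ _) (sym (*-identityʳ r)))
    decay (suc i) = decay-step i (U i) (U (suc i)) (decay i)

    U-end : U (suc r) ≡ 0
    U-end = n≤0⇒n≡0 (*-cancelˡ-≤ (4 * q) (+-cancelʳ-≤ (r * U r) (4 * q * U (suc r)) (4 * q * 0)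
      (subst (λ z → 4 * q * U (suc r) + r * U r ≤ z + r * U r) (sym (*-zeroʳ (4 * q))) (decay r))))

    U-mono : ∀ i → U (suc i) ≤ q * U i
    U-mono i = *-cancelˡ-≤ (4 * q) (≤-trans (m≤m+n (4 * q * U (suc i)) (i * U i)) (≤-trans (decay i) (≤-reflexive (*-assoc (4 * q) q (U i)))))

    U-rec : ∀ i → s * U (suc i) ≤ q * U i + U (suc (suc i))
    U-rec i = m≤n+m∸n (s * U (suc i)) (q * U i)

    W : ℕ → ℕ
    W i = U i * q ^ (r ∸ i)

    W-end : W (suc r) ≡ 0
    W-end = cong (_* q ^ (r ∸ suc r)) U-end

    1≤r : 1 ≤ r
    1≤r = >-nonZero⁻¹ r {{m*n≢0 (4 * q) q}}

    exponent : ∀ {i} → suc i ≤ r → r ∸ i ≡ suc (r ∸ suc i)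
    exponent {i} i<r = +-∸-assoc 1 i<r

    W-step : ∀ {i} → suc i ≤ r → W i ≡ q * U i * q ^ (r ∸ suc i)
    W-step {i} i<r = trans (cong (λ e → U i * q ^ e) (exponent i<r))
      (solve 3 (λ u q p → u :* (q :* p) := q :* u :* p) refl (U i) q (q ^ (r ∸ suc i)))

    W-mono : ∀ {i} → i ≤ r → W (suc i) ≤ W i
    W-mono {i} i≤r with m≤n⇒m<n∨m≡n i≤r
    ... | inj₁ i<r  = subst (W (suc i) ≤_) (sym (W-step i<r)) (*-monoˡ-≤ (q ^ (r ∸ suc i)) (U-mono i))
    ... | inj₂ i≡r = subst (_≤ W i) (sym (trans (cong (λ j → W (suc j)) i≡r) W-end)) z≤n

    W-rec : ∀ {i} → suc i ≤ r → s * W (suc i) ≤ W i + q * W (suc (suc i))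
    W-rec {i} i<r = begin
      s * (U (suc i) * p)               ≡⟨ sym (*-assoc s (U (suc i)) p) ⟩
      s * U (suc i) * p                 ≤⟨ *-monoˡ-≤ p (U-rec i) ⟩
      (q * U i + U (suc (suc i))) * p   ≡⟨ *-distribʳ-+ p (q * U i) (U (suc (suc i))) ⟩
      q * U i * p + U (suc (suc i)) * p ≤⟨ +-mono-≤ (≤-reflexive (sym (W-step i<r))) (last (m≤n⇒m<n∨m≡n i<r)) ⟩
      W i + q * W (suc (suc i))         ∎
      where
      open ≤-Reasoning
      p = q ^ (r ∸ suc i)
      last : suc i < r ⊎ suc i ≡ r → U (suc (suc i)) * p ≤ q * W (suc (suc i))
      last (inj₁ i+1<r) = ≤-reflexive (trans (cong (λ e → U (suc (suc i)) * q ^ e) (exponent i+1<r))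
        (solve 3 (λ u q p → u :* (q :* p) := q :* (u :* p)) refl (U (suc (suc i))) q (q ^ (r ∸ suc (suc i)))))
      last (inj₂ i+1≡r) = subst (λ z → z * p ≤ q * W (suc (suc i))) (sym (trans (cong (λ j → U (suc j)) i+1≡r) U-end)) z≤n

    -- The reason for the initial values 1 and q of `U`: the neighbours of the centre weigh as much
    -- as the centre, which satisfies its inequality with room to spare.
    W₀≡W₁ : W 0 ≡ W 1
    W₀≡W₁ = trans (W-step 1≤r) (cong (_* q ^ (r ∸ 1)) (*-identityʳ q))

    0<W₀ : 0 < W 0
    0<W₀ = subst (0 <_) (sym (+-identityʳ (q ^ r))) (>-nonZero⁻¹ (q ^ r) {{m^n≢0 q r}})

    W₀≡q^r : W 0 ≡ q ^ r
    W₀≡q^r = +-identityʳ (q ^ r)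

    s≤q : s ≤ q
    s≤q with s ≤? q
    ... | yes ≤q = ≤q
    ... | no  ≰q = contradiction (≤-trans (s≤s (≤-trans bound (*-mono-≤ (≰⇒> ≰q) (≰⇒> ≰q)))) s²<4q) (<-irrefl refl)
      where
      bound : 4 * q ≤ suc q * suc q
      bound = subst (4 * q ≤_) (solve 1 (λ q → con 1 :* con 1 :+ q :* q :+ con 2 :* q := (con 1 :+ q) :* (con 1 :+ q)) refl q)
        (subst (_≤ (1 * 1 + q * q) + 2 * q) (solve 1 (λ q → con 2 :* (con 1 :* q) :+ con 2 :* q := con 4 :* q) refl q)
          (+-monoˡ-≤ (2 * q) (2mn≤m²+n² 1 q)))

  count-rep : ∀ {A : Set} (p : A → Bool) n X → count p (rep n X) ≡ n * count p X
  count-rep p zero    X = refl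
  count-rep p (suc n) X = trans (count-++ p X (rep n X)) (cong (count p X +_) (count-rep p n X))

  length-rep : ∀ {A : Set} n (X : List A) → length (rep n X) ≡ n * length X
  length-rep zero    X = refl
  length-rep (suc n) X = trans (length-++ X) (cong (length X +_) (length-rep n X))

  sum-≤ : ∀ {A : Set} (f : A → ℕ) N → (∀ x → f x ≤ N) → ∀ xs → sum (map f xs) ≤ length xs * N
  sum-≤ f N h []       = z≤n
  sum-≤ f N h (x ∷ xs) = +-mono-≤ (h x) (sum-≤ f N h xs)

  sum-< : ∀ {A : Set} (f : A → ℕ) N → (∀ x → f x ≤ N) → ∀ {x xs} → x ∈ xs → f x < N → sum (map f xs) < length xs * N
  sum-< f N h {xs = _ ∷ xs} (here refl) fx<N = +-mono-<-≤ fx<N (sum-≤ f N h xs)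
  sum-< f N h {xs = y ∷ xs} (there x∈)  fx<N = +-mono-≤-< (h y) (sum-< f N h x∈ fx<N)

  -- With the constant vector split off, only σ = |F| and the strict inequality ⟨F,KF⟩ < σ² matter.
  mean-arith : ∀ v k κ l σ κF .{{_ : NonZero v}} → v ≡ k + κ → κF < σ * σ →
    2 * (v * σ * (σ * (k + l))) + 2 * (v * 0 * 0) ≤ v * v * κF + σ * σ * (v * (k + l)) + 0 * 0 * 0 + 2 * (σ * 0 * 0) →
    v ≤ κ * (σ * σ)
  mean-arith v k κ l σ κF v≡ κF<σ² ineq = +-cancelˡ-≤ (σ * σ * k) v (κ * (σ * σ)) (begin
    σ * σ * k + v                   ≤⟨ +-monoˡ-≤ v (*-monoʳ-≤ (σ * σ) (m≤m+n k l)) ⟩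
    σ * σ * (k + l) + v             ≤⟨ +-monoˡ-≤ v reduced ⟩
    v * κF + v                      ≡⟨ solve 2 (λ v f → v :* f :+ v := v :* (con 1 :+ f)) refl v κF ⟩
    v * suc κF                      ≤⟨ *-monoʳ-≤ v κF<σ² ⟩
    v * (σ * σ)                     ≡⟨ cong (_* (σ * σ)) v≡ ⟩
    (k + κ) * (σ * σ)               ≡⟨ solve 3 (λ k c s → (k :+ c) :* s := s :* k :+ c :* s) refl k κ (σ * σ) ⟩
    σ * σ * k + κ * (σ * σ)         ∎)
    where
    open ≤-Reasoning
    reduced : σ * σ * (k + l) ≤ v * κF
    reduced = *-cancelˡ-≤ v (+-cancelʳ-≤ (σ * σ * (v * (k + l))) _ _ (subst₂ _≤_
      (solve 3 (λ v s w → con 2 :* (v :* s :* (s :* w)) :+ con 2 :* (v :* con 0 :* con 0) := v :* (s :* s :* w) :+ s :* s :* (v :* w)) refl v σ (k + l))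
      (solve 4 (λ v s w f → v :* v :* f :+ s :* s :* (v :* w) :+ con 0 :* con 0 :* con 0 :+ con 2 :* (s :* con 0 :* con 0) := v :* (v :* f) :+ s :* s :* (v :* w)) refl v σ (k + l) κF)
      ineq))

  -- The Alon-Boppana bound for the complement.

  module AlonBoppana {v : ℕ} (G : Graph v) (t : ℕ) .{{_ : NonZero t}}
    (psd : Weight.Semidefinite G (suc t))
    (k q r : ℕ) (W : ℕ → ℕ)
    (W-mono : ∀ {i} → i ≤ r → W (suc i) ≤ W i)
    (W-rec : ∀ {i} → suc i ≤ r → t * W (suc i) ≤ W i + q * W (suc (suc i)))
    (W-end : W (suc r) ≡ 0) (W₀≡W₁ : W 0 ≡ W 1) (0<W₀ : 0 < W 0) (t≤q : t ≤ q)
    where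
    open Graph G
    open Sesqui G t psd

    κ : ℕ
    κ = suc (suc q)

    -- Adjacency in the complement with a loop at every vertex, so that it is J - A. Without loops
    -- the degree is q + 1, that of the tree in `Profile`.
    far : V → V → Bool
    far u z = not (adj u z)

    module _ (degree : ∀ u → count (adj u) verts ≡ k) (codegree : ∀ u → count (far u) verts ≡ κ) (x : V) where

      Ball : ℕ → List V
      Ball zero    = [ x ]
      Ball (suc i) = proj₁ (select (λ u → any (λ y → far y u) (Ball i)))

      far-self : ∀ u → far u u ≡ true
      far-self u = cong not (irrefl u)

      far-sym : ∀ {u z} → far u z ≡ true → far z u ≡ true
      far-sym {u} {z} = trans (cong not (symm z u))

      ball-in : ∀ {i y u} → y ∈ Ball i → far y u ≡ true → u ∈ Ball (suc i)
      ball-in {i} {y} {u} y∈ yu = proj₂ (proj₂ (proj₂ (proj₂ (select (λ u → any (λ y → far y u) (Ball i)))))) u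
        (any-intro (λ y → far y u) y∈ yu)

      ball-out : ∀ {i u} → u ∈ Ball (suc i) → ∃ λ y → y ∈ Ball i × far y u ≡ true
      ball-out {i} {u} u∈ = any-true (λ y → far y u) (Ball i)
        (All.lookup (proj₁ (proj₂ (proj₂ (proj₂ (select (λ u → any (λ y → far y u) (Ball i))))))) u∈)

      ball-mono : ∀ {i u} → u ∈ Ball i → u ∈ Ball (suc i)
      ball-mono {i} {u} u∈ = ball-in {i} u∈ (far-self u)

      ball-unique : ∀ i → AllPairs _≢_ (Ball i)
      ball-unique zero    = [] ∷ []
      ball-unique (suc i) = select-unique (proj₁ (proj₂ (select (λ u → any (λ y → far y u) (Ball i)))))

      centre : ∀ i → x ∈ Ball i
      centre zero    = here refl
      centre (suc i) = ball-mono {i} (centre i)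

      ball-size : ∀ i → length (Ball i) ≤ κ ^ i
      ball-size zero    = ≤-refl
      ball-size (suc i) = begin
        length (Ball (suc i))
          ≡⟨ proj₁ (proj₂ (proj₂ (select (λ u → any (λ y → far y u) (Ball i))))) ⟩
        count (λ u → any (λ y → far y u) (Ball i)) verts
          ≤⟨ count-any far (Ball i) verts (All.universal (λ y → ≤-reflexive (codegree y)) (Ball i)) ⟩
        length (Ball i) * κ
          ≤⟨ *-monoˡ-≤ κ (ball-size i) ⟩
        κ ^ i * κ
          ≡⟨ *-comm (κ ^ i) κ ⟩
        κ ^ suc i ∎
        where open ≤-Reasoning

      far-count-inside : ∀ {i u} → u ∈ Ball i → κ ≤ count (far u) (Ball (suc i))
      far-count-inside {i} {u} u∈ = subst (_≤ count (far u) (Ball (suc i))) (codegree u)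
        (count-unique (far u) (far u) verts-unique (λ {z} _ uz → ball-in {i} u∈ uz , uz))

      count-pos : ∀ (p : V → Bool) {z L} → z ∈ L → p z ≡ true → 1 ≤ count p L
      count-pos p {z} {L} z∈ pz = subst (_≤ count p L) (count-all p (pz ∷ []))
        (count-unique p p {[ z ]} {L} ([] ∷ []) (λ { (here refl) _ → z∈ , pz }))

      -- A predecessor of `u` is counted in the smaller ball; the loop at `u` and that predecessor
      -- are counted in the larger one.
      far-count-boundary : ∀ {i u} → ¬ u ∈ Ball i → u ∈ Ball (suc i) → 1 ≤ count (far u) (Ball i) × 2 ≤ count (far u) (Ball (suc i))
      far-count-boundary {i} {u} u∉ u∈ with ball-out {i} u∈
      ... | y , y∈ , yu = count-pos (far u) y∈ (far-sym yu) ,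
        subst (_≤ count (far u) (Ball (suc i))) (count-all (far u) (far-self u ∷ far-sym yu ∷ []))
          (count-unique (far u) (far u) {u ∷ y ∷ []} ((u≢y ∷ []) ∷ [] ∷ [])
            λ { (here refl) p → u∈ , p ; (there (here refl)) p → ball-mono {i} y∈ , p })
        where
        u≢y : u ≢ y
        u≢y refl = u∉ y∈

      δᵂ : ℕ → ℕ
      δᵂ i = W i ∸ W (suc i)

      -- As the differences `δᵂ` telescope, a vertex at distance d ≥ i from the centre receives
      -- multiplicity `W d`: a radial weight without a distance function.
      tail : ℕ → ℕ → List V
      tail i zero    = []
      tail i (suc m) = rep (δᵂ i) (Ball i) ++ tail (suc i) m

      count-tail : ∀ p i m → count p (tail i (suc m)) ≡ δᵂ i * count p (Ball i) + count p (tail (suc i) m)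
      count-tail p i m = trans (count-++ p (rep (δᵂ i) (Ball i)) (tail (suc i) m)) (cong (_+ count p (tail (suc i) m)) (count-rep p (δᵂ i) (Ball i)))

      index : ∀ {i m} → i + suc m ≡ suc r → i ≤ r × suc i + m ≡ suc r
      index {i} {m} eq = s≤s⁻¹ (subst (suc i ≤_) eq′ (m≤m+n (suc i) m)) , eq′
        where eq′ = trans (sym (+-suc i m)) eq

      empty : ∀ {i} → i + 0 ≡ suc r → W i ≡ 0
      empty {i} eq = trans (cong W (trans (sym (+-identityʳ i)) eq)) W-end

      multiplicity≤ : ∀ i m u → i + m ≡ suc r → count (eqᵇ u) (tail i m) ≤ W i
      multiplicity≤ i zero    u eq = z≤n
      multiplicity≤ i (suc m) u eq = subst (_≤ W i) (sym (count-tail (eqᵇ u) i m)) (begin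
        δᵂ i * count (eqᵇ u) (Ball i) + count (eqᵇ u) (tail (suc i) m)
          ≤⟨ +-mono-≤ (*-monoʳ-≤ (δᵂ i) (count-eq u (ball-unique i))) (multiplicity≤ (suc i) m u (proj₂ (index eq))) ⟩
        δᵂ i * 1 + W (suc i)
          ≡⟨ cong (_+ W (suc i)) (*-identityʳ (δᵂ i)) ⟩
        δᵂ i + W (suc i)
          ≡⟨ m∸n+n≡m (W-mono (proj₁ (index eq))) ⟩
        W i ∎)
        where open ≤-Reasoning

      centre-multiplicity : ∀ i m → i + m ≡ suc r → W i ≤ count (eqᵇ x) (tail i m)
      centre-multiplicity i zero    eq = ≤-reflexive (empty eq)
      centre-multiplicity i (suc m) eq = subst (W i ≤_) (sym (count-tail (eqᵇ x) i m)) (begin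
        W i
          ≡⟨ sym (m∸n+n≡m (W-mono (proj₁ (index eq)))) ⟩
        δᵂ i + W (suc i)
          ≡⟨ cong (_+ W (suc i)) (sym (*-identityʳ (δᵂ i))) ⟩
        δᵂ i * 1 + W (suc i)
          ≤⟨ +-mono-≤ (*-monoʳ-≤ (δᵂ i) (count-pos (eqᵇ x) (centre i) (eqᵇ-refl x))) (centre-multiplicity (suc i) m (proj₂ (index eq))) ⟩
        δᵂ i * count (eqᵇ x) (Ball i) + count (eqᵇ x) (tail (suc i) m) ∎)
        where open ≤-Reasoning

      far-inside : ∀ i m u → u ∈ Ball i → suc i + m ≡ suc r → κ * W (suc i) ≤ count (far u) (tail (suc i) m)
      far-inside i zero    u u∈ eq = ≤-reflexive (trans (cong (κ *_) (empty {suc i} eq)) (*-zeroʳ κ))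
      far-inside i (suc m) u u∈ eq = subst (κ * W (suc i) ≤_) (sym (count-tail (far u) (suc i) m)) (begin
        κ * W (suc i)
          ≡⟨ cong (κ *_) (sym (m∸n+n≡m (W-mono (proj₁ (index {suc i} eq))))) ⟩
        κ * (δᵂ (suc i) + W (suc (suc i)))
          ≡⟨ solve 3 (λ k d w → k :* (d :+ w) := d :* k :+ k :* w) refl κ (δᵂ (suc i)) (W (suc (suc i))) ⟩
        δᵂ (suc i) * κ + κ * W (suc (suc i))
          ≤⟨ +-mono-≤ (*-monoʳ-≤ (δᵂ (suc i)) (far-count-inside {i} u∈)) (far-inside (suc i) m u (ball-mono {i} u∈) (proj₂ (index {suc i} eq))) ⟩
        δᵂ (suc i) * count (far u) (Ball (suc i)) + count (far u) (tail (suc (suc i)) m) ∎)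
        where open ≤-Reasoning

      -- At distance d ≥ 1 a vertex sees itself, a vertex at distance d - 1 and q others no farther
      -- than d + 1. Weights decrease outwards, so these total at least
      -- `W d + W (d - 1) + q W (d + 1)`, which `W-rec` bounds below by `(1 + t) W d`.
      far-outside : ∀ i m u → ¬ u ∈ Ball i → i + m ≡ suc r → l * count (eqᵇ u) (tail i m) ≤ count (far u) (tail i m)
      far-outside i zero    u u∉ eq = ≤-reflexive (*-zeroʳ l)
      far-outside i (suc m) u u∉ eq = subst₂ (λ a b → l * a ≤ b) (sym (trans (count-tail (eqᵇ u) i m) drop)) (sym (count-tail (far u) i m))
          (step m (proj₂ (index eq)))
        where
        drop : δᵂ i * count (eqᵇ u) (Ball i) + count (eqᵇ u) (tail (suc i) m) ≡ count (eqᵇ u) (tail (suc i) m)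
        drop = cong (_+ count (eqᵇ u) (tail (suc i) m)) (trans (cong (δᵂ i *_)
          (count-none (eqᵇ u) {Ball i} (All.tabulate λ {z} z∈ → eqᵇ-≢ {u} {z} λ { refl → u∉ z∈ }))) (*-zeroʳ (δᵂ i)))
        step : ∀ m → suc i + m ≡ suc r → l * count (eqᵇ u) (tail (suc i) m) ≤ δᵂ i * count (far u) (Ball i) + count (far u) (tail (suc i) m)
        step m eq′ with any (eqᵇ u) (Ball (suc i)) in e
        ... | false = ≤-trans (far-outside (suc i) m u u∉′ eq′) (m≤n+m _ (δᵂ i * count (far u) (Ball i)))
          where
          u∉′ : ¬ u ∈ Ball (suc i)
          u∉′ u∈ = contradiction (trans (sym e) (any-intro (eqᵇ u) u∈ (eqᵇ-refl u))) λ ()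
        step zero eq′ | true = ≤-trans (≤-reflexive (*-zeroʳ l)) z≤n
        step (suc m) eq′ | true = begin
          l * count (eqᵇ u) (tail (suc i) (suc m))
            ≤⟨ *-monoʳ-≤ l (multiplicity≤ (suc i) (suc m) u eq′) ⟩
          l * W₁
            ≤⟨ +-monoʳ-≤ W₁ (W-rec (proj₁ (index {suc i} eq′))) ⟩
          W₁ + (W i + q * W₂)
            ≡⟨ cong₂ (λ a b → a + (b + q * W₂)) (sym eq₁) (sym eq₀) ⟩
          (δᵂ (suc i) + W₂) + ((δᵂ i + W₁) + q * W₂)
            ≡⟨ cong (λ b → (δᵂ (suc i) + W₂) + ((δᵂ i + b) + q * W₂)) (sym eq₁) ⟩
          (δᵂ (suc i) + W₂) + ((δᵂ i + (δᵂ (suc i) + W₂)) + q * W₂)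
            ≡⟨ solve 4 (λ d e w q → (e :+ w) :+ ((d :+ (e :+ w)) :+ q :* w) := d :* con 1 :+ (e :* con 2 :+ (con 2 :+ q) :* w)) refl (δᵂ i) (δᵂ (suc i)) W₂ q ⟩
          δᵂ i * 1 + (δᵂ (suc i) * 2 + κ * W₂)
            ≤⟨ +-mono-≤ (*-monoʳ-≤ (δᵂ i) (proj₁ boundary)) (+-mono-≤ (*-monoʳ-≤ (δᵂ (suc i)) (proj₂ boundary))
                 (far-inside (suc i) m u u∈ (proj₂ (index {suc i} eq′)))) ⟩
          δᵂ i * count (far u) (Ball i) + (δᵂ (suc i) * count (far u) (Ball (suc i)) + count (far u) (tail (suc (suc i)) m))
            ≡⟨ cong (δᵂ i * count (far u) (Ball i) +_) (sym (count-tail (far u) (suc i) m)) ⟩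
          δᵂ i * count (far u) (Ball i) + count (far u) (tail (suc i) (suc m)) ∎
          where
          open ≤-Reasoning
          W₁ = W (suc i)
          W₂ = W (suc (suc i))
          eq₀ : δᵂ i + W₁ ≡ W i
          eq₀ = m∸n+n≡m (W-mono (proj₁ (index eq)))
          eq₁ : δᵂ (suc i) + W₂ ≡ W₁
          eq₁ = m∸n+n≡m (W-mono (proj₁ (index {suc i} eq′)))
          u∈ : u ∈ Ball (suc i)
          u∈ with any-true (eqᵇ u) (Ball (suc i)) e
          ... | z , z∈ , uz = subst (_∈ Ball (suc i)) (sym (eqᵇ-≡ {u} {z} uz)) z∈
          boundary = far-count-boundary {i} u∉ u∈

      F : List V
      F = tail 0 (suc r)

      far-centre : l * count (eqᵇ x) F < count (far x) F
      far-centre = begin-strict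
        l * count (eqᵇ x) F                      ≤⟨ *-monoʳ-≤ l (multiplicity≤ 0 (suc r) x refl) ⟩
        l * W 0                                  <⟨ *-monoˡ-< (W 0) {{>-nonZero 0<W₀}} (s≤s (s≤s t≤q)) ⟩
        κ * W 0                                  ≡⟨ cong (κ *_) W₀≡W₁ ⟩
        κ * W 1                                  ≤⟨ far-inside 0 r x (here refl) refl ⟩
        count (far x) (tail 1 r)                 ≤⟨ m≤n+m _ (δᵂ 0 * count (far x) (Ball 0)) ⟩
        δᵂ 0 * count (far x) (Ball 0) + count (far x) (tail 1 r) ≡⟨ sym (count-tail (far x) 0 r) ⟩
        count (far x) F ∎
        where open ≤-Reasoning

      far-everywhere : ∀ u → l * count (eqᵇ u) F ≤ count (far u) F
      far-everywhere u with u Fin.≟ x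
      ... | yes refl = <⇒≤ far-centre
      ... | no u≢x   = far-outside 0 (suc r) u (λ { (here u≡x) → u≢x u≡x }) refl

      -- A row of `(A + l I) + (J - A) = J + l I`.
      K₁-complement : ∀ u L → K₁ u L + count (far u) L ≡ length L + l * count (eqᵇ u) L
      K₁-complement u []      = sym (*-zeroʳ l)
      K₁-complement u (z ∷ L) = begin
        (K u z + K₁ u L) + (bit (far u z) + count (far u) L)
          ≡⟨ interchange (K u z) (K₁ u L) (bit (far u z)) (count (far u) L) ⟩
        (K u z + bit (far u z)) + (K₁ u L + count (far u) L)
          ≡⟨ cong₂ _+_ (entry (eqᵇ u z) (adj u z)) (K₁-complement u L) ⟩
        (1 + l * bit (eqᵇ u z)) + (length L + l * count (eqᵇ u) L)
          ≡⟨ solve 4 (λ l b n c → (con 1 :+ l :* b) :+ (n :+ l :* c) := (con 1 :+ n) :+ l :* (b :+ c)) refl l (bit (eqᵇ u z)) (length L) (count (eqᵇ u) L) ⟩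
        suc (length L) + l * (bit (eqᵇ u z) + count (eqᵇ u) L) ∎
        where
        open ≡-Reasoning
        entry : ∀ e b → ((if e then l else 0) + (if b then 1 else 0)) + bit (not b) ≡ 1 + l * bit e
        entry true  true  = solve 1 (λ l → (l :+ con 1) :+ con 0 := con 1 :+ l :* con 1) refl l
        entry true  false = solve 1 (λ l → (l :+ con 0) :+ con 1 := con 1 :+ l :* con 1) refl l
        entry false true  = sym (cong suc (*-zeroʳ l))
        entry false false = sym (cong suc (*-zeroʳ l))

      K₁≤ : ∀ u → K₁ u F ≤ length F
      K₁≤ u = +-cancelʳ-≤ (count (far u) F) _ _ (subst (_≤ length F + count (far u) F) (sym (K₁-complement u F)) (+-monoʳ-≤ (length F) (far-everywhere u)))

      K₁< : K₁ x F < length F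
      K₁< = +-cancelʳ-< (count (far x) F) _ _ (subst (_< length F + count (far x) F) (sym (K₁-complement x F)) (+-monoʳ-< (length F) far-centre))

      centre∈F : x ∈ F
      centre∈F with pick (eqᵇ x) F 1 (≤-trans 0<W₀ (centre-multiplicity 0 (suc r) refl))
      ... | z ∷ [] , z⊆ , _ , e ∷ [] = subst (_∈ F) (sym (eqᵇ-≡ {x} {z} e)) (lookup z⊆ (here refl))

      K₂< : K₂ F F < length F * length F
      K₂< = sum-< (λ u → K₁ u F) (length F) K₁≤ centre∈F K₁<

      |verts| : length verts ≡ v
      |verts| = length-tabulate (λ i → i)

      v≡k+κ : v ≡ k + κ
      v≡k+κ = trans (sym |verts|) (trans (sym (count-not (adj x) verts)) (cong₂ _+_ (degree x) (codegree x)))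

      K₁-verts : ∀ u → K₁ u verts ≡ k + l
      K₁-verts u = +-cancelʳ-≡ κ (K₁ u verts) (k + l) (begin
        K₁ u verts + κ                          ≡⟨ cong (K₁ u verts +_) (sym (codegree u)) ⟩
        K₁ u verts + count (far u) verts        ≡⟨ K₁-complement u verts ⟩
        length verts + l * count (eqᵇ u) verts  ≡⟨ cong₂ (λ a b → a + l * b) (trans |verts| v≡k+κ)
                                                     (≤-antisym (count-eq u verts-unique) (count-pos (eqᵇ u) (∈-allFin u) (eqᵇ-refl u))) ⟩
        (k + κ) + l * 1                         ≡⟨ solve 3 (λ k c l → (k :+ c) :+ l :* con 1 := (k :+ l) :+ c) refl k κ l ⟩
        (k + l) + κ                             ∎)
        where open ≡-Reasoning

      K₂-verts : ∀ L → K₂ L verts ≡ length L * (k + l)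
      K₂-verts []      = refl
      K₂-verts (u ∷ L) = cong₂ _+_ (K₁-verts u) (K₂-verts L)

      -- Test vector: `v F - length F` times the constant vector, with coordinate sum zero.
      order-bound : v ≤ κ * (length F * length F)
      order-bound = mean-arith v k κ l (length F) (K₂ F F) {{v≢0}} v≡k+κ K₂< (subst₂ _≤_
        (cong₂ (λ a b → 2 * (v * length F * a) + 2 * (v * 0 * b)) (K₂-verts F) (K₂-[] F))
        (cong₂ (λ a b → v * v * K₂ F F + length F * length F * a + 0 * 0 * 0 + 2 * (length F * 0 * b))
          (trans (K₂-verts verts) (cong (_* (k + l)) |verts|)) (K₂-[] verts))
        (psd₃ v (length F) 0 F verts []))
        where
        v≢0 : NonZero v
        v≢0 = subst NonZero (sym (trans v≡k+κ (+-suc k (suc q)))) _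

      tail-size : ∀ i m → i + m ≡ suc r → length (tail i m) ≤ W i * κ ^ r
      tail-size i zero    eq = z≤n
      tail-size i (suc m) eq = begin
        length (rep (δᵂ i) (Ball i) ++ tail (suc i) m)
          ≡⟨ trans (length-++ (rep (δᵂ i) (Ball i))) (cong (_+ length (tail (suc i) m)) (length-rep (δᵂ i) (Ball i))) ⟩
        δᵂ i * length (Ball i) + length (tail (suc i) m)
          ≤⟨ +-mono-≤ (*-monoʳ-≤ (δᵂ i) (≤-trans (ball-size i) (^-monoʳ-≤ κ (proj₁ (index eq))))) (tail-size (suc i) m (proj₂ (index eq))) ⟩
        δᵂ i * κ ^ r + W (suc i) * κ ^ r
          ≡⟨ sym (*-distribʳ-+ (κ ^ r) (δᵂ i) (W (suc i))) ⟩
        (δᵂ i + W (suc i)) * κ ^ r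
          ≡⟨ cong (_* κ ^ r) (m∸n+n≡m (W-mono (proj₁ (index eq)))) ⟩
        W i * κ ^ r ∎
        where open ≤-Reasoning

      order-bound′ : v ≤ κ * ((W 0 * κ ^ r) * (W 0 * κ ^ r))
      order-bound′ = ≤-trans order-bound (*-monoʳ-≤ κ (*-mono-≤ size size))
        where
        size : length F ≤ W 0 * κ ^ r
        size = tail-size 0 (suc r) refl

  ∣tabulate∣ : ∀ {n} {A : Set} (p : A → Bool) (f : Fin n → A) → ∣ Vec.tabulate (λ i → p (f i)) ∣ ≡ count p (tabulate f)
  ∣tabulate∣ {zero}  p f = refl
  ∣tabulate∣ {suc n} p f with p (f zero)
  ... | true  = cong suc (∣tabulate∣ p (λ i → f (suc i)))
  ... | false = ∣tabulate∣ p (λ i → f (suc i))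

  tabulate-∩ : ∀ {n} (f g : Fin n → Bool) → Vec.tabulate f ∩ Vec.tabulate g ≡ Vec.tabulate (λ i → f i ∧ g i)
  tabulate-∩ {zero}  f g = refl
  tabulate-∩ {suc n} f g = cong (f zero ∧ g zero Vec.∷_) (tabulate-∩ (λ i → f (suc i)) (λ i → g (suc i)))

  -- A sum in place of a maximum. The codegree is known only to be at most `D`, so `C` has to
  -- dominate the order bound for every such value.
  upper : (ℕ → ℕ) → ℕ → ℕ
  upper f zero    = f 0
  upper f (suc n) = f (suc n) + upper f n

  f≤upper : ∀ f {i n} → i ≤ n → f i ≤ upper f n
  f≤upper f {i} {n} i≤n = below (≤⇒≤′ i≤n)
    where
    first : ∀ n → f n ≤ upper f n
    first zero    = ≤-refl
    first (suc n) = m≤m+n (f (suc n)) (upper f n)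
    below : ∀ {n} → i ≤′ n → f i ≤ upper f n
    below ≤′-refl         = first i
    below (≤′-step i≤′n) = ≤-trans (below i≤′n) (m≤n+m _ (f _))

  -- Choice of the constants and final case distinction.

  module Thresholds (t : ℕ) where
    open Constants t

    -- The bound of `order-bound′` for the weights of `Profile`, with r = 4 q² and `W 0 = q ^ r`.
    orderBound : ℕ → ℕ
    orderBound q = suc (suc q) * ((q ^ (4 * q * q) * suc (suc q) ^ (4 * q * q)) * (q ^ (4 * q * q) * suc (suc q) ^ (4 * q * q)))

    -- Abstract, because unfolding the Ramsey numbers is expensive.
    abstract
      q M m₀ m₁ C : ℕ
      q  = q₀ + (q₁ + q₂)
      M  = ram′ q + suc D
      m₀ = q₀ + (M + suc h)
      m₁ = m₀ + ((1 + (l * (t * l) + ram′ m₀)) + (1 + (a + ram′ m₀ * (t * l))))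
      C  = ram′ m₁ + upper orderBound D

      q₀≤q : q₀ ≤ q
      q₀≤q = m≤m+n q₀ (q₁ + q₂)

      q₁≤q : q₁ ≤ q
      q₁≤q = ≤-trans (m≤m+n q₁ q₂) (m≤n+m (q₁ + q₂) q₀)

      q₂≤q : q₂ ≤ q
      q₂≤q = ≤-trans (m≤n+m q₂ q₁) (m≤n+m (q₁ + q₂) q₀)

      ram≤M : ram′ q ≤ M
      ram≤M = m≤m+n (ram′ q) (suc D)

      D<M : D < M
      D<M = m≤n+m (suc D) (ram′ q)

      q₀≤m₀ : q₀ ≤ m₀
      q₀≤m₀ = m≤m+n q₀ (M + suc h)

      M+h<m₀ : M + suc h ≤ m₀
      M+h<m₀ = m≤n+m (M + suc h) q₀

      m₀≤m₁ : m₀ ≤ m₁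
      m₀≤m₁ = m≤m+n m₀ _

      room₁ : 1 + (l * (t * l) + ram′ m₀) ≤ m₁
      room₁ = ≤-trans (m≤m+n _ (1 + (a + ram′ m₀ * (t * l)))) (m≤n+m _ m₀)

      room₂ : 1 + (a + ram′ m₀ * (t * l)) ≤ m₁
      room₂ = ≤-trans (m≤n+m _ (1 + (l * (t * l) + ram′ m₀))) (m≤n+m _ m₀)

      ram≤C : ram′ m₁ ≤ C
      ram≤C = m≤m+n (ram′ m₁) _

      orderBound≤C : ∀ {i} → i ≤ D → orderBound i ≤ C
      orderBound≤C i≤D = ≤-trans (f≤upper orderBound i≤D) (m≤n+m (upper orderBound D) (ram′ m₁))

  module Dichotomy {v : ℕ} (G : Graph v) (t : ℕ) .{{_ : NonZero t}}
    (psd : Weight.Semidefinite G (suc t))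
    (k c : ℕ) (connected : Connected G) (sesqui : SesquiRegular G k c) where
    open Graph G
    open Sesqui G t psd
    open Thresholds t

    degree : ∀ x → count (adj x) verts ≡ k
    degree x = trans (sym (∣tabulate∣ (adj x) (λ i → i))) (SesquiRegular.regular sesqui x)

    d2⇒Distance : ∀ {x y} → d2 x y ≡ true → Distance G x y 2
    d2⇒Distance {x} {y} xy with d2-elim xy
    ... | nxy , z , xz , zy = cons xz (cons zy nil) , shortest
      where
      shortest : ∀ n → Walk G n x y → 2 ≤ n
      shortest zero          nil           = contradiction refl (nadj⇒≢ nxy)
      shortest (suc zero)    (cons xy nil) = contradiction (trans (sym xy) (nadj⇒¬adj nxy)) λ ()
      shortest (suc (suc n)) _             = s≤s (s≤s z≤n)

    common-count : ∀ {x y} → d2 x y ≡ true → count (common x y) verts ≡ c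
    common-count {x} {y} xy = trans (sym (∣tabulate∣ (common x y) (λ i → i)))
      (trans (cong ∣_∣ (sym (tabulate-∩ (adj x) (adj y)))) (SesquiRegular.common sesqui x y (d2⇒Distance xy)))

    -- The bound on `c` refers to a given pair at distance 2; an edge leaving the closed
    -- neighbourhood of `x` provides one.
    pair-at-distance-two : ∀ x → 0 < count (nadj x) verts → ∃ λ y → d2 x y ≡ true
    pair-at-distance-two x pos with pick (nadj x) verts 1 pos
    ... | z ∷ [] , _ , _ , xz ∷ [] with walk-exit G (λ u → not (nadj x u)) (proj₂ (connected x z))
            (cong (λ b → not (not (b ∨ adj x x))) (eqᵇ-refl x)) (cong not xz)
    ...   | b , b′ , bb′ , xb , xb′ with nadj-false (not-true xb)
    ...     | inj₁ refl = contradiction (trans (sym bb′) (nadj⇒¬adj (not-false xb′))) λ ()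
    ...     | inj₂ adj-xb = b′ , d2-intro (not-false xb′) adj-xb bb′

    bounded-when-c-small : c < M → C ≤ k → ∀ {x y} → d2 x y ≡ true → c ≤ l * (t * l)
    bounded-when-c-small c<M C≤k = Lines.SmallCommon.common-count-bound G t psd m₀ m₁ c k
      q₀≤m₀ (≤-trans (+-monoˡ-≤ (suc h) c<M) M+h<m₀) m₀≤m₁ room₁ room₂ (≤-trans ram≤C C≤k) degree common-count

    codegree-bounded-when-c-large : M ≤ c → ∀ x → count (nadj x) verts ≤ D
    codegree-bounded-when-c-large M≤c = LargeCommon.nonneighbour-count q c
      q₀≤q q₁≤q q₂≤q (≤-trans ram≤M M≤c) (≤-trans D<M M≤c) common-count connected

    order : ∀ x → suc k + count (nadj x) verts ≡ v
    order x = trans (trans (sym (cong₂ (λ e n → e + (n + count (nadj x) verts)) one (degree x))) (count-trichotomy x verts)) (length-tabulate (λ i → i))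
      where
      one : count (eqᵇ x) verts ≡ 1
      one = ≤-antisym (count-eq x verts-unique) (subst (_≤ count (eqᵇ x) verts) (count-all (eqᵇ x) (eqᵇ-refl x ∷ []))
        (count-unique (eqᵇ x) (eqᵇ x) {[ x ]} ([] ∷ []) (λ {z} _ e → ∈-allFin z , e)))

    order-bounded : ∀ x q′ → count (nadj x) verts ≡ suc q′ → t * t < 4 * q′ → v ≤ orderBound q′
    order-bounded x q′ k′≡ t²<4q = subst (λ w → v ≤ suc (suc q′) * ((w * suc (suc q′) ^ r) * (w * suc (suc q′) ^ r))) W₀≡q^r
      (AlonBoppana.order-bound′ G t psd k q′ r W W-mono W-rec W-end W₀≡W₁ 0<W₀ s≤q degree codegree x)
      where
      open Profile t q′ t²<4q
      codegree : ∀ u → count (λ z → not (adj u z)) verts ≡ suc (suc q′)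
      codegree u = +-cancelˡ-≡ k _ _ (begin
        k + count (λ z → not (adj u z)) verts                   ≡⟨ cong (_+ count (λ z → not (adj u z)) verts) (sym (degree u)) ⟩
        count (adj u) verts + count (λ z → not (adj u z)) verts ≡⟨ count-not (adj u) verts ⟩
        length verts                                            ≡⟨ length-tabulate (λ i → i) ⟩
        v                                                       ≡⟨ sym (order x) ⟩
        suc k + count (nadj x) verts                            ≡⟨ cong (suc k +_) k′≡ ⟩
        suc k + suc q′                                          ≡⟨ sym (+-suc k (suc q′)) ⟩
        k + suc (suc q′)                                        ∎)
        where open ≡-Reasoning

    -- If `M ≤ c`, the codegree is at most `D`, and its order bound contradicts `C ≤ k < v`. So
    -- `c < M`, and the argument with lines applies.
    large-codegree⇒c-bounded : C ≤ k → ∀ x q′ → count (nadj x) verts ≡ suc q′ → t * t < 4 * q′ → c ≤ l * (t * l)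
    large-codegree⇒c-bounded C≤k x q′ k′≡ t²<4q with M ≤? c
    ... | no M≰c with pair-at-distance-two x (subst (0 <_) (sym k′≡) (s≤s z≤n))
    ...   | y , xy = bounded-when-c-small (≰⇒> M≰c) C≤k xy
    large-codegree⇒c-bounded C≤k x q′ k′≡ t²<4q | yes M≤c = contradiction (begin-strict
      v                   ≤⟨ order-bounded x q′ k′≡ t²<4q ⟩
      orderBound q′       ≤⟨ orderBound≤C (≤-trans (n≤1+n q′) (subst (_≤ D) k′≡ (codegree-bounded-when-c-large M≤c x))) ⟩
      C                   ≤⟨ C≤k ⟩
      k                   <⟨ subst (suc k ≤_) (order x) (m≤m+n (suc k) _) ⟩
      v                   ∎) (<-irrefl refl)
      where open ≤-Reasoning

    dichotomy-at : C ≤ k → V → c ≤ l * (t * l) ⊎ Σ ℕ λ k′ → v ≤ suc k + k′ × 4 * k′ ≤ t * t + 4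
    dichotomy-at C≤k x with 4 * count (nadj x) verts ≤? t * t + 4
    ... | yes small = inj₂ (count (nadj x) verts , ≤-reflexive (sym (order x)) , small)
    ... | no  large with count (nadj x) verts in k′≡
    ...   | zero   = contradiction z≤n large
    -- Failure of the second alternative is `t² + 4 < 4 (q′ + 1)`; cancelling 4 gives the condition
    -- of `Profile`.
    ...   | suc q′ = inj₁ (large-codegree⇒c-bounded C≤k x q′ k′≡
              (+-cancelʳ-< 4 (t * t) (4 * q′) (subst (t * t + 4 <_) (trans (*-suc 4 q′) (+-comm 4 (4 * q′))) (≰⇒> large))))

  dichotomy : ∀ {v} (G : Graph v) t .{{_ : NonZero t}} →
    (∀ X Y → Weight.K₂ G (suc t) X Y + Weight.K₂ G (suc t) Y X ≤ Weight.K₂ G (suc t) X X + Weight.K₂ G (suc t) Y Y) →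
    ∀ k c → Connected G → SesquiRegular G k c → Thresholds.C t ≤ k →
    c ≤ suc t * (t * suc t) ⊎ Σ ℕ λ k′ → v ≤ suc k + k′ × 4 * k′ ≤ t * t + 4
  dichotomy {zero}  G t psd k c connected sesqui C≤k = inj₂ (0 , z≤n , z≤n)
  dichotomy {suc v} G t psd k c connected sesqui C≤k = Dichotomy.dichotomy-at G t psd k c connected sesqui C≤k zero

open import Data.Nat.Base as ℕ using (ℕ; suc; s≤s)
import Data.Nat.Properties as ℕ
import Data.Nat.Solver as ℕ
open import Data.Integer.Base as ℤ using (+_)
import Data.Integer.Properties as ℤ
import Data.Integer.Solver as ℤ
open import Data.Rational.Base as ℚ using (1ℚ)
import Data.Rational.Properties as ℚ
import Data.Rational.Unnormalised.Base as ℚᵘ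
import Data.Rational.Unnormalised.Properties as ℚᵘ
open import Data.Product.Base using (Σ; _,_; _×_)
open import Data.Sum.Base using (_⊎_; inj₁; inj₂)
open import Relation.Binary.PropositionalEquality using (refl; trans; cong; subst; subst₂)
open SmallestEigenvalue
open WeightForm
open Combinatorics

-- Translation into integers and rationals.

excess-bound : ∀ v k k′ → v ℕ.≤ suc k ℕ.+ k′ → + v ℤ.- + k ℤ.- + 1 ℤ.≤ + k′
excess-bound v k k′ v≤ = subst (+ v ℤ.- + k ℤ.- + 1 ℤ.≤_)
  (solve 2 (λ k k′ → ((con (+ 1) :+ k) :+ k′) :- k :- con (+ 1) := k′) refl (+ k) (+ k′))
  (ℤ.+-monoˡ-≤ (ℤ.- (+ 1)) (ℤ.+-monoˡ-≤ (ℤ.- (+ k)) (ℤ.+≤+ v≤)))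
  where open ℤ.+-*-Solver

-- Compared as unnormalised fractions, where cross-multiplication leaves an inequality between
-- integers.
quarter-bound : ∀ x t k′ → x ℤ.≤ + k′ → 4 ℕ.* k′ ℕ.≤ t ℕ.* t ℕ.+ 4 →
  x ℚ./ 1 ℚ.≤ (((+ t) ℤ.^ 2) ℚ./ 4) ℚ.+ 1ℚ
quarter-bound x t k′ x≤k′ 4k′≤ = ℚ.toℚᵘ-cancel-≤ (begin
  ℚ.toℚᵘ (x ℚ./ 1)                               ≃⟨ ℚ.toℚᵘ-fromℚᵘ (ℚᵘ.mkℚᵘ x 0) ⟩
  ℚᵘ.mkℚᵘ x 0                                    ≤⟨ ℚᵘ.*≤* cross ⟩
  ℚᵘ.mkℚᵘ y 3 ℚᵘ.+ ℚᵘ.1ℚᵘ                        ≃⟨ ℚᵘ.+-congˡ ℚᵘ.1ℚᵘ (ℚᵘ.≃-sym (ℚ.toℚᵘ-fromℚᵘ (ℚᵘ.mkℚᵘ y 3))) ⟩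
  ℚ.toℚᵘ (y ℚ./ 4) ℚᵘ.+ ℚ.toℚᵘ 1ℚ                ≃⟨ ℚᵘ.≃-sym (ℚ.toℚᵘ-homo-+ (y ℚ./ 4) 1ℚ) ⟩
  ℚ.toℚᵘ ((y ℚ./ 4) ℚ.+ 1ℚ)                      ∎)
  where
  open ℚᵘ.≤-Reasoning
  y = (+ t) ℤ.^ 2
  cross : x ℤ.* + 4 ℤ.≤ (y ℤ.* + 1 ℤ.+ + 1 ℤ.* + 4) ℤ.* + 1
  cross = ℤ.≤-trans (ℤ.*-monoʳ-≤-nonNeg (+ 4) x≤k′) (subst₂ ℤ._≤_
    (trans (cong +_ (ℕ.*-comm 4 k′)) (ℤ.pos-* k′ 4))
    (trans (cong (ℤ._+ + 4) (ℤ.pos-* t t))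
      (solve 1 (λ t → t :* t :+ con (+ 4) := ((t :* (t :* con (+ 1))) :* con (+ 1) :+ con (+ 1) :* con (+ 4)) :* con (+ 1)) refl (+ t)))
    (ℤ.+≤+ 4k′≤))
    where open ℤ.+-*-Solver

theorem1p5 : (l : ℕ) → 2 ℕ.≤ l →
    Σ ℕ λ C →
    (v k c : ℕ) (G : Graph v) →
    Connected G →
    SesquiRegular G k c →
    (λmin : ℝ) → IsSmallestEigenvalue (adjacencyMatrix G) λmin →
    fromℤ (ℤ.- (+ l)) ≤ᴿ λmin →
    C ℕ.≤ k →
    (c ℕ.≤ (l ℕ.^ 2) ℕ.* (l ℕ.∸ 1))
    ⊎ ((+ v ℤ.- + k ℤ.- + 1) ℚ./ 1 ℚ.≤ (((+ l ℤ.- + 1) ℤ.^ 2) ℚ./ 4) ℚ.+ 1ℚ)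
theorem1p5 (suc ℕ.zero) (s≤s ())
-- Matching `t` against a successor supplies `NonZero t`, by which `split-arith` can cancel.
theorem1p5 l@(suc t@(suc _)) _ = Thresholds.C t , λ v k c G connected sesqui λmin least -l≤λmin C≤k →
  conclude v k c (dichotomy G t (K₂-psd G l (psd-of-smallestEigenvalue G l λmin least -l≤λmin)) k c connected sesqui C≤k)
  where
  -- As `l` is `suc t`, the terms `l ∸ 1` and `+ l ℤ.- + 1` of the theorem compute to `t` and `+ t`.
  conclude : ∀ v k c → c ℕ.≤ l ℕ.* (t ℕ.* l) ⊎ (Σ ℕ λ k′ → v ℕ.≤ suc k ℕ.+ k′ × 4 ℕ.* k′ ℕ.≤ t ℕ.* t ℕ.+ 4) →
    (c ℕ.≤ (l ℕ.^ 2) ℕ.* t) ⊎ ((+ v ℤ.- + k ℤ.- + 1) ℚ./ 1 ℚ.≤ (((+ t) ℤ.^ 2) ℚ./ 4) ℚ.+ 1ℚ)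
  conclude v k c (inj₁ c≤) = inj₁ (subst (c ℕ.≤_) (solve 2 (λ l t → l :* (t :* l) := (l :* (l :* con 1)) :* t) refl l t) c≤)
    where open ℕ.+-*-Solver
  conclude v k c (inj₂ (k′ , v≤ , 4k′≤)) = inj₂ (quarter-bound _ t k′ (excess-bound v k k′ v≤) 4k′≤)
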